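{- Let $G$ be a finite graph in which three edges $e_1,e_2,e_3\in E(G)$ form a triangle. Let $A=G-e_1$, $B=G-e_2$, and $A\cap B=G-e_1-e_2$. Then there is a long exact sequence $$\cdots\to H_i(A\cap B)\xrightarrow{\ \varphi\ }H_i(A)\oplus H_i(B)\xrightarrow{\ \psi\ }H_i(G)\xrightarrow{\ \delta\ }H_{i-1}(A\cap B)\to\cdots\to H_0(G)\to 0$$ of chromatic symmetric homology modules, where $\varphi$ and $\psi$ are induced by the chain-level maps $x\mapsto(x,-x)$ and $(a,b)\mapsto a+b$.
   Context: Graphs are finite; loops and multiple edges are allowed. $V=V(G)=\{v_1,\dots,v_n\}$, $E=E(G)$, with a fixed enumeration of the $m$ edges; $G-e$ denotes deletion of the edge $e$ (same vertex set, inherited edge order). Three edges form a triangle if they join pairwise three distinct vertices. $\mathfrak S_V\cong\mathfrak S_n$ is the symmetric group on $V$; representations are over $\mathbb C$; $\mathcal S^\lambda$ is the Specht module indexed by $\lambda\vdash n$. States and modules. A state of $G$ is a spanning subgraph, identified with its edge set $F\subseteq E$. For $a\ge1$ let $\mathcal L_a=\bigoplus_{i=0}^{a-1}\mathcal S^{(a-i,1^i)}$, graded with $\mathcal S^{(a-i,1^i)}$ in degree $i$; equivalently $\mathcal L_a\cong\bigwedge^*\mathcal S^{(a-1,1)}$ with the exterior grading (for $a=1$ put $\mathcal S^{(0,1)}=0$). If the connected components of $(V,F)$ have vertex sets $B_1,\dots,B_r$ of sizes $b_1,\dots,b_r$, let $\mathfrak S_F=\mathfrak S_{B_1}\times\cdots\times\mathfrak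 S_{B_r}$ and $\mathcal M_F=\mathrm{Ind}_{\mathfrak S_F}^{\mathfrak S_V}(\mathcal L_{b_1}\otimes\cdots\otimes\mathcal L_{b_r})$, a graded $\mathfrak S_V$-module. Concretely: realise $\mathcal S^{(b-1,1)}$ for a $b$-element set $B$ as $W_B=\{x\in\mathbb C^B:\sum_{v\in B}x_v=0\}$, put $W_F=\bigoplus_kW_{B_k}\subseteq\mathbb C^V$; then $\mathcal L_{b_1}\otimes\cdots\otimes\mathcal L_{b_r}=\bigwedge^*W_F$ and $\mathcal M_F=\mathbb C[\mathfrak S_V]\otimes_{\mathbb C[\mathfrak S_F]}\bigwedge^*W_F$. Chain modules: $C_{i,j}(G)=\bigoplus_{|F|=i}(\mathcal M_F)_j$, $C_i(G)=\bigoplus_jC_{i,j}(G)$. For a spanning subgraph $A$ of $G$, states of $A$ are states of $G$, so $C_i(A)\subseteq C_i(G)$. Per-edge maps: let $F'=F-e$ with $e\in F$; write $\varepsilon$ for the corresponding edge of the Boolean lattice of states. If $F$ and $F'$ have the same components, $d_\varepsilon:\mathcal M_F\to\mathcal M_{F'}$ is the identity. Otherwise a component of $F$ splits into two components $P,Q$ of $F'$. In the case that $F$ has only one component, $\mathrm{Res}_{\mathfrak S_P\times\mathfrak S_Q}W_V=\mathcal T\oplus\mathbf 1$ with $\mathcal T=W_P\oplus W_Q$ and $\mathbf 1$ trivial, so $\mathrm{Res}\,\bigwedge^*W_V=\bigwedge^*\mathcal T\oplus(\bigwedge^*\mathcal T)[1]$, where $(\bigwedge^*\mathcal T)[1]=\bigwedge^*\mathcal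 T\wedge\mathbf 1$, and $d_\varepsilon$ is the map corresponding under Frobenius reciprocity to the $(\mathfrak S_P\times\mathfrak S_Q)$-map that is the identity on $\bigwedge^*\mathcal T$ and zero on $(\bigwedge^*\mathcal T)[1]$. In general $d_\varepsilon$ is obtained by tensoring this map with the identity on the factors of the other components and inducing to $\mathfrak S_V$. Explicitly, $d_\varepsilon(g\otimes x)=\sum_{h\in\mathfrak S_F/\mathfrak S_{F'}}gh\otimes(\bigwedge^*\pi)(h^{ -1}x)$, where $\pi:W_F\to W_{F'}$ is the orthogonal projection. Signs and differential: encode $F$ by the binary string $z_1\cdots z_m$ with $z_i=1$ if the $i$th edge is in $F$ and $z_i=0$ otherwise. If $e$ is the $k$th edge, $\mathrm{sgn}(\varepsilon)=(-1)^{s}$, where $s$ is the number of ones in positions after the $k$th. Set $d_i=\sum_\varepsilon\mathrm{sgn}(\varepsilon)d_\varepsilon:C_i(G)\to C_{i-1}(G)$, the sum over all $\varepsilon$ from a state with $i$ edges to one with $i-1$ edges, and $d_{i,j}:C_{i,j}(G)\to C_{i-1,j}(G)$ its degree $j$ part. Homology: $H_{i,j}(G)=\ker d_{i,j}/\mathrm{im}\,d_{i+1,j}$ and $H_i(G)=\bigoplus_{j\ge0}H_{i,j}(G)$. -}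

module Defs where

open import Algebra.Bundles using (CommutativeRing; CommutativeMonoid)
import Algebra.Definitions.RawMonoid as RawMonoidDefs
open import Algebra.Module.Bundles using (LeftModule)
import Algebra.Module.Construct.DirectProduct as DirectProduct
import Algebra.Module.Construct.TensorUnit as TensorUnit
import Algebra.Module.Construct.Zero as Zero
open import Algebra.Module.Morphism.Structures using (IsLeftModuleHomomorphism)
open import Algebra.Structures using (IsCommutativeRing)
open import Data.Bool.Base using (Bool; true; false; if_then_else_)
open import Data.Fin.Base using (Fin; zero; suc; punchIn)
open import Data.Fin.Permutation as Perm using (Permutation′; _⟨$⟩ʳ_; _⟨$⟩ˡ_; _∘ₚ_)
open import Data.Fin.Properties as Fin using (all?)
open import Data.Fin.Subset using (Subset; _∈_; _⊆_; _∪_; ⁅_⁆; ⊤; ∣_∣) renaming (_-_ to _∖_)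
open import Data.Fin.Subset.Properties using (_∈?_; p⊆p∪q; ∪-identityʳ; p─q⊆p; p─x─y≡p─y─x)
open import Data.List.Base using (List; []; _∷_; allFin; cartesianProductWith; deduplicate; filter; map)
open import Data.List.Membership.Propositional using () renaming (_∈_ to _∈ₗ_)
open import Data.List.Membership.Propositional.Properties
  using (∈-allFin; ∈-filter⁺; ∈-filter⁻; ∈-map⁺; ∈-map⁻)
open import Data.List.Relation.Unary.All as All using (All; []; _∷_)
import Data.List.Relation.Unary.All.Properties as Allₚ
open import Data.List.Relation.Unary.AllPairs as AllPairs using (AllPairs; []; _∷_)
import Data.List.Relation.Unary.AllPairs.Properties as AllPairsₚ
open import Data.List.Relation.Unary.Any as Any using (Any; here; there)
import Data.List.Relation.Unary.Any.Properties as Anyₚ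
open import Data.List.Relation.Unary.Unique.DecSetoid.Properties using (deduplicate-!)
open import Data.Nat.Base as ℕ using (ℕ; zero; suc)
import Data.Nat.Properties as ℕₚ
open import Data.Product using (Σ-syntax; ∃-syntax; _×_; _,_; proj₁; proj₂)
open import Data.Rational.Base as ℚ using (ℚ; 0ℚ; 1ℚ)
import Data.Rational.Properties as ℚₚ
import Data.Rational.Solver
open import Data.Sum.Base using (_⊎_; inj₁; inj₂)
open import Data.Vec.Base as Vec using (Vec; _∷_; lookup; tabulate; _[_]≔_; here; there)
import Data.Vec.Properties as Vecₚ
open import Data.Vec.Relation.Binary.Pointwise.Inductive as Pointwise using (Pointwise)
open import Function.Base using (_∘_; _$_; id)
open import Function.Bundles using (_⇔_; mk⇔)
open import Level using (0ℓ)
open import Relation.Binary.Construct.Closure.Equivalence as EqClosure using (EqClosure)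
open import Relation.Binary.Construct.Closure.ReflexiveTransitive using (_◅_; _◅◅_) renaming (ε to stop)
open import Relation.Binary.Construct.Closure.Symmetric using (fwd; bwd)
open import Relation.Binary.Core using (Rel)
open import Relation.Binary.PropositionalEquality.Core as ≡ using (_≡_; _≢_)
open import Relation.Binary.Structures using (IsDecEquivalence)
open import Relation.Nullary.Decidable
  using (Dec; yes; no; does; ¬?; dec-true; dec-false; does-⇔; map′; _×-dec_; _⊎-dec_)
open import Relation.Nullary.Negation using (¬_; contradiction)

------------------------------------------------------------------------
-- ℝ: Cauchy sequences of rationals modulo null sequences.

module Reals where

  open Data.Rational.Solver.+-*-Solver using (solve; :-_; _:+_; _:-_; _:*_; _:=_)

  record ℝ : Set where
    field
      seq    : ℕ → ℚ
      cauchy : ∀ ε → 0ℚ ℚ.< ε →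
               ∃[ N ] (∀ m n → N ℕ.≤ m → N ℕ.≤ n → ℚ.∣ seq m ℚ.- seq n ∣ ℚ.< ε)

  open ℝ public

  infix 4 _≈_

  record _≈_ (x y : ℝ) : Set where
    constructor null
    field
      difference : ∀ ε → 0ℚ ℚ.< ε →
                   ∃[ N ] (∀ n → N ℕ.≤ n → ℚ.∣ seq x n ℚ.- seq y n ∣ ℚ.< ε)

  -- Null and bounded families over an index type I in which "i is beyond N"
  -- is given by after; used for sequences and for double sequences.
  private
    module Null {I : Set} (after : ℕ → I → Set)
                (antitone : ∀ {M N i} → M ℕ.≤ N → after N i → after M i) where

      Null : (I → ℚ) → Set
      Null f = ∀ ε → 0ℚ ℚ.< ε → ∃[ N ] (∀ i → after N i → ℚ.∣ f i ∣ ℚ.< ε)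

      Bounded : (I → ℚ) → Set
      Bounded f = ∃[ B ] (0ℚ ℚ.< B × ∃[ N ] (∀ i → after N i → ℚ.∣ f i ∣ ℚ.< B))

      null-cong : ∀ {f g} → (∀ i → f i ≡ g i) → Null f → Null g
      null-cong f≗g f→0 ε 0<ε with f→0 ε 0<ε
      ... | N , h = N , λ i a → ≡.subst (λ q → ℚ.∣ q ∣ ℚ.< ε) (f≗g i) (h i a)

      null-0 : ∀ {f} → (∀ i → f i ≡ 0ℚ) → Null f
      null-0 f≗0 ε 0<ε = 0 , λ i _ → ≡.subst (λ q → ℚ.∣ q ∣ ℚ.< ε) (≡.sym (f≗0 i)) 0<ε

      null-- : ∀ {f} → Null f → Null (λ i → ℚ.- f i)
      null-- {f} f→0 ε 0<ε with f→0 ε 0<ε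
      ... | N , h = N , λ i a → ≡.subst (ℚ._< ε) (≡.sym (ℚₚ.∣-p∣≡∣p∣ (f i))) (h i a)

      null-+ : ∀ {f g} → Null f → Null g → Null (λ i → f i ℚ.+ g i)
      null-+ {f} {g} f→0 g→0 ε 0<ε = N , λ i a → ℚₚ.≤-<-trans
          (ℚₚ.∣p+q∣≤∣p∣+∣q∣ (f i) (g i))
          (≡.subst (ℚ.∣ f i ∣ ℚ.+ ℚ.∣ g i ∣ ℚ.<_) eq
            (ℚₚ.+-mono-< (proj₂ F i (antitone (ℕₚ.m≤m⊔n (proj₁ F) (proj₁ G)) a))
                         (proj₂ G i (antitone (ℕₚ.m≤n⊔m (proj₁ F) (proj₁ G)) a))))
        where
        instance _ = ℚ.positive 0<ε
        δ = ℚ.½ ℚ.* ε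
        0<δ : 0ℚ ℚ.< δ
        0<δ = ℚₚ.positive⁻¹ δ ⦃ ℚₚ.pos*pos⇒pos ℚ.½ ε ⦄
        F = f→0 δ 0<δ
        G = g→0 δ 0<δ
        N = proj₁ F ℕ.⊔ proj₁ G
        eq : δ ℚ.+ δ ≡ ε
        eq = ≡.trans (≡.sym (ℚₚ.*-distribʳ-+ ε ℚ.½ ℚ.½)) (ℚₚ.*-identityˡ ε)

      null-* : ∀ {f g} → Bounded f → Null g → Null (λ i → f i ℚ.* g i)
      null-* {f} {g} (B , 0<B , M , f<B) g→0 ε 0<ε = N , λ i a →
          ≡.subst₂ ℚ._<_ (≡.sym (ℚₚ.∣p*q∣≡∣p∣*∣q∣ (f i) (g i))) eq (bound i a)
        where
        instance
          _ = ℚ.positive 0<ε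
          B⁺ = ℚ.positive 0<B
          B≠0 = ℚₚ.pos⇒nonZero B
          B⁻¹⁺ = ℚₚ.1/pos⇒pos B
        δ = ℚ.1/ B ℚ.* ε
        δ⁺ = ℚₚ.pos*pos⇒pos (ℚ.1/ B) ε
        0<δ : 0ℚ ℚ.< δ
        0<δ = ℚₚ.positive⁻¹ δ ⦃ δ⁺ ⦄
        G = g→0 δ 0<δ
        N = M ℕ.⊔ proj₁ G
        eq : B ℚ.* δ ≡ ε
        eq = ≡.trans (≡.sym (ℚₚ.*-assoc B (ℚ.1/ B) ε))
             (≡.trans (≡.cong (ℚ._* ε) (ℚₚ.*-inverseʳ B)) (ℚₚ.*-identityˡ ε))
        bound : ∀ i → after N i → ℚ.∣ f i ∣ ℚ.* ℚ.∣ g i ∣ ℚ.< B ℚ.* δ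
        bound i a = ℚₚ.≤-<-trans
          (ℚₚ.*-monoʳ-≤-nonNeg ℚ.∣ g i ∣ ⦃ ℚ.nonNegative (ℚₚ.0≤∣p∣ (g i)) ⦄
            (ℚₚ.<⇒≤ (f<B i (antitone (ℕₚ.m≤m⊔n M (proj₁ G)) a))))
          (ℚₚ.*-monoʳ-<-pos B (proj₂ G i (antitone (ℕₚ.m≤n⊔m M (proj₁ G)) a)))

    module N₁ = Null ℕ._≤_ ℕₚ.≤-trans
    module N₂ = Null (λ N ((m , n) : ℕ × ℕ) → N ℕ.≤ m × N ℕ.≤ n)
                     (λ M≤N (p , q) → ℕₚ.≤-trans M≤N p , ℕₚ.≤-trans M≤N q)

    Δ : (ℕ → ℚ) → ℕ × ℕ → ℚ
    Δ f (m , n) = f m ℚ.- f n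

    fromNull : (f : ℕ → ℚ) → N₂.Null (Δ f) → ℝ
    fromNull f h = record
      { seq    = f
      ; cauchy = λ ε 0<ε → let (N , b) = h ε 0<ε in N , λ m n p q → b (m , n) (p , q)
      }

    toNull : ∀ x → N₂.Null (Δ (seq x))
    toNull x ε 0<ε = let (N , b) = cauchy x ε 0<ε in N , λ (m , n) (p , q) → b m n p q

    bounded : ∀ x → N₁.Bounded (seq x)
    bounded x = ℚ.∣ xN ∣ ℚ.+ 1ℚ
              , ℚₚ.+-mono-≤-< (ℚₚ.0≤∣p∣ xN) 0<1
              , N , λ n N≤n → ℚₚ.≤-<-trans
                  (≡.subst (λ q → ℚ.∣ q ∣ ℚ.≤ ℚ.∣ xN ∣ ℚ.+ ℚ.∣ seq x n ℚ.- xN ∣)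
                    (solve 2 (λ a b → a :+ (b :- a) := b) ≡.refl xN (seq x n))
                    (ℚₚ.∣p+q∣≤∣p∣+∣q∣ xN (seq x n ℚ.- xN)))
                  (ℚₚ.+-mono-≤-< (ℚₚ.≤-refl {ℚ.∣ xN ∣}) (proj₂ C n N N≤n ℕₚ.≤-refl))
      where
      0<1 : 0ℚ ℚ.< 1ℚ
      0<1 = ℚₚ.positive⁻¹ 1ℚ
      C = cauchy x 1ℚ 0<1
      N = proj₁ C
      xN = seq x N

    bounded₁ : ∀ x → N₂.Bounded (λ (m , _) → seq x m)
    bounded₁ x = let (B , 0<B , N , b) = bounded x in B , 0<B , N , λ (m , _) (p , _) → b m p

    bounded₂ : ∀ x → N₂.Bounded (λ (_ , n) → seq x n)
    bounded₂ x = let (B , 0<B , N , b) = bounded x in B , 0<B , N , λ (_ , n) (_ , p) → b n p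

  ι : ℚ → ℝ
  ι q = fromNull (λ _ → q) (N₂.null-0 λ _ → ℚₚ.+-inverseʳ q)

  infixl 6 _+_
  infixl 7 _*_
  infix  8 -_

  _+_ _*_ : ℝ → ℝ → ℝ
  x + y = fromNull (λ n → seq x n ℚ.+ seq y n)
    (N₂.null-cong
      (λ (m , n) → solve 4 (λ a b c d → (a :- b) :+ (c :- d) := (a :+ c) :- (b :+ d)) ≡.refl
                     (seq x m) (seq x n) (seq y m) (seq y n))
      (N₂.null-+ (toNull x) (toNull y)))
  x * y = fromNull (λ n → seq x n ℚ.* seq y n)
    (N₂.null-cong
      (λ (m , n) → solve 4 (λ a b c d → a :* (c :- d) :+ d :* (a :- b) := a :* c :- b :* d) ≡.refl
                     (seq x m) (seq x n) (seq y m) (seq y n))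
      (N₂.null-+ (N₂.null-* (bounded₁ x) (toNull y)) (N₂.null-* (bounded₂ y) (toNull x))))

  -_ : ℝ → ℝ
  - x = fromNull (λ n → ℚ.- seq x n)
    (N₂.null-cong
      (λ (m , n) → ℚₚ.neg-distrib-+ (seq x m) (ℚ.- seq x n))
      (N₂.null-- (toNull x)))

  pointwise : ∀ x y → (∀ n → seq x n ≡ seq y n) → x ≈ y
  pointwise x y e = null $ N₁.null-0 λ n →
    ≡.trans (≡.cong (ℚ._- seq y n) (e n)) (ℚₚ.+-inverseʳ (seq y n))

  private
    neg-cong : ∀ x y → x ≈ y → - x ≈ - y
    neg-cong x y (null x≈y) = null $ N₁.null-cong
      (λ n → ℚₚ.neg-distrib-+ (seq x n) (ℚ.- seq y n)) (N₁.null-- x≈y)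

    ≈-sym : ∀ x y → x ≈ y → y ≈ x
    ≈-sym x y (null x≈y) = null $ N₁.null-cong
      (λ n → solve 2 (λ a b → :- (a :- b) := b :- a) ≡.refl (seq x n) (seq y n))
      (N₁.null-- x≈y)

    ≈-trans : ∀ x y z → x ≈ y → y ≈ z → x ≈ z
    ≈-trans x y z (null x≈y) (null y≈z) = null $ N₁.null-cong
      (λ n → solve 3 (λ a b c → (a :- b) :+ (b :- c) := a :- c) ≡.refl
               (seq x n) (seq y n) (seq z n))
      (N₁.null-+ x≈y y≈z)

    +-cong : ∀ x y u v → x ≈ y → u ≈ v → x + u ≈ y + v
    +-cong x y u v (null x≈y) (null u≈v) = null $ N₁.null-cong
      (λ n → solve 4 (λ a b c d → (a :- b) :+ (c :- d) := (a :+ c) :- (b :+ d)) ≡.refl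
               (seq x n) (seq y n) (seq u n) (seq v n))
      (N₁.null-+ x≈y u≈v)

    *-cong : ∀ x y u v → x ≈ y → u ≈ v → x * u ≈ y * v
    *-cong x y u v (null x≈y) (null u≈v) = null $ N₁.null-cong
      (λ n → solve 4 (λ a b c d → a :* (c :- d) :+ d :* (a :- b) := a :* c :- b :* d) ≡.refl
               (seq x n) (seq y n) (seq u n) (seq v n))
      (N₁.null-+ (N₁.null-* (bounded x) u≈v) (N₁.null-* (bounded v) x≈y))

  isCommutativeRing : IsCommutativeRing _≈_ _+_ _*_ -_ (ι 0ℚ) (ι 1ℚ)
  isCommutativeRing = record
    { isRing = record
      { +-isAbelianGroup = record
        { isGroup = record
          { isMonoid = record
            { isSemigroup = record
              { isMagma = record
                { isEquivalence = record
                  { refl  = λ {x} → pointwise x x λ _ → ≡.refl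
                  ; sym   = λ {x} {y} → ≈-sym x y
                  ; trans = λ {x} {y} {z} → ≈-trans x y z
                  }
                ; ∙-cong = λ {x} {y} {u} {v} → +-cong x y u v
                }
              ; assoc = λ x y z → pointwise (x + y + z) (x + (y + z))
                          λ n → ℚₚ.+-assoc (seq x n) (seq y n) (seq z n)
              }
            ; identity = (λ x → pointwise (ι 0ℚ + x) x λ n → ℚₚ.+-identityˡ (seq x n))
                       , (λ x → pointwise (x + ι 0ℚ) x λ n → ℚₚ.+-identityʳ (seq x n))
            }
          ; inverse = (λ x → pointwise (- x + x) (ι 0ℚ) λ n → ℚₚ.+-inverseˡ (seq x n))
                    , (λ x → pointwise (x + - x) (ι 0ℚ) λ n → ℚₚ.+-inverseʳ (seq x n))
          ; ⁻¹-cong = λ {x} {y} → neg-cong x y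
          }
        ; comm = λ x y → pointwise (x + y) (y + x) λ n → ℚₚ.+-comm (seq x n) (seq y n)
        }
      ; *-cong = λ {x} {y} {u} {v} → *-cong x y u v
      ; *-assoc = λ x y z → pointwise (x * y * z) (x * (y * z))
                    λ n → ℚₚ.*-assoc (seq x n) (seq y n) (seq z n)
      ; *-identity = (λ x → pointwise (ι 1ℚ * x) x λ n → ℚₚ.*-identityˡ (seq x n))
                   , (λ x → pointwise (x * ι 1ℚ) x λ n → ℚₚ.*-identityʳ (seq x n))
      ; distrib = (λ x y z → pointwise (x * (y + z)) (x * y + x * z)
                     λ n → ℚₚ.*-distribˡ-+ (seq x n) (seq y n) (seq z n))
                , (λ x y z → pointwise ((y + z) * x) (y * x + z * x)
                     λ n → ℚₚ.*-distribʳ-+ (seq x n) (seq y n) (seq z n))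
      }
    ; *-comm = λ x y → pointwise (x * y) (y * x) λ n → ℚₚ.*-comm (seq x n) (seq y n)
    }

  ι-+ : ∀ p q → ι p + ι q ≈ ι (p ℚ.+ q)
  ι-+ p q = pointwise (ι p + ι q) (ι (p ℚ.+ q)) λ _ → ≡.refl

  ι-* : ∀ p q → ι p * ι q ≈ ι (p ℚ.* q)
  ι-* p q = pointwise (ι p * ι q) (ι (p ℚ.* q)) λ _ → ≡.refl

ℝ-commutativeRing : CommutativeRing 0ℓ 0ℓ
ℝ-commutativeRing = record { isCommutativeRing = Reals.isCommutativeRing }

------------------------------------------------------------------------
-- R[i] for a commutative ring R; ℂ is the case R = ℝ.

module Complexes (R : CommutativeRing 0ℓ 0ℓ) where

  open CommutativeRing R hiding (isCommutativeRing)
  open import Algebra.Properties.Ring ring using (-1*x≈-x)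
  open import Algebra.Solver.Ring.NaturalCoefficients.Default commutativeSemiring
    using (solve; _:+_; _:*_; _:=_)

  infix 4 _≈ᶜ_
  infixl 6 _+ᶜ_
  infixl 7 _*ᶜ_

  R² : Set
  R² = Carrier × Carrier

  _≈ᶜ_ : Rel R² 0ℓ
  (a , b) ≈ᶜ (c , d) = a ≈ c × b ≈ d

  _+ᶜ_ _*ᶜ_ : R² → R² → R²
  (a , b) +ᶜ (c , d) = a + c , b + d
  (a , b) *ᶜ (c , d) = a * c - b * d , a * d + b * c

  -ᶜ_ : R² → R²
  -ᶜ (a , b) = - a , - b

  private
    -- The laws of multiplication are semiring identities once x - y is
    -- written as x + (-1) y.
    _*ⁿ_ : R² → R² → R²
    (a , b) *ⁿ (c , d) = a * c + - 1# * (b * d) , a * d + b * c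

    ≈ᶜ-refl : ∀ {x} → x ≈ᶜ x
    ≈ᶜ-refl = refl , refl

    ≈ᶜ-sym : ∀ {x y} → x ≈ᶜ y → y ≈ᶜ x
    ≈ᶜ-sym (p , q) = sym p , sym q

    ≈ᶜ-trans : ∀ {x y z} → x ≈ᶜ y → y ≈ᶜ z → x ≈ᶜ z
    ≈ᶜ-trans (p , q) (r , s) = trans p r , trans q s

    *ᶜ-cong : ∀ {x y u v} → x ≈ᶜ y → u ≈ᶜ v → x *ᶜ u ≈ᶜ y *ᶜ v
    *ᶜ-cong (p , q) (r , s) =
      +-cong (*-cong p r) (-‿cong (*-cong q s)) , +-cong (*-cong p s) (*-cong q r)

    +ᶜ-cong : ∀ {x y u v} → x ≈ᶜ y → u ≈ᶜ v → x +ᶜ u ≈ᶜ y +ᶜ v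
    +ᶜ-cong (p , q) (r , s) = +-cong p r , +-cong q s

    *ᶜ≈*ⁿ : ∀ x y → x *ᶜ y ≈ᶜ x *ⁿ y
    *ᶜ≈*ⁿ (a , b) (c , d) = +-congˡ (sym (-1*x≈-x (b * d))) , refl

    *ᶜ-assoc : ∀ x y z → (x *ᶜ y) *ᶜ z ≈ᶜ x *ᶜ (y *ᶜ z)
    *ᶜ-assoc x@(a , b) y@(c , d) z@(e , f) =
      ≈ᶜ-trans (*ᶜ-cong (*ᶜ≈*ⁿ x y) (≈ᶜ-refl {z}))
      (≈ᶜ-trans (*ᶜ≈*ⁿ (x *ⁿ y) z)
      (≈ᶜ-trans
        ( solve 7 (λ n a b c d e f →
              (a :* c :+ n :* (b :* d)) :* e :+ n :* ((a :* d :+ b :* c) :* f)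
           := a :* (c :* e :+ n :* (d :* f)) :+ n :* (b :* (c :* f :+ d :* e)))
            refl (- 1#) a b c d e f
        , solve 7 (λ n a b c d e f →
              (a :* c :+ n :* (b :* d)) :* f :+ (a :* d :+ b :* c) :* e
           := a :* (c :* f :+ d :* e) :+ b :* (c :* e :+ n :* (d :* f)))
            refl (- 1#) a b c d e f )
      (≈ᶜ-sym (≈ᶜ-trans (*ᶜ-cong (≈ᶜ-refl {x}) (*ᶜ≈*ⁿ y z)) (*ᶜ≈*ⁿ x (y *ⁿ z))))))

    *ᶜ-comm : ∀ x y → x *ᶜ y ≈ᶜ y *ᶜ x
    *ᶜ-comm (a , b) (c , d) =
        +-cong (*-comm a c) (-‿cong (*-comm b d))
      , trans (+-cong (*-comm a d) (*-comm b c)) (+-comm _ _)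

    *ᶜ-identityˡ : ∀ x → (1# , 0#) *ᶜ x ≈ᶜ x
    *ᶜ-identityˡ (a , b) =
        trans (+-cong (*-identityˡ a) (trans (-‿cong (zeroˡ b)) -0#≈0#)) (+-identityʳ a)
      , trans (+-cong (*-identityˡ b) (zeroˡ a)) (+-identityʳ b)
      where open import Algebra.Properties.Ring ring using (-0#≈0#)

    *ᶜ-distribˡ : ∀ x y z → x *ᶜ (y +ᶜ z) ≈ᶜ x *ᶜ y +ᶜ x *ᶜ z
    *ᶜ-distribˡ x@(a , b) y@(c , d) z@(e , f) =
      ≈ᶜ-trans (*ᶜ≈*ⁿ x (y +ᶜ z))
      (≈ᶜ-trans
        ( solve 7 (λ n a b c d e f →
              a :* (c :+ e) :+ n :* (b :* (d :+ f))
           := (a :* c :+ n :* (b :* d)) :+ (a :* e :+ n :* (b :* f)))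
            refl (- 1#) a b c d e f
        , solve 6 (λ a b c d e f →
              a :* (d :+ f) :+ b :* (c :+ e) := (a :* d :+ b :* c) :+ (a :* f :+ b :* e))
            refl a b c d e f )
      (≈ᶜ-sym (+ᶜ-cong (*ᶜ≈*ⁿ x y) (*ᶜ≈*ⁿ x z))))

  isCommutativeRing : IsCommutativeRing _≈ᶜ_ _+ᶜ_ _*ᶜ_ -ᶜ_ (0# , 0#) (1# , 0#)
  isCommutativeRing = record
    { isRing = record
      { +-isAbelianGroup = record
        { isGroup = record
          { isMonoid = record
            { isSemigroup = record
              { isMagma = record
                { isEquivalence = record
                  { refl  = ≈ᶜ-refl
                  ; sym   = ≈ᶜ-sym
                  ; trans = ≈ᶜ-trans
                  }
                ; ∙-cong = +ᶜ-cong
                }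
              ; assoc = λ _ _ _ → +-assoc _ _ _ , +-assoc _ _ _
              }
            ; identity = (λ _ → +-identityˡ _ , +-identityˡ _)
                       , (λ _ → +-identityʳ _ , +-identityʳ _)
            }
          ; inverse = (λ _ → -‿inverseˡ _ , -‿inverseˡ _)
                    , (λ _ → -‿inverseʳ _ , -‿inverseʳ _)
          ; ⁻¹-cong = λ (p , q) → -‿cong p , -‿cong q
          }
        ; comm = λ _ _ → +-comm _ _ , +-comm _ _
        }
      ; *-cong = *ᶜ-cong
      ; *-assoc = *ᶜ-assoc
      ; *-identity = *ᶜ-identityˡ
                   , λ x → ≈ᶜ-trans (*ᶜ-comm x (1# , 0#)) (*ᶜ-identityˡ x)
      ; distrib = *ᶜ-distribˡ
                , λ x y z → ≈ᶜ-trans (*ᶜ-comm (y +ᶜ z) x)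
                    (≈ᶜ-trans (*ᶜ-distribˡ x y z) (+ᶜ-cong (*ᶜ-comm x y) (*ᶜ-comm x z)))
      }
    ; *-comm = *ᶜ-comm
    }

complexify : CommutativeRing 0ℓ 0ℓ → CommutativeRing 0ℓ 0ℓ
complexify R = record { isCommutativeRing = Complexes.isCommutativeRing R }

ℂ : CommutativeRing 0ℓ 0ℓ
ℂ = complexify ℝ-commutativeRing

record HasReciprocals (K : CommutativeRing 0ℓ 0ℓ) : Set where
  open CommutativeRing K
  open RawMonoidDefs +-rawMonoid using () renaming (_×_ to _×ₙ_)
  field
    1/1+_        : ℕ → Carrier
    1/1+-inverse : ∀ k → (suc k ×ₙ 1#) * (1/1+ k) ≈ 1#

private
  module _ where
    open RawMonoidDefs (CommutativeRing.+-rawMonoid ℚₚ.+-*-commutativeRing)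
      using () renaming (_×_ to _×ₙ_)

    ×ₙ1-nonNeg : ∀ k → 0ℚ ℚ.≤ k ×ₙ 1ℚ
    ×ₙ1-nonNeg zero    = ℚₚ.≤-refl
    ×ₙ1-nonNeg (suc k) = ℚₚ.+-mono-≤ {0ℚ} {1ℚ} {0ℚ} {k ×ₙ 1ℚ}
      (ℚₚ.<⇒≤ (ℚₚ.positive⁻¹ 1ℚ)) (×ₙ1-nonNeg k)

    ×ₙ1-pos : ∀ k → 0ℚ ℚ.< suc k ×ₙ 1ℚ
    ×ₙ1-pos k = ℚₚ.+-mono-<-≤ {0ℚ} {1ℚ} {0ℚ} {k ×ₙ 1ℚ} (ℚₚ.positive⁻¹ 1ℚ) (×ₙ1-nonNeg k)

    reciprocal : ∀ p → 0ℚ ℚ.< p → ∃[ q ] p ℚ.* q ≡ 1ℚ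
    reciprocal p 0<p = ℚ.1/ p , ℚₚ.*-inverseʳ p
      where instance _ = ℚₚ.pos⇒nonZero p ⦃ ℚ.positive 0<p ⦄

  ℚ-hasReciprocals : HasReciprocals ℚₚ.+-*-commutativeRing
  ℚ-hasReciprocals = record
    { 1/1+_ = λ k → proj₁ (reciprocal _ (×ₙ1-pos k))
    ; 1/1+-inverse = λ k → proj₂ (reciprocal _ (×ₙ1-pos k))
    }

  transport : ∀ (A B : CommutativeRing 0ℓ 0ℓ) →
    (let module A = CommutativeRing A
         module B = CommutativeRing B)
    (f : A.Carrier → B.Carrier) → (∀ {x y} → x A.≈ y → f x B.≈ f y) →
    (∀ x y → f x B.+ f y B.≈ f (x A.+ y)) → f A.0# B.≈ B.0# →
    (∀ x y → f x B.* f y B.≈ f (x A.* y)) → f A.1# B.≈ B.1# →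
    HasReciprocals A → HasReciprocals B
  transport A B f f-cong f-+ f-0 f-* f-1 h = record
    { 1/1+_ = λ k → f (1/1+ k)
    ; 1/1+-inverse = λ k → B.trans (B.*-congʳ (f-× (suc k)))
        (B.trans (f-* (suc k ×ᴬ A.1#) (1/1+ k)) (B.trans (f-cong (1/1+-inverse k)) f-1))
    }
    where
    module A = CommutativeRing A
    module B = CommutativeRing B
    open HasReciprocals h
    open RawMonoidDefs A.+-rawMonoid using () renaming (_×_ to _×ᴬ_)
    open RawMonoidDefs B.+-rawMonoid using () renaming (_×_ to _×ᴮ_)

    f-× : ∀ k → k ×ᴮ B.1# B.≈ f (k ×ᴬ A.1#)
    f-× zero    = B.sym f-0
    f-× (suc k) = B.trans (B.+-cong (B.sym f-1) (f-× k)) (f-+ A.1# (k ×ᴬ A.1#))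

ℝ-hasReciprocals : HasReciprocals ℝ-commutativeRing
ℝ-hasReciprocals = transport ℚₚ.+-*-commutativeRing ℝ-commutativeRing
  Reals.ι (λ {p} → λ { ≡.refl → R.refl {Reals.ι p} }) Reals.ι-+ (R.refl {R.0#}) Reals.ι-* (R.refl {R.1#})
  ℚ-hasReciprocals
  where module R = CommutativeRing ℝ-commutativeRing

complexify-hasReciprocals : ∀ R → HasReciprocals R → HasReciprocals (complexify R)
complexify-hasReciprocals R = transport R (complexify R)
  (λ a → a , 0#) (λ p → p , refl) (λ a b → refl , +-identityˡ 0#) (refl , refl)
  (λ a b → trans (+-congˡ (trans (-‿cong (zeroˡ 0#)) -0#≈0#)) (+-identityʳ (a * b))
         , trans (+-cong (zeroʳ a) (zeroˡ b)) (+-identityʳ 0#))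
  (refl , refl)
  where
  open CommutativeRing R
  open import Algebra.Properties.Ring ring using (-0#≈0#)

ℂ-hasReciprocals : HasReciprocals ℂ
ℂ-hasReciprocals = complexify-hasReciprocals ℝ-commutativeRing ℝ-hasReciprocals

------------------------------------------------------------------------
-- g · h is g after h, whereas _∘ₚ_ composes from left to right.

𝔖 : ℕ → Set
𝔖 n = Permutation′ n

infixr 9 _·_

_·_ : ∀ {n} → 𝔖 n → 𝔖 n → 𝔖 n
g · h = h ∘ₚ g

------------------------------------------------------------------------
-- A partition is given by the relation "in the same block".

record Partition (n : ℕ) : Set₁ where
  infix 4 _~_
  field
    _~_              : Rel (Fin n) 0ℓ
    isDecEquivalence : IsDecEquivalence _~_
  open IsDecEquivalence isDecEquivalence public
    using () renaming (refl to ~-refl; sym to ~-sym; trans to ~-trans; _≟_ to infix 4 _~?_)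

  block : Fin n → Subset n
  block v = tabulate λ u → does (u ~? v)

  -- Membership in the Young subgroup 𝔖_{B₁} × ⋯ × 𝔖_{Bᵣ}.
  Stabilises : 𝔖 n → Set
  Stabilises h = ∀ v → (h ⟨$⟩ʳ v) ~ v

  stabilises? : ∀ h → Dec (Stabilises h)
  stabilises? h = all? λ v → (h ⟨$⟩ʳ v) ~? v

  -- Equality of left cosets g 𝔖_B = h 𝔖_B.
  SameCoset : Rel (𝔖 n) 0ℓ
  SameCoset g h = Stabilises (Perm.flip g · h)

  sameCoset? : ∀ g h → Dec (SameCoset g h)
  sameCoset? g h = stabilises? (Perm.flip g · h)

  does-cong : ∀ {u v} → u ~ v → ∀ w → does (w ~? u) ≡ does (w ~? v)
  does-cong {u} {v} u~v w = does-⇔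
    (mk⇔ (λ w~u → ~-trans w~u u~v) (λ w~v → ~-trans w~v (~-sym u~v))) (w ~? u) (w ~? v)

  block-cong : ∀ {u v} → u ~ v → block u ≡ block v
  block-cong u~v = Vecₚ.tabulate-cong (does-cong u~v)

  id-stabilises : Stabilises Perm.id
  id-stabilises v = ~-refl

  flip-stabilises : ∀ h → Stabilises h → Stabilises (Perm.flip h)
  flip-stabilises h s v = ~-sym (≡.subst (_~ (h ⟨$⟩ˡ v)) (Perm.inverseʳ h) (s (h ⟨$⟩ˡ v)))

  ·-stabilises : ∀ g h → Stabilises g → Stabilises h → Stabilises (g · h)
  ·-stabilises g h s t v = ~-trans (s (h ⟨$⟩ʳ v)) (t v)

  sameCoset-refl : ∀ {g} → SameCoset g g
  sameCoset-refl {g} v = ≡.subst (_~ v) (≡.sym (Perm.inverseˡ g)) ~-refl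

  sameCoset-sym : ∀ {g h} → SameCoset g h → SameCoset h g
  sameCoset-sym {g} {h} s = flip-stabilises (Perm.flip g · h) s

  sameCoset-trans : ∀ {g h k} → SameCoset g h → SameCoset h k → SameCoset g k
  sameCoset-trans {g} {h} {k} s t v =
    ≡.subst (λ w → (g ⟨$⟩ˡ w) ~ v) (Perm.inverseʳ h)
      (·-stabilises (Perm.flip g · h) (Perm.flip h · k) s t v)

  sameCoset-isDecEquivalence : IsDecEquivalence SameCoset
  sameCoset-isDecEquivalence = record
    { isEquivalence = record
      { refl  = λ {g} → sameCoset-refl {g}
      ; sym   = λ {g} {h} → sameCoset-sym {g} {h}
      ; trans = λ {g} {h} {k} → sameCoset-trans {g} {h} {k}
      }
    ; _≟_ = sameCoset?
    }

permutations : ∀ n → List (𝔖 n)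
permutations zero    = Perm.id ∷ []
permutations (suc n) = cartesianProductWith (Perm.insert zero) (allFin (suc n)) (permutations n)

permutations-complete : ∀ {n} (g : 𝔖 n) → Any (g Perm.≈_) (permutations n)
permutations-complete {zero}  g = here λ ()
permutations-complete {suc n} g = Anyₚ.cartesianProductWith⁺ (Perm.insert zero)
  {P = _≡_ (g ⟨$⟩ʳ zero)} {Q = Perm.remove zero g Perm.≈_}
  (λ { {_} {h} ≡.refl r≈h → λ v → ≡.trans (≡.sym (Perm.insert-remove zero g v))
         (insert-cong (g ⟨$⟩ʳ zero) (Perm.remove zero g) h r≈h v) })
  (∈-allFin (g ⟨$⟩ʳ zero)) (permutations-complete (Perm.remove zero g))
  where
  insert-cong : ∀ j (h k : 𝔖 n) → h Perm.≈ k →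
                Perm.insert zero j h Perm.≈ Perm.insert zero j k
  insert-cong j h k h≈k zero    = ≡.refl
  insert-cong j h k h≈k (suc v) = ≡.cong (punchIn j) (h≈k v)

-- Representatives h of the cosets h 𝔖_Q contained in 𝔖_P.
transversal : ∀ {n} → Partition n → Partition n → List (𝔖 n)
transversal {n} P Q =
  deduplicate (Partition.sameCoset? Q) (filter (Partition.stabilises? P) (permutations n))

module _ {n} (P Q : Partition n) where
  private
    module P = Partition P
    module Q = Partition Q

  transversal-stabilises : All P.Stabilises (transversal P Q)
  transversal-stabilises =
    Allₚ.deduplicate⁺ Q.sameCoset? (Allₚ.all-filter P.stabilises? (permutations n))

  transversal-unique : AllPairs (λ g h → ¬ Q.SameCoset g h) (transversal P Q)
  transversal-unique = deduplicate-! record { isDecEquivalence = Q.sameCoset-isDecEquivalence }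
    (filter P.stabilises? (permutations n))

  transversal-complete : ∀ g → P.Stabilises g → Any (Q.SameCoset g) (transversal P Q)
  transversal-complete g s = Anyₚ.deduplicate⁺ Q.sameCoset?
    (λ {a} {b} b~a g~a → Q.sameCoset-trans {g} {a} {b} g~a (Q.sameCoset-sym {b} {a} b~a))
    (Any.map (λ {h} g≈h v → ≡.subst (Q._~ v)
        (≡.trans (≡.sym (Perm.inverseˡ g)) (≡.cong (g ⟨$⟩ˡ_) (g≈h v))) Q.~-refl)
      in-P)
    where
    in-P : Any (g Perm.≈_) (filter P.stabilises? (permutations n))
    in-P with permutations-complete g
    ... | g∈ with Anyₚ.filter⁺ P.stabilises? g∈
    ... | inj₁ p = p
    ... | inj₂ ¬s = contradiction
      (λ v → ≡.subst (P._~ v) (Anyₚ.lookup-result g∈ v) (s v)) ¬s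

------------------------------------------------------------------------
-- Graphs: edges are enumerated by Fin m and may be loops or parallel.  The
-- order of the two endpoints in ends e carries no meaning.

record Graph : Set where
  field
    n m  : ℕ
    ends : Fin m → Fin n × Fin n

  Vertex Edge : Set
  Vertex = Fin n
  Edge   = Fin m

  Joins : Edge → Vertex → Vertex → Set
  Joins e u v = ends e ≡ (u , v) ⊎ ends e ≡ (v , u)

  Triangle : Edge → Edge → Edge → Set
  Triangle e₁ e₂ e₃ = ∃[ u ] ∃[ v ] ∃[ w ]
    (u ≢ v × v ≢ w × u ≢ w × Joins e₁ u v × Joins e₂ v w × Joins e₃ u w)

  Connected : Subset m → Rel Vertex 0ℓ
  Connected F = EqClosure λ u v → ∃[ e ] (e ∈ F × ends e ≡ (u , v))

private
  module _ {n : ℕ} where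

    Linked : List (Fin n × Fin n) → Rel (Fin n) 0ℓ
    Linked es = EqClosure λ u v → (u , v) ∈ₗ es

    linked? : ∀ es u v → Dec (Linked es u v)
    linked? [] u v = map′ (λ { ≡.refl → stop })
      (λ { stop → ≡.refl ; (fwd () ◅ _) ; (bwd () ◅ _) }) (u Fin.≟ v)
    linked? ((a , b) ∷ es) u v = map′ to from
      (linked? es u v ⊎-dec (linked? es u a ×-dec linked? es b v)
                      ⊎-dec (linked? es u b ×-dec linked? es a v))
      where
      infix 4 _~_
      _~_ = Linked es

      Via : Rel (Fin n) 0ℓ
      Via u v = u ~ v ⊎ (u ~ a × b ~ v) ⊎ (u ~ b × a ~ v)

      weaken : ∀ {u v} → u ~ v → Linked ((a , b) ∷ es) u v
      weaken = EqClosure.map there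

      to : ∀ {u v} → Via u v → Linked ((a , b) ∷ es) u v
      to (inj₁ p)              = weaken p
      to (inj₂ (inj₁ (p , q))) = weaken p ◅◅ fwd (here ≡.refl) ◅ weaken q
      to (inj₂ (inj₂ (p , q))) = weaken p ◅◅ bwd (here ≡.refl) ◅ weaken q

      prepend : ∀ {u w v} → u ~ w → Via w v → Via u v
      prepend r (inj₁ p)              = inj₁ (r ◅◅ p)
      prepend r (inj₂ (inj₁ (p , q))) = inj₂ (inj₁ (r ◅◅ p , q))
      prepend r (inj₂ (inj₂ (p , q))) = inj₂ (inj₂ (r ◅◅ p , q))

      along : ∀ {v} → Via b v → Via a v
      along (inj₁ p)              = inj₂ (inj₁ (stop , p))
      along (inj₂ (inj₁ (_ , q))) = inj₂ (inj₁ (stop , q))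
      along (inj₂ (inj₂ (_ , q))) = inj₁ q

      against : ∀ {v} → Via a v → Via b v
      against (inj₁ p)              = inj₂ (inj₂ (stop , p))
      against (inj₂ (inj₁ (_ , q))) = inj₁ q
      against (inj₂ (inj₂ (_ , q))) = inj₂ (inj₂ (stop , q))

      from : ∀ {u v} → Linked ((a , b) ∷ es) u v → Via u v
      from stop                     = inj₁ stop
      from (fwd (here ≡.refl) ◅ ps) = along (from ps)
      from (bwd (here ≡.refl) ◅ ps) = against (from ps)
      from (fwd (there e) ◅ ps)     = prepend (fwd e ◅ stop) (from ps)
      from (bwd (there e) ◅ ps)     = prepend (bwd e ◅ stop) (from ps)

module _ (G : Graph) where
  open Graph G

  connected? : ∀ F u v → Dec (Connected F u v)
  connected? F u v = map′ (EqClosure.map to) (EqClosure.map from) (linked? es u v)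
    where
    es = map ends (filter (_∈? F) (allFin m))

    to : ∀ {u v} → (u , v) ∈ₗ es → ∃[ e ] (e ∈ F × ends e ≡ (u , v))
    to uv∈ = let (e , e∈ , eq) = ∈-map⁻ ends uv∈ in
      e , proj₂ (∈-filter⁻ (_∈? F) {xs = allFin m} e∈) , ≡.sym eq

    from : ∀ {u v} → ∃[ e ] (e ∈ F × ends e ≡ (u , v)) → (u , v) ∈ₗ es
    from (e , e∈F , eq) =
      ≡.subst (_∈ₗ es) eq (∈-map⁺ ends (∈-filter⁺ (_∈? F) (∈-allFin e) e∈F))

  components : Subset m → Partition n
  components F = record
    { _~_ = Connected F
    ; isDecEquivalence = record
      { isEquivalence = EqClosure.isEquivalence _
      ; _≟_ = connected? F
      }
    }

module LinearAlgebra (K : CommutativeRing 0ℓ 0ℓ) where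

  open CommutativeRing K using (ring) renaming
    (Carrier to Scalar; _≈_ to _≈ₛ_; _+_ to _+ₛ_; _*_ to _*ₛ_; -_ to -ₛ_; 0# to 0ₛ; 1# to 1ₛ)
  private module K = CommutativeRing K

  Module : Set₁
  Module = LeftModule ring 0ℓ 0ℓ

  private variable I : Set

  record IsLinear (M N : Module) (f : LeftModule.Carrierᴹ M → LeftModule.Carrierᴹ N) : Set where
    private
      module M = LeftModule M
      module N = LeftModule N
    field
      cong : ∀ {x y} → x M.≈ᴹ y → f x N.≈ᴹ f y
      +-homo : ∀ x y → f (x M.+ᴹ y) N.≈ᴹ f x N.+ᴹ f y
      *-homo : ∀ c x → f (c M.*ₗ x) N.≈ᴹ c N.*ₗ f x

    0-homo : f M.0ᴹ N.≈ᴹ N.0ᴹ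
    0-homo = N.≈ᴹ-trans (cong (M.≈ᴹ-sym (M.*ₗ-zeroˡ M.0ᴹ)))
             (N.≈ᴹ-trans (*-homo 0ₛ M.0ᴹ) (N.*ₗ-zeroˡ (f M.0ᴹ)))

    -- Additivity and homogeneity entail the remaining laws.
    isLeftModuleHomomorphism : IsLeftModuleHomomorphism M.rawLeftModule N.rawLeftModule f
    isLeftModuleHomomorphism = record
      { +ᴹ-isGroupHomomorphism = record
        { isMonoidHomomorphism = record
          { isMagmaHomomorphism = record
            { isRelHomomorphism = record { cong = cong }
            ; homo = +-homo
            }
          ; ε-homo = 0-homo
          }
        ; ⁻¹-homo = λ x → inverseˡ-uniqueᴹ (f (M.-ᴹ x)) (f x)
            (N.≈ᴹ-trans (N.≈ᴹ-sym (+-homo (M.-ᴹ x) x))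
            (N.≈ᴹ-trans (cong (M.-ᴹ‿inverseˡ x)) 0-homo))
        }
      ; *ₗ-homo = *-homo
      }
      where open import Algebra.Module.Properties.LeftModule N using (inverseˡ-uniqueᴹ)

  record LinearMap (M N : Module) : Set where
    field
      ⟦_⟧      : LeftModule.Carrierᴹ M → LeftModule.Carrierᴹ N
      isLinear : IsLinear M N ⟦_⟧
    open IsLinear isLinear public

  open LinearMap using (⟦_⟧)

  infixr 9 _∘ˡ_

  _∘ˡ_ : ∀ {L M N} → LinearMap M N → LinearMap L M → LinearMap L N
  _∘ˡ_ {N = N} g f = record
    { ⟦_⟧ = λ x → ⟦ g ⟧ (⟦ f ⟧ x)
    ; isLinear = record
      { cong   = λ p → G.cong (F.cong p)
      ; +-homo = λ x y → N.≈ᴹ-trans (G.cong (F.+-homo x y)) (G.+-homo (⟦ f ⟧ x) (⟦ f ⟧ y))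
      ; *-homo = λ c x → N.≈ᴹ-trans (G.cong (F.*-homo c x)) (G.*-homo c (⟦ f ⟧ x))
      }
    }
    where
    module F = LinearMap f
    module G = LinearMap g
    module N = LeftModule N

  ∏ : (I → Module) → Module
  ∏ {I} M = record
    { Carrierᴹ = ∀ i → M.Carrierᴹ i
    ; _≈ᴹ_ = λ x y → ∀ i → M._≈ᴹ_ i (x i) (y i)
    ; _+ᴹ_ = λ x y i → M._+ᴹ_ i (x i) (y i)
    ; _*ₗ_ = λ c x i → M._*ₗ_ i c (x i)
    ; 0ᴹ = λ i → M.0ᴹ i
    ; -ᴹ_ = λ x i → M.-ᴹ_ i (x i)
    ; isLeftModule = record
      { isLeftSemimodule = record
        { +ᴹ-isCommutativeMonoid = record
          { isMonoid = record
            { isSemigroup = record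
              { isMagma = record
                { isEquivalence = record
                  { refl  = λ i → M.≈ᴹ-refl i
                  ; sym   = λ p i → M.≈ᴹ-sym i (p i)
                  ; trans = λ p q i → M.≈ᴹ-trans i (p i) (q i)
                  }
                ; ∙-cong = λ p q i → M.+ᴹ-cong i (p i) (q i)
                }
              ; assoc = λ x y z i → M.+ᴹ-assoc i (x i) (y i) (z i)
              }
            ; identity = (λ x i → M.+ᴹ-identityˡ i (x i)) , (λ x i → M.+ᴹ-identityʳ i (x i))
            }
          ; comm = λ x y i → M.+ᴹ-comm i (x i) (y i)
          }
        ; isPreleftSemimodule = record
          { *ₗ-cong      = λ c≈d p i → M.*ₗ-cong i c≈d (p i)
          ; *ₗ-zeroˡ     = λ x i → M.*ₗ-zeroˡ i (x i)
          ; *ₗ-distribʳ  = λ x c d i → M.*ₗ-distribʳ i (x i) c d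
          ; *ₗ-identityˡ = λ x i → M.*ₗ-identityˡ i (x i)
          ; *ₗ-assoc     = λ c d x i → M.*ₗ-assoc i c d (x i)
          ; *ₗ-zeroʳ     = λ c i → M.*ₗ-zeroʳ i c
          ; *ₗ-distribˡ  = λ c x y i → M.*ₗ-distribˡ i c (x i) (y i)
          }
        }
      ; -ᴹ‿cong = λ p i → M.-ᴹ‿cong i (p i)
      ; -ᴹ‿inverse = (λ x i → M.-ᴹ‿inverseˡ i (x i)) , (λ x i → M.-ᴹ‿inverseʳ i (x i))
      }
    }
    where module M i = LeftModule (M i)

  coordinates : ℕ → Module
  coordinates n = ∏ {Fin n} λ _ → TensorUnit.leftModule

  record Submodule (M : Module) : Set₁ where
    open LeftModule M
    field
      _∈       : Carrierᴹ → Set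
      resp     : ∀ {x y} → x ≈ᴹ y → x ∈ → y ∈
      0-closed : 0ᴹ ∈
      +-closed : ∀ {x y} → x ∈ → y ∈ → (x +ᴹ y) ∈
      *-closed : ∀ c {x} → x ∈ → (c *ₗ x) ∈

    -1*x≈-x : ∀ x → (-ₛ 1ₛ) *ₗ x ≈ᴹ -ᴹ x
    -1*x≈-x x = inverseˡ-uniqueᴹ ((-ₛ 1ₛ) *ₗ x) x
      (≈ᴹ-trans (+ᴹ-congˡ (≈ᴹ-sym (*ₗ-identityˡ x)))
      (≈ᴹ-trans (≈ᴹ-sym (*ₗ-distribʳ x (-ₛ 1ₛ) 1ₛ))
      (≈ᴹ-trans (*ₗ-cong (K.-‿inverseˡ 1ₛ) ≈ᴹ-refl) (*ₗ-zeroˡ x))))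
      where open import Algebra.Module.Properties.LeftModule M using (inverseˡ-uniqueᴹ)

    neg-closed : ∀ {x} → x ∈ → (-ᴹ x) ∈
    neg-closed {x} x∈ = resp (-1*x≈-x x) (*-closed (-ₛ 1ₛ) x∈)

    difference : ∀ {x y} → x ≈ᴹ y → (x +ᴹ -ᴹ y) ∈
    difference {x} {y} x≈y = resp (≈ᴹ-sym (≈ᴹ-trans (+ᴹ-congʳ x≈y) (-ᴹ‿inverseʳ y))) 0-closed

  restrict : (M : Module) → Submodule M → Module
  restrict M P = record
    { Carrierᴹ = Σ[ x ∈ Carrierᴹ ] x ∈
    ; _≈ᴹ_ = λ (x , _) (y , _) → x ≈ᴹ y
    ; _+ᴹ_ = λ (x , p) (y , q) → x +ᴹ y , +-closed p q
    ; _*ₗ_ = λ c (x , p) → c *ₗ x , *-closed c p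
    ; 0ᴹ = 0ᴹ , 0-closed
    ; -ᴹ_ = λ (x , p) → -ᴹ x , neg-closed p
    ; isLeftModule = record
      { isLeftSemimodule = record
        { +ᴹ-isCommutativeMonoid = record
          { isMonoid = record
            { isSemigroup = record
              { isMagma = record
                { isEquivalence = record { refl = ≈ᴹ-refl ; sym = ≈ᴹ-sym ; trans = ≈ᴹ-trans }
                ; ∙-cong = +ᴹ-cong
                }
              ; assoc = λ (x , _) (y , _) (z , _) → +ᴹ-assoc x y z
              }
            ; identity = (λ (x , _) → +ᴹ-identityˡ x) , (λ (x , _) → +ᴹ-identityʳ x)
            }
          ; comm = λ (x , _) (y , _) → +ᴹ-comm x y
          }
        ; isPreleftSemimodule = record
          { *ₗ-cong      = *ₗ-cong
          ; *ₗ-zeroˡ     = λ (x , _) → *ₗ-zeroˡ x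
          ; *ₗ-distribʳ  = λ (x , _) → *ₗ-distribʳ x
          ; *ₗ-identityˡ = λ (x , _) → *ₗ-identityˡ x
          ; *ₗ-assoc     = λ c d (x , _) → *ₗ-assoc c d x
          ; *ₗ-zeroʳ     = *ₗ-zeroʳ
          ; *ₗ-distribˡ  = λ c (x , _) (y , _) → *ₗ-distribˡ c x y
          }
        }
      ; -ᴹ‿cong = -ᴹ‿cong
      ; -ᴹ‿inverse = (λ (x , _) → -ᴹ‿inverseˡ x) , (λ (x , _) → -ᴹ‿inverseʳ x)
      }
    }
    where
    open LeftModule M
    open Submodule P

  -- The quotient M / P: same elements, equality modulo P.
  quotient : (M : Module) → Submodule M → Module
  quotient M P = record
    { Carrierᴹ = Carrierᴹ
    ; _≈ᴹ_ = _≈ₚ_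
    ; _+ᴹ_ = _+ᴹ_
    ; _*ₗ_ = _*ₗ_
    ; 0ᴹ = 0ᴹ
    ; -ᴹ_ = -ᴹ_
    ; isLeftModule = record
      { isLeftSemimodule = record
        { +ᴹ-isCommutativeMonoid = record
          { isMonoid = record
            { isSemigroup = record
              { isMagma = record
                { isEquivalence = record
                  { refl  = difference ≈ᴹ-refl
                  ; sym   = λ {x} {y} p → resp (flip-diff x y) (neg-closed p)
                  ; trans = λ {x} {y} {z} p q → resp (paste-diff x y z) (+-closed p q)
                  }
                ; ∙-cong = λ {x} {y} {u} {v} p q → resp (+-diff x y u v) (+-closed p q)
                }
              ; assoc = λ x y z → difference (+ᴹ-assoc x y z)
              }
            ; identity = (λ x → difference (+ᴹ-identityˡ x)) , (λ x → difference (+ᴹ-identityʳ x))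
            }
          ; comm = λ x y → difference (+ᴹ-comm x y)
          }
        ; isPreleftSemimodule = record
          { *ₗ-cong      = λ {c} {d} {x} {y} c≈d p →
              resp (≈ᴹ-trans (*-diff c x y) (+ᴹ-congˡ (-ᴹ‿cong (*ₗ-cong c≈d ≈ᴹ-refl)))) (*-closed c p)
          ; *ₗ-zeroˡ     = λ x → difference (*ₗ-zeroˡ x)
          ; *ₗ-distribʳ  = λ x c d → difference (*ₗ-distribʳ x c d)
          ; *ₗ-identityˡ = λ x → difference (*ₗ-identityˡ x)
          ; *ₗ-assoc     = λ c d x → difference (*ₗ-assoc c d x)
          ; *ₗ-zeroʳ     = λ c → difference (*ₗ-zeroʳ c)
          ; *ₗ-distribˡ  = λ c x y → difference (*ₗ-distribˡ c x y)
          }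
        }
      ; -ᴹ‿cong = λ {x} {y} p → resp (neg-diff x y) (neg-closed p)
      ; -ᴹ‿inverse = (λ x → difference (-ᴹ‿inverseˡ x)) , (λ x → difference (-ᴹ‿inverseʳ x))
      }
    }
    where
    open LeftModule M
    open Submodule P
    _≈ₚ_ : Rel Carrierᴹ 0ℓ
    x ≈ₚ y = (x +ᴹ -ᴹ y) ∈

    open import Relation.Binary.Reasoning.Setoid ≈ᴹ-setoid
    open import Algebra.Properties.AbelianGroup +ᴹ-abelianGroup
      using (⁻¹-anti-homo‿-; ⁻¹-∙-comm; inverseˡ-unique)
    open import Algebra.Properties.CommutativeSemigroup
      (CommutativeMonoid.commutativeSemigroup +ᴹ-commutativeMonoid) using (interchange)

    flip-diff : ∀ x y → -ᴹ (x +ᴹ -ᴹ y) ≈ᴹ y +ᴹ -ᴹ x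
    flip-diff = ⁻¹-anti-homo‿-

    paste-diff : ∀ x y z → (x +ᴹ -ᴹ y) +ᴹ (y +ᴹ -ᴹ z) ≈ᴹ x +ᴹ -ᴹ z
    paste-diff x y z = begin
      (x +ᴹ -ᴹ y) +ᴹ (y +ᴹ -ᴹ z)  ≈⟨ +ᴹ-assoc x (-ᴹ y) (y +ᴹ -ᴹ z) ⟩
      x +ᴹ (-ᴹ y +ᴹ (y +ᴹ -ᴹ z))  ≈⟨ +ᴹ-congˡ (+ᴹ-assoc (-ᴹ y) y (-ᴹ z)) ⟨
      x +ᴹ ((-ᴹ y +ᴹ y) +ᴹ -ᴹ z)  ≈⟨ +ᴹ-congˡ (+ᴹ-congʳ (-ᴹ‿inverseˡ y)) ⟩
      x +ᴹ (0ᴹ +ᴹ -ᴹ z)           ≈⟨ +ᴹ-congˡ (+ᴹ-identityˡ (-ᴹ z)) ⟩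
      x +ᴹ -ᴹ z                   ∎

    +-diff : ∀ x y u v → (x +ᴹ -ᴹ y) +ᴹ (u +ᴹ -ᴹ v) ≈ᴹ (x +ᴹ u) +ᴹ -ᴹ (y +ᴹ v)
    +-diff x y u v = begin
      (x +ᴹ -ᴹ y) +ᴹ (u +ᴹ -ᴹ v)  ≈⟨ interchange x (-ᴹ y) u (-ᴹ v) ⟩
      (x +ᴹ u) +ᴹ (-ᴹ y +ᴹ -ᴹ v)  ≈⟨ +ᴹ-congˡ (⁻¹-∙-comm y v) ⟩
      (x +ᴹ u) +ᴹ -ᴹ (y +ᴹ v)     ∎

    neg-diff : ∀ x y → -ᴹ (x +ᴹ -ᴹ y) ≈ᴹ -ᴹ x +ᴹ -ᴹ (-ᴹ y)
    neg-diff x y = ≈ᴹ-sym (⁻¹-∙-comm x (-ᴹ y))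

    *-diff : ∀ c x y → c *ₗ (x +ᴹ -ᴹ y) ≈ᴹ c *ₗ x +ᴹ -ᴹ (c *ₗ y)
    *-diff c x y = begin
      c *ₗ (x +ᴹ -ᴹ y)       ≈⟨ *ₗ-distribˡ c x (-ᴹ y) ⟩
      c *ₗ x +ᴹ c *ₗ (-ᴹ y)  ≈⟨ +ᴹ-congˡ (inverseˡ-unique (c *ₗ (-ᴹ y)) (c *ₗ y) (begin
        c *ₗ (-ᴹ y) +ᴹ c *ₗ y  ≈⟨ *ₗ-distribˡ c (-ᴹ y) y ⟨
        c *ₗ (-ᴹ y +ᴹ y)       ≈⟨ *ₗ-cong K.refl (-ᴹ‿inverseˡ y) ⟩
        c *ₗ 0ᴹ                ≈⟨ *ₗ-zeroʳ c ⟩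
        0ᴹ                     ∎)) ⟩
      c *ₗ x +ᴹ -ᴹ (c *ₗ y)  ∎

  infixl 6 _⊞_
  infixr 7 _⊡_

  data Term (X : Set) : Set where
    ⟨_⟩ : X → Term X
    𝟘   : Term X
    _⊞_ : Term X → Term X → Term X
    _⊡_ : Scalar → Term X → Term X

  -- The least module congruence containing the relations R.
  data Congruence {X : Set} (R : Rel (Term X) 0ℓ) : Rel (Term X) 0ℓ where
    relation    : ∀ {x y} → R x y → Congruence R x y
    refl        : ∀ {x} → Congruence R x x
    sym         : ∀ {x y} → Congruence R x y → Congruence R y x
    trans       : ∀ {x y z} → Congruence R x y → Congruence R y z → Congruence R x z
    ⊞-cong      : ∀ {x y u v} → Congruence R x y → Congruence R u v →
                  Congruence R (x ⊞ u) (y ⊞ v)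
    ⊡-cong      : ∀ {c d x y} → c ≈ₛ d → Congruence R x y → Congruence R (c ⊡ x) (d ⊡ y)
    ⊞-assoc     : ∀ x y z → Congruence R ((x ⊞ y) ⊞ z) (x ⊞ (y ⊞ z))
    ⊞-comm      : ∀ x y → Congruence R (x ⊞ y) (y ⊞ x)
    ⊞-identityˡ : ∀ x → Congruence R (𝟘 ⊞ x) x
    ⊡-zeroˡ     : ∀ x → Congruence R (0ₛ ⊡ x) 𝟘
    ⊡-identityˡ : ∀ x → Congruence R (1ₛ ⊡ x) x
    ⊡-assoc     : ∀ c d x → Congruence R ((c *ₛ d) ⊡ x) (c ⊡ (d ⊡ x))
    ⊡-distribʳ  : ∀ x c d → Congruence R ((c +ₛ d) ⊡ x) (c ⊡ x ⊞ d ⊡ x)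
    ⊡-distribˡ  : ∀ c x y → Congruence R (c ⊡ (x ⊞ y)) (c ⊡ x ⊞ c ⊡ y)

  presented : (X : Set) → Rel (Term X) 0ℓ → Module
  presented X R = record
    { Carrierᴹ = Term X
    ; _≈ᴹ_ = Congruence R
    ; _+ᴹ_ = _⊞_
    ; _*ₗ_ = _⊡_
    ; 0ᴹ = 𝟘
    ; -ᴹ_ = (-ₛ 1ₛ) ⊡_
    ; isLeftModule = record
      { isLeftSemimodule = record
        { +ᴹ-isCommutativeMonoid = record
          { isMonoid = record
            { isSemigroup = record
              { isMagma = record
                { isEquivalence = record { refl = refl ; sym = sym ; trans = trans }
                ; ∙-cong = ⊞-cong
                }
              ; assoc = ⊞-assoc
              }
            ; identity = ⊞-identityˡ , λ x → trans (⊞-comm x 𝟘) (⊞-identityˡ x)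
            }
          ; comm = ⊞-comm
          }
        ; isPreleftSemimodule = record
          { *ₗ-cong      = ⊡-cong
          ; *ₗ-zeroˡ     = ⊡-zeroˡ
          ; *ₗ-distribʳ  = ⊡-distribʳ
          ; *ₗ-identityˡ = ⊡-identityˡ
          ; *ₗ-assoc     = ⊡-assoc
          ; *ₗ-zeroʳ     = λ c → trans (⊡-cong K.refl (sym (⊡-zeroˡ 𝟘)))
                             (trans (sym (⊡-assoc c 0ₛ 𝟘))
                             (trans (⊡-cong (K.zeroʳ c) refl) (⊡-zeroˡ 𝟘)))
          ; *ₗ-distribˡ  = ⊡-distribˡ
          }
        }
      ; -ᴹ‿cong = ⊡-cong K.refl
      ; -ᴹ‿inverse = inverseˡ , λ x → trans (⊞-comm x _) (inverseˡ x)
      }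
    }
    where
    inverseˡ : ∀ x → Congruence R ((-ₛ 1ₛ) ⊡ x ⊞ x) 𝟘
    inverseˡ x = trans (⊞-cong refl (sym (⊡-identityˡ x)))
      (trans (sym (⊡-distribʳ x (-ₛ 1ₛ) 1ₛ))
      (trans (⊡-cong (K.-‿inverseˡ 1ₛ) refl) (⊡-zeroˡ x)))

  module _ {X : Set} (M : Module) where
    open LeftModule M

    extend : (X → Carrierᴹ) → Term X → Carrierᴹ
    extend f ⟨ x ⟩   = f x
    extend f 𝟘       = 0ᴹ
    extend f (x ⊞ y) = extend f x +ᴹ extend f y
    extend f (c ⊡ x) = c *ₗ extend f x

    module _ {R : Rel (Term X) 0ℓ} (f : X → Carrierᴹ)
             (f-resp : ∀ {x y} → R x y → extend f x ≈ᴹ extend f y) where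

      extend-cong : ∀ {x y} → Congruence R x y → extend f x ≈ᴹ extend f y
      extend-cong (relation r)        = f-resp r
      extend-cong refl                = ≈ᴹ-refl
      extend-cong (sym p)             = ≈ᴹ-sym (extend-cong p)
      extend-cong (trans p q)         = ≈ᴹ-trans (extend-cong p) (extend-cong q)
      extend-cong (⊞-cong p q)        = +ᴹ-cong (extend-cong p) (extend-cong q)
      extend-cong (⊡-cong c p)        = *ₗ-cong c (extend-cong p)
      extend-cong (⊞-assoc x y z)     = +ᴹ-assoc _ _ _
      extend-cong (⊞-comm x y)        = +ᴹ-comm _ _
      extend-cong (⊞-identityˡ x)     = +ᴹ-identityˡ _
      extend-cong (⊡-zeroˡ x)         = *ₗ-zeroˡ _
      extend-cong (⊡-identityˡ x)     = *ₗ-identityˡ _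
      extend-cong (⊡-assoc c d x)     = *ₗ-assoc c d _
      extend-cong (⊡-distribʳ x c d)  = *ₗ-distribʳ _ c d
      extend-cong (⊡-distribˡ c x y)  = *ₗ-distribˡ c _ _

      extend-linear : LinearMap (presented X R) M
      extend-linear = record
        { ⟦_⟧ = extend f
        ; isLinear = record
          { cong   = extend-cong
          ; +-homo = λ _ _ → ≈ᴹ-refl
          ; *-homo = λ _ _ → ≈ᴹ-refl
          }
        }

  extend-unique : ∀ {X R} {M : Module} (f g : LinearMap (presented X R) M) →
                  (let open LeftModule M) →
                  (∀ x → ⟦ f ⟧ ⟨ x ⟩ ≈ᴹ ⟦ g ⟧ ⟨ x ⟩) → ∀ t → ⟦ f ⟧ t ≈ᴹ ⟦ g ⟧ t
  extend-unique {M = M} f g h = go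
    where
    open LeftModule M
    module F = LinearMap f
    module G = LinearMap g
    go : ∀ t → ⟦ f ⟧ t ≈ᴹ ⟦ g ⟧ t
    go ⟨ x ⟩   = h x
    go 𝟘       = ≈ᴹ-trans F.0-homo (≈ᴹ-sym G.0-homo)
    go (t ⊞ u) = ≈ᴹ-trans (F.+-homo t u) (≈ᴹ-trans (+ᴹ-cong (go t) (go u)) (≈ᴹ-sym (G.+-homo t u)))
    go (c ⊡ t) = ≈ᴹ-trans (F.*-homo c t) (≈ᴹ-trans (*ₗ-cong K.refl (go t)) (≈ᴹ-sym (G.*-homo c t)))

  ----------------------------------------------------------------------
  -- Exterior powers; ⟨ x₁ ∷ … ∷ xⱼ ∷ [] ⟩ stands for x₁ ∧ … ∧ xⱼ.

  module _ (M : Module) where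
    open LeftModule M

    data ⋀-Relation (j : ℕ) : Rel (Term (Vec Carrierᴹ j)) 0ℓ where
      congruent   : ∀ {xs ys} → Pointwise _≈ᴹ_ xs ys → ⋀-Relation j ⟨ xs ⟩ ⟨ ys ⟩
      additive    : ∀ xs i x y →
                    ⋀-Relation j ⟨ xs [ i ]≔ (x +ᴹ y) ⟩ (⟨ xs [ i ]≔ x ⟩ ⊞ ⟨ xs [ i ]≔ y ⟩)
      homogeneous : ∀ xs i c x → ⋀-Relation j ⟨ xs [ i ]≔ (c *ₗ x) ⟩ (c ⊡ ⟨ xs [ i ]≔ x ⟩)
      alternating : ∀ xs {i k} → i ≢ k → lookup xs i ≈ᴹ lookup xs k → ⋀-Relation j ⟨ xs ⟩ 𝟘

    ⋀ : ℕ → Module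
    ⋀ j = presented (Vec Carrierᴹ j) (⋀-Relation j)

  ⋀-map : ∀ {M N} j → LinearMap M N → LinearMap (⋀ M j) (⋀ N j)
  ⋀-map {M} {N} j f = extend-linear (⋀ N j) (λ xs → ⟨ Vec.map ⟦ f ⟧ xs ⟩) resp
    where
    module M = LeftModule M
    module N = LeftModule N
    module F = LinearMap f
    _≋_ = LeftModule._≈ᴹ_ (⋀ N j)

    ext = extend (⋀ N j) (λ xs → ⟨ Vec.map ⟦ f ⟧ xs ⟩)

    map-≔ : ∀ xs i x → ⟨ Vec.map ⟦ f ⟧ (xs [ i ]≔ x) ⟩ ≡ ⟨ Vec.map ⟦ f ⟧ xs [ i ]≔ ⟦ f ⟧ x ⟩
    map-≔ xs i x = ≡.cong ⟨_⟩ (Vecₚ.map-[]≔ ⟦ f ⟧ xs i)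

    reflexive : ∀ {x y} → x ≡ y → x ≋ y
    reflexive ≡.refl = refl

    ≔-cong : ∀ xs i {x y} → x N.≈ᴹ y → ⟨ xs [ i ]≔ x ⟩ ≋ ⟨ xs [ i ]≔ y ⟩
    ≔-cong xs i x≈y = relation (congruent (go xs i x≈y))
      where
      go : ∀ {k} (xs : Vec N.Carrierᴹ k) i {x y} → x N.≈ᴹ y →
           Pointwise N._≈ᴹ_ (xs [ i ]≔ x) (xs [ i ]≔ y)
      go (x Vec.∷ xs) zero    p = p Pointwise.∷ Pointwise.refl N.≈ᴹ-refl
      go (x Vec.∷ xs) (suc i) p = N.≈ᴹ-refl Pointwise.∷ go xs i p

    resp : ∀ {t u} → ⋀-Relation M j t u → ext t ≋ ext u
    resp (congruent p) = relation (congruent (Pointwise.map⁺ F.cong p))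
    resp (additive xs i x y) =
      trans (reflexive (map-≔ xs i (x M.+ᴹ y)))
      (trans (≔-cong (Vec.map ⟦ f ⟧ xs) i (F.+-homo x y))
      (trans (relation (additive (Vec.map ⟦ f ⟧ xs) i (⟦ f ⟧ x) (⟦ f ⟧ y)))
      (sym (⊞-cong (reflexive (map-≔ xs i x)) (reflexive (map-≔ xs i y))))))
    resp (homogeneous xs i c x) =
      trans (reflexive (map-≔ xs i (c M.*ₗ x)))
      (trans (≔-cong (Vec.map ⟦ f ⟧ xs) i (F.*-homo c x))
      (trans (relation (homogeneous (Vec.map ⟦ f ⟧ xs) i c (⟦ f ⟧ x)))
      (sym (⊡-cong K.refl (reflexive (map-≔ xs i x))))))
    resp (alternating xs {i} {k} i≢k p) = relation (alternating (Vec.map ⟦ f ⟧ xs) i≢k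
      (≡.subst₂ N._≈ᴹ_ (≡.sym (Vecₚ.lookup-map i ⟦ f ⟧ xs)) (≡.sym (Vecₚ.lookup-map k ⟦ f ⟧ xs))
        (F.cong p)))

  ⋀-map-∘ : ∀ {L M N} j (g : LinearMap M N) (f : LinearMap L M) (h : LinearMap L N) →
            (let module N = LeftModule N
                 module ⋀N = LeftModule (⋀ N j)) →
            (∀ x → ⟦ g ⟧ (⟦ f ⟧ x) N.≈ᴹ ⟦ h ⟧ x) →
            ∀ t → ⟦ ⋀-map j g ⟧ (⟦ ⋀-map j f ⟧ t) ⋀N.≈ᴹ ⟦ ⋀-map j h ⟧ t
  ⋀-map-∘ {L} {M} {N} j g f h p = extend-unique (⋀-map j g ∘ˡ ⋀-map j f) (⋀-map j h)
    λ xs → relation (congruent (go xs))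
    where
    go : ∀ {k} (xs : Vec (LeftModule.Carrierᴹ L) k) →
         Pointwise (LeftModule._≈ᴹ_ N) (Vec.map ⟦ g ⟧ (Vec.map ⟦ f ⟧ xs)) (Vec.map ⟦ h ⟧ xs)
    go Vec.[]       = Pointwise.[]
    go (x Vec.∷ xs) = p x Pointwise.∷ go xs

  record Representation (n : ℕ) : Set₁ where
    field
      leftModule : Module
    open LeftModule leftModule public
    field
      act      : 𝔖 n → Carrierᴹ → Carrierᴹ
      act-cong : ∀ {g h x y} → g Perm.≈ h → x ≈ᴹ y → act g x ≈ᴹ act h y
      act-+    : ∀ g x y → act g (x +ᴹ y) ≈ᴹ act g x +ᴹ act g y
      act-*    : ∀ g c x → act g (c *ₗ x) ≈ᴹ c *ₗ act g x
      act-id   : ∀ x → act Perm.id x ≈ᴹ x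
      act-∘    : ∀ g h x → act (g · h) x ≈ᴹ act g (act h x)

  actMap : ∀ {n} (X : Representation n) → 𝔖 n →
           LinearMap (Representation.leftModule X) (Representation.leftModule X)
  actMap X g = record
    { ⟦_⟧ = act g
    ; isLinear = record
      { cong = act-cong {g} {g} (λ _ → ≡.refl) ; +-homo = act-+ g ; *-homo = act-* g }
    }
    where open Representation X

  infix 1 _⟶_

  record _⟶_ {n} (X Y : Representation n) : Set where
    private
      module X = Representation X
      module Y = Representation Y
    field
      linearMap : LinearMap X.leftModule Y.leftModule
    open LinearMap linearMap public renaming (⟦_⟧ to to)
    field
      equivariant : ∀ g x → to (X.act g x) Y.≈ᴹ Y.act g (to x)

  open _⟶_ using (to)

  private variable n : ℕ

  ∏ʳ : (I → Representation n) → Representation n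
  ∏ʳ X = record
    { leftModule = ∏ (λ i → X.leftModule i)
    ; act        = λ g x i → X.act i g (x i)
    ; act-cong   = λ g≈h p i → X.act-cong i g≈h (p i)
    ; act-+      = λ g x y i → X.act-+ i g (x i) (y i)
    ; act-*      = λ g c x i → X.act-* i g c (x i)
    ; act-id     = λ x i → X.act-id i (x i)
    ; act-∘      = λ g h x i → X.act-∘ i g h (x i)
    }
    where module X i = Representation (X i)

  𝟎 : Representation n
  𝟎 = record { leftModule = Zero.leftModule }

  infixr 4 _⊕_

  _⊕_ : Representation n → Representation n → Representation n
  X ⊕ Y = record
    { leftModule = DirectProduct.leftModule X.leftModule Y.leftModule
    ; act        = λ g (x , y) → X.act g x , Y.act g y
    ; act-cong   = λ g≈h (p , q) → X.act-cong g≈h p , Y.act-cong g≈h q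
    ; act-+      = λ g (x , y) (x′ , y′) → X.act-+ g x x′ , Y.act-+ g y y′
    ; act-*      = λ g c (x , y) → X.act-* g c x , Y.act-* g c y
    ; act-id     = λ (x , y) → X.act-id x , Y.act-id y
    ; act-∘      = λ g h (x , y) → X.act-∘ g h x , Y.act-∘ g h y
    }
    where
    module X = Representation X
    module Y = Representation Y

  record Subrepresentation (X : Representation n) : Set₁ where
    open Representation X
    field
      submodule : Submodule leftModule
    open Submodule submodule public
    field
      act-closed : ∀ g {x} → x ∈ → act g x ∈

  restrictʳ : (X : Representation n) → Subrepresentation X → Representation n
  restrictʳ X P = record
    { leftModule = restrict leftModule submodule
    ; act        = λ g (x , p) → act g x , act-closed g p
    ; act-cong   = act-cong
    ; act-+      = λ g (x , _) (y , _) → act-+ g x y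
    ; act-*      = λ g c (x , _) → act-* g c x
    ; act-id     = λ (x , _) → act-id x
    ; act-∘      = λ g h (x , _) → act-∘ g h x
    }
    where
    open Representation X
    open Subrepresentation P

  quotientʳ : (X : Representation n) → Subrepresentation X → Representation n
  quotientʳ X P = record
    { leftModule = quotient leftModule submodule
    ; act        = act
    ; act-cong   = λ {g} {h} {x} {y} g≈h p →
        resp (≈ᴹ-trans (act-+ g x (-ᴹ y))
               (+ᴹ-congˡ (≈ᴹ-trans (act-neg g y) (-ᴹ‿cong (act-cong g≈h ≈ᴹ-refl)))))
             (act-closed g p)
    ; act-+      = λ g x y → difference (act-+ g x y)
    ; act-*      = λ g c x → difference (act-* g c x)
    ; act-id     = λ x → difference (act-id x)
    ; act-∘      = λ g h x → difference (act-∘ g h x)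
    }
    where
    open Representation X
    open Subrepresentation P

    act-neg : ∀ g x → act g (-ᴹ x) ≈ᴹ -ᴹ act g x
    act-neg g x = ≈ᴹ-trans (act-cong (λ _ → ≡.refl) (≈ᴹ-sym (-1*x≈-x x)))
                  (≈ᴹ-trans (act-* g (-ₛ 1ₛ) x) (-1*x≈-x (act g x)))

  -- Direct sums over ℕ: families that vanish beyond some index.
  ⨁ : (ℕ → Representation n) → Representation n
  ⨁ X = restrictʳ (∏ʳ X) record
    { submodule = record
      { _∈       = λ x → ∃[ N ] (∀ j → N ℕ.≤ j → x j ≈₀ X.0ᴹ j)
      ; resp     = λ p (N , z) → N , λ j l → X.≈ᴹ-trans j (X.≈ᴹ-sym j (p j)) (z j l)
      ; 0-closed = 0 , λ j _ → X.≈ᴹ-refl j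
      ; +-closed = λ (M , y) (N , z) → M ℕ.⊔ N , λ j l → X.≈ᴹ-trans j
          (X.+ᴹ-cong j (y j (ℕₚ.m⊔n≤o⇒m≤o M N l)) (z j (ℕₚ.m⊔n≤o⇒n≤o M N l)))
          (X.+ᴹ-identityˡ j (X.0ᴹ j))
      ; *-closed = λ c (N , z) → N , λ j l → X.≈ᴹ-trans j
          (X.*ₗ-cong j K.refl (z j l)) (X.*ₗ-zeroʳ j c)
      }
    ; act-closed = λ g (N , z) → N , λ j l → X.≈ᴹ-trans j
        (X.act-cong j (λ _ → ≡.refl) (X.≈ᴹ-trans j (z j l) (X.≈ᴹ-sym j (X.*ₗ-zeroˡ j (X.0ᴹ j)))))
        (X.≈ᴹ-trans j (X.act-* j g 0ₛ (X.0ᴹ j)) (X.*ₗ-zeroˡ j _))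
    }
    where
    module X i = Representation (X i)
    _≈₀_ : ∀ {j} → X.Carrierᴹ j → X.Carrierᴹ j → Set
    _≈₀_ {j} = X._≈ᴹ_ j

  ⨁-map : {X Y : ℕ → Representation n} → (∀ j → X j ⟶ Y j) → ⨁ X ⟶ ⨁ Y
  ⨁-map {X = X} {Y} f = record
    { linearMap = record
      { ⟦_⟧ = λ (x , N , z) → (λ j → F.to j (x j))
            , N , λ j l → Y.≈ᴹ-trans j (F.cong j (z j l)) (F.0-homo j)
      ; isLinear = record
        { cong   = λ p j → F.cong j (p j)
        ; +-homo = λ (x , _) (y , _) j → F.+-homo j (x j) (y j)
        ; *-homo = λ c (x , _) j → F.*-homo j c (x j)
        }
      }
    ; equivariant = λ g (x , _) j → F.equivariant j g (x j)
    }
    where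
    module F j = _⟶_ (f j)
    module Y j = Representation (Y j)

  -ʳ_ : {X Y : Representation n} → X ⟶ Y → X ⟶ Y
  -ʳ_ {X = X} {Y} f = record
    { linearMap = record
      { ⟦_⟧ = λ x → -ᴹ (F.to x)
      ; isLinear = record
        { cong   = λ p → -ᴹ‿cong (F.cong p)
        ; +-homo = λ x y → ≈ᴹ-trans (-ᴹ‿cong (F.+-homo x y)) (≈ᴹ-sym (⁻¹-∙-comm (F.to x) (F.to y)))
        ; *-homo = λ c x → ≈ᴹ-trans (-ᴹ‿cong (F.*-homo c x)) (neg-* c (F.to x))
        }
      }
    ; equivariant = λ g x → ≈ᴹ-trans (-ᴹ‿cong (F.equivariant g x)) (neg-act g (F.to x))
    }
    where
    module F = _⟶_ f
    open Representation Y
    open import Algebra.Properties.AbelianGroup +ᴹ-abelianGroup using (⁻¹-∙-comm; inverseˡ-unique)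
    neg-* : ∀ c y → -ᴹ (c *ₗ y) ≈ᴹ c *ₗ (-ᴹ y)
    neg-* c y = ≈ᴹ-sym (inverseˡ-unique (c *ₗ (-ᴹ y)) (c *ₗ y)
      (≈ᴹ-trans (≈ᴹ-sym (*ₗ-distribˡ c (-ᴹ y) y))
      (≈ᴹ-trans (*ₗ-cong K.refl (-ᴹ‿inverseˡ y)) (*ₗ-zeroʳ c))))
    neg-act : ∀ g y → -ᴹ (act g y) ≈ᴹ act g (-ᴹ y)
    neg-act g y = ≈ᴹ-sym (inverseˡ-unique (act g (-ᴹ y)) (act g y)
      (≈ᴹ-trans (≈ᴹ-sym (act-+ g (-ᴹ y) y))
      (≈ᴹ-trans (act-cong (λ _ → ≡.refl)
        (≈ᴹ-trans (-ᴹ‿inverseˡ y) (≈ᴹ-sym (*ₗ-zeroˡ 0ᴹ))))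
      (≈ᴹ-trans (act-* g 0ₛ 0ᴹ) (*ₗ-zeroˡ (act g 0ᴹ))))))

  ⟪_,_⟫ : {X Y Z : Representation n} → X ⟶ Y → X ⟶ Z → X ⟶ Y ⊕ Z
  ⟪ f , g ⟫ = record
    { linearMap = record
      { ⟦_⟧ = λ x → (F.to x) , (G.to x)
      ; isLinear = record
        { cong   = λ p → F.cong p , G.cong p
        ; +-homo = λ x y → F.+-homo x y , G.+-homo x y
        ; *-homo = λ c x → F.*-homo c x , G.*-homo c x
        }
      }
    ; equivariant = λ h x → F.equivariant h x , G.equivariant h x
    }
    where
    module F = _⟶_ f
    module G = _⟶_ g

  [_∣_] : {X Y Z : Representation n} → X ⟶ Z → Y ⟶ Z → X ⊕ Y ⟶ Z
  [_∣_] {Z = Z} f g = record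
    { linearMap = record
      { ⟦_⟧ = λ (x , y) → (F.to x) +ᴹ (G.to y)
      ; isLinear = record
        { cong   = λ (p , q) → +ᴹ-cong (F.cong p) (G.cong q)
        ; +-homo = λ (x , y) (x′ , y′) → ≈ᴹ-trans (+ᴹ-cong (F.+-homo x x′) (G.+-homo y y′))
            (interchange (F.to x) (F.to x′) (G.to y) (G.to y′))
        ; *-homo = λ c (x , y) → ≈ᴹ-trans (+ᴹ-cong (F.*-homo c x) (G.*-homo c y))
            (≈ᴹ-sym (*ₗ-distribˡ c (F.to x) (G.to y)))
        }
      }
    ; equivariant = λ h (x , y) → ≈ᴹ-trans (+ᴹ-cong (F.equivariant h x) (G.equivariant h y))
        (≈ᴹ-sym (act-+ h (F.to x) (G.to y)))
    }
    where
    module F = _⟶_ f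
    module G = _⟶_ g
    open Representation Z
    open import Algebra.Properties.CommutativeSemigroup
      (CommutativeMonoid.commutativeSemigroup +ᴹ-commutativeMonoid) using (interchange)

  module _ {X Y Z : Representation n} (f : X ⟶ Y) (g : Y ⟶ Z) where
    private
      module F = _⟶_ f
      module G = _⟶_ g
      module X = Representation X
      module Y = Representation Y
      module Z = Representation Z

    kernel : Subrepresentation Y
    kernel = record
      { submodule = record
        { _∈       = λ y → (G.to y) Z.≈ᴹ Z.0ᴹ
        ; resp     = λ p z → Z.≈ᴹ-trans (G.cong (Y.≈ᴹ-sym p)) z
        ; 0-closed = G.0-homo
        ; +-closed = λ {x} {y} p q → Z.≈ᴹ-trans (G.+-homo x y)
            (Z.≈ᴹ-trans (Z.+ᴹ-cong p q) (Z.+ᴹ-identityˡ Z.0ᴹ))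
        ; *-closed = λ c {x} p → Z.≈ᴹ-trans (G.*-homo c x)
            (Z.≈ᴹ-trans (Z.*ₗ-cong K.refl p) (Z.*ₗ-zeroʳ c))
        }
      ; act-closed = λ h {x} p → Z.≈ᴹ-trans (G.equivariant h x)
          (Z.≈ᴹ-trans (Z.act-cong (λ _ → ≡.refl) (Z.≈ᴹ-trans p (Z.≈ᴹ-sym (Z.*ₗ-zeroˡ Z.0ᴹ))))
          (Z.≈ᴹ-trans (Z.act-* h 0ₛ Z.0ᴹ) (Z.*ₗ-zeroˡ (Z.act h Z.0ᴹ))))
      }

    -- im f ∩ ker g, which is im f as soon as g ∘ f = 0.
    image : Subrepresentation (restrictʳ Y kernel)
    image = record
      { submodule = record
        { _∈       = λ (y , _) → ∃[ x ] (F.to x) Y.≈ᴹ y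
        ; resp     = λ p (x , q) → x , Y.≈ᴹ-trans q p
        ; 0-closed = X.0ᴹ , F.0-homo
        ; +-closed = λ (x , p) (y , q) → x X.+ᴹ y , Y.≈ᴹ-trans (F.+-homo x y) (Y.+ᴹ-cong p q)
        ; *-closed = λ c (x , p) → c X.*ₗ x , Y.≈ᴹ-trans (F.*-homo c x) (Y.*ₗ-cong K.refl p)
        }
      ; act-closed = λ h (x , p) → X.act h x
          , Y.≈ᴹ-trans (F.equivariant h x) (Y.act-cong (λ _ → ≡.refl) p)
      }

    homology : Representation n
    homology = quotientʳ (restrictʳ Y kernel) image

  homology-map : {X Y Z X′ Y′ Z′ : Representation n}
    {f : X ⟶ Y} {g : Y ⟶ Z} {f′ : X′ ⟶ Y′} {g′ : Y′ ⟶ Z′}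
    (a : X ⟶ X′) (b : Y ⟶ Y′) (c : Z ⟶ Z′) →
    (let module Y′ = Representation Y′
         module Z′ = Representation Z′) →
    (∀ x → to f′ (to a x) Y′.≈ᴹ to b (to f x)) →
    (∀ y → to g′ (to b y) Z′.≈ᴹ to c (to g y)) →
    homology f g ⟶ homology f′ g′
  homology-map {Y′ = Y′} {Z′} {f} {g} {f′} {g′} a b c left right = record
    { linearMap = record
      { ⟦_⟧ = λ (y , p) → (B.to y)
            , Z′.≈ᴹ-trans (right y) (Z′.≈ᴹ-trans (C.cong p) C.0-homo)
      ; isLinear = record
        { cong   = λ {(y , _)} {(z , _)} (x , p) → (A.to x)
                 , Y′.≈ᴹ-trans (left x) (Y′.≈ᴹ-trans (B.cong p)
                   (Y′.≈ᴹ-trans (B.+-homo y _) (Y′.+ᴹ-congˡ (B.isLeftModuleHomomorphism .-ᴹ-homo z))))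
        ; +-homo = λ (y , _) (z , _) → difference′ (B.+-homo y z)
        ; *-homo = λ c (y , _) → difference′ (B.*-homo c y)
        }
      }
    ; equivariant = λ h (y , _) → difference′ (B.equivariant h y)
    }
    where
    module A = _⟶_ a
    module B = _⟶_ b
    module C = _⟶_ c
    module Y′ = Representation Y′
    module Z′ = Representation Z′
    open IsLeftModuleHomomorphism using (-ᴹ-homo)
    difference′ : ∀ {y z} → y Y′.≈ᴹ z → ∃[ x ] to f′ x Y′.≈ᴹ (y Y′.+ᴹ Y′.-ᴹ z)
    difference′ {y} {z} p = _ , Y′.≈ᴹ-trans (_⟶_.0-homo f′)
      (Y′.≈ᴹ-sym (Y′.≈ᴹ-trans (Y′.+ᴹ-congʳ p) (Y′.-ᴹ‿inverseʳ z)))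

  Exact : {X Y Z : Representation n} → X ⟶ Y → Y ⟶ Z → Set
  Exact {Y = Y} {Z} f g = ∀ y → to g y Z.≈ᴹ Z.0ᴹ ⇔ (∃[ x ] to f x Y.≈ᴹ y)
    where
    module Y = Representation Y
    module Z = Representation Z

  Surjective : {X Y : Representation n} → X ⟶ Y → Set
  Surjective {Y = Y} f = ∀ y → ∃[ x ] to f x Y.≈ᴹ y
    where module Y = Representation Y

module ChromaticHomology (K : CommutativeRing 0ℓ 0ℓ) (reciprocals : HasReciprocals K) where

  open LinearAlgebra K
  open LinearMap using (⟦_⟧)
  open _⟶_ using (to)
  open HasReciprocals reciprocals
  private module K = CommutativeRing K
  open K using () renaming (Carrier to Scalar; _≈_ to _≈ₛ_; 0# to 0ₛ; 1# to 1ₛ)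
  open import Algebra.Properties.CommutativeMonoid.Sum K.+-commutativeMonoid
    using (sum; sum-cong-≋; ∑-distrib-+; sum-permute)
  open import Relation.Binary.Reasoning.Setoid K.setoid
  open RawMonoidDefs K.+-rawMonoid using () renaming (_×_ to _×ₙ_)

  -- (g x)ᵥ = x_{g⁻¹ v}
  permute : ∀ {n} → 𝔖 n → LinearMap (coordinates n) (coordinates n)
  permute g = record
    { ⟦_⟧ = λ x v → x (g ⟨$⟩ˡ v)
    ; isLinear = record
      { cong   = λ p v → p (g ⟨$⟩ˡ v)
      ; +-homo = λ _ _ _ → K.refl
      ; *-homo = λ _ _ _ → K.refl
      }
    }

  private
    if-cong : ∀ {b c} {x y : Scalar} → b ≡ c → x ≈ₛ y →
              (if b then x else 0ₛ) ≈ₛ (if c then y else 0ₛ)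
    if-cong {true}  ≡.refl p = p
    if-cong {false} ≡.refl p = K.refl

    if-+ : ∀ b (x y : Scalar) → (if b then x K.+ y else 0ₛ) ≈ₛ
                               (if b then x else 0ₛ) K.+ (if b then y else 0ₛ)
    if-+ true  x y = K.refl
    if-+ false x y = K.sym (K.+-identityˡ 0ₛ)

    if-* : ∀ b c (x : Scalar) → (if b then c K.* x else 0ₛ) ≈ₛ c K.* (if b then x else 0ₛ)
    if-* true  c x = K.refl
    if-* false c x = K.sym (K.zeroʳ c)

    sum-* : ∀ {n} c (x : Fin n → Scalar) → sum (λ u → c K.* x u) ≈ₛ c K.* sum x
    sum-* {zero}  c x = K.sym (K.zeroʳ c)
    sum-* {suc n} c x = K.trans (K.+-congˡ (sum-* c (x ∘ suc))) (K.sym (K.distribˡ c _ _))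

    sum-indicator : ∀ {n} (b : Fin n → Bool) c →
      sum (λ u → if b u then c else 0ₛ) ≈ₛ (∣ tabulate b ∣ ×ₙ 1ₛ) K.* c
    sum-indicator {zero}  b c = K.sym (K.zeroˡ c)
    sum-indicator {suc n} b c with b zero
    ... | true  = K.trans (K.+-cong (K.sym (K.*-identityˡ c)) (sum-indicator (b ∘ suc) c))
                    (K.sym (K.distribʳ c 1ₛ _))
    ... | false = K.trans (K.+-identityˡ _) (sum-indicator (b ∘ suc) c)

    count-pos : ∀ {n} (b : Fin n → Bool) v → b v ≡ true → ∃[ k ] ∣ tabulate b ∣ ≡ suc k
    count-pos b zero    p rewrite p = ∣ tabulate (b ∘ suc) ∣ , ≡.refl
    count-pos b (suc v) p with b zero
    ... | true  = ∣ tabulate (b ∘ suc) ∣ , ≡.refl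
    ... | false = count-pos (b ∘ suc) v p

  module _ {n} (P : Partition n) where
    open Partition P

    blockSum : (Fin n → Scalar) → Fin n → Scalar
    blockSum x v = sum λ u → if does (u ~? v) then x u else 0ₛ

    blockSum-cong : ∀ {x y} → (∀ u → x u ≈ₛ y u) → ∀ v → blockSum x v ≈ₛ blockSum y v
    blockSum-cong {x} {y} p v = sum-cong-≋ λ u → if-cong {does (u ~? v)} ≡.refl (p u)

    blockSum-+ : ∀ x y v → blockSum (λ u → x u K.+ y u) v ≈ₛ blockSum x v K.+ blockSum y v
    blockSum-+ x y v = K.trans (sum-cong-≋ λ u → if-+ (does (u ~? v)) (x u) (y u))
      (∑-distrib-+ (λ u → if does (u ~? v) then x u else 0ₛ) (λ u → if does (u ~? v) then y u else 0ₛ))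

    blockSum-* : ∀ c x v → blockSum (λ u → c K.* x u) v ≈ₛ c K.* blockSum x v
    blockSum-* c x v = K.trans (sum-cong-≋ λ u → if-* (does (u ~? v)) c (x u))
      (sum-* c (λ u → if does (u ~? v) then x u else 0ₛ))

    blockSum-0 : ∀ v → blockSum (λ _ → 0ₛ) v ≈ₛ 0ₛ
    blockSum-0 v = K.trans (sum-indicator (λ u → does (u ~? v)) 0ₛ) (K.zeroʳ _)

    blockSum-~ : ∀ x {u v} → u ~ v → blockSum x u ≈ₛ blockSum x v
    blockSum-~ x u~v = sum-cong-≋ λ w → if-cong (does-cong u~v w) K.refl

    blockSum-permute : ∀ h → Stabilises h → ∀ x v → blockSum (⟦ permute h ⟧ x) v ≈ₛ blockSum x v
    blockSum-permute h s x v = K.trans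
      (sum-permute (λ u → if does (u ~? v) then x (h ⟨$⟩ˡ u) else 0ₛ) h)
      (sum-cong-≋ λ u → if-cong
        (does-⇔ (mk⇔ (~-trans (~-sym (s u))) (~-trans (s u))) (h ⟨$⟩ʳ u ~? v) (u ~? v))
        (K.reflexive (≡.cong x (Perm.inverseˡ h))))

    -- W_P = ⊕ₖ W_{Bₖ} ⊆ Kⁿ for the blocks B₁, …, Bᵣ of P, where W_B, the
    -- vectors on B with coordinate sum 0, realises the Specht module of shape
    -- (|B| - 1, 1).
    zeroSum : Submodule (coordinates n)
    zeroSum = record
      { _∈       = λ x → ∀ v → blockSum x v ≈ₛ 0ₛ
      ; resp     = λ p z v → K.trans (blockSum-cong (λ u → K.sym (p u)) v) (z v)
      ; 0-closed = blockSum-0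
      ; +-closed = λ {x} {y} p q v → K.trans (blockSum-+ x y v)
          (K.trans (K.+-cong (p v) (q v)) (K.+-identityˡ 0ₛ))
      ; *-closed = λ c {x} p v → K.trans (blockSum-* c x v) (K.trans (K.*-congˡ (p v)) (K.zeroʳ c))
      }

    W : Module
    W = restrict (coordinates n) zeroSum

    -- The average of x over the block of v, which has at least one element.
    mean : (Fin n → Scalar) → Fin n → Scalar
    mean x v = (1/1+ ℕ.pred ∣ block v ∣) K.* blockSum x v

    mean-~ : ∀ x {u v} → u ~ v → mean x u ≈ₛ mean x v
    mean-~ x {u} {v} u~v =
      K.*-cong (K.reflexive (≡.cong (λ B → 1/1+ ℕ.pred ∣ B ∣) (block-cong u~v))) (blockSum-~ x u~v)

    blockSum-mean : ∀ x v → blockSum (mean x) v ≈ₛ blockSum x v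
    blockSum-mean x v = begin
      blockSum (mean x) v
        ≈⟨ sum-cong-≋ on-block ⟩
      sum (λ u → if does (u ~? v) then mean x v else 0ₛ)
        ≈⟨ sum-indicator (λ u → does (u ~? v)) (mean x v) ⟩
      (∣ block v ∣ ×ₙ 1ₛ) K.* ((1/1+ ℕ.pred ∣ block v ∣) K.* blockSum x v)
        ≈⟨ K.*-assoc _ _ _ ⟨
      ((∣ block v ∣ ×ₙ 1ₛ) K.* (1/1+ ℕ.pred ∣ block v ∣)) K.* blockSum x v
        ≈⟨ K.*-congʳ (inverse (count-pos (λ u → does (u ~? v)) v (dec-true (v ~? v) ~-refl))) ⟩
      1ₛ K.* blockSum x v
        ≈⟨ K.*-identityˡ _ ⟩
      blockSum x v ∎
      where
      on-block : ∀ u → (if does (u ~? v) then mean x u else 0ₛ) ≈ₛ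
                       (if does (u ~? v) then mean x v else 0ₛ)
      on-block u with u ~? v
      ... | yes u~v = mean-~ x u~v
      ... | no  _   = K.refl
      inverse : ∀ {b} → ∃[ k ] b ≡ suc k → (b ×ₙ 1ₛ) K.* (1/1+ ℕ.pred b) ≈ₛ 1ₛ
      inverse (k , ≡.refl) = 1/1+-inverse k

    -- The orthogonal projection Kⁿ → W_P: the difference x - π x is constant
    -- on each block, hence orthogonal to W_P.
    π : LinearMap (coordinates n) W
    π = record
      { ⟦_⟧ = λ x → (λ v → x v K.- mean x v) , sums x
      ; isLinear = record
        { cong   = λ p v → K.+-cong (p v) (K.-‿cong (K.*-congˡ (blockSum-cong p v)))
        ; +-homo = λ x y v → K.trans
            (K.+-congˡ (K.trans (K.-‿cong (K.trans (K.*-congˡ (blockSum-+ x y v)) (K.distribˡ _ _ _)))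
              (K.sym (⁻¹-∙-comm (mean x v) (mean y v)))))
            (interchange (x v) (y v) (K.- mean x v) (K.- mean y v))
        ; *-homo = λ c x v → K.sym (K.trans (K.distribˡ c (x v) (K.- mean x v))
            (K.+-congˡ (K.trans (K.sym (-‿distribʳ-* c (mean x v))) (K.-‿cong (begin
              c K.* (_ K.* blockSum x v)    ≈⟨ K.*-assoc c _ _ ⟨
              (c K.* _) K.* blockSum x v    ≈⟨ K.*-congʳ (K.*-comm c _) ⟩
              (_ K.* c) K.* blockSum x v    ≈⟨ K.*-assoc _ c _ ⟩
              _ K.* (c K.* blockSum x v)    ≈⟨ K.*-congˡ (blockSum-* c x v) ⟨
              mean (λ u → c K.* x u) v      ∎)))))
        }
      }
      where
      open import Algebra.Properties.AbelianGroup K.+-abelianGroup using (⁻¹-∙-comm)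
      open import Algebra.Properties.Ring K.ring using (-1*x≈-x; -‿distribʳ-*)
      open import Algebra.Properties.CommutativeSemigroup
        (CommutativeMonoid.commutativeSemigroup K.+-commutativeMonoid) using (interchange)
      sums : ∀ x v → blockSum (λ u → x u K.- mean x u) v ≈ₛ 0ₛ
      sums x v = begin
        blockSum (λ u → x u K.- mean x u) v
          ≈⟨ blockSum-+ x (λ u → K.- mean x u) v ⟩
        blockSum x v K.+ blockSum (λ u → K.- mean x u) v
          ≈⟨ K.+-congˡ (blockSum-cong (λ u → K.sym (-1*x≈-x (mean x u))) v) ⟩
        blockSum x v K.+ blockSum (λ u → K.- 1ₛ K.* mean x u) v
          ≈⟨ K.+-congˡ (blockSum-* (K.- 1ₛ) (mean x) v) ⟩
        blockSum x v K.+ K.- 1ₛ K.* blockSum (mean x) v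
          ≈⟨ K.+-congˡ (-1*x≈-x _) ⟩
        blockSum x v K.- blockSum (mean x) v
          ≈⟨ K.+-congˡ (K.-‿cong (blockSum-mean x v)) ⟩
        blockSum x v K.- blockSum x v
          ≈⟨ K.-‿inverseʳ _ ⟩
        0ₛ ∎

    inclusion : LinearMap W (coordinates n)
    inclusion = record
      { ⟦_⟧ = proj₁
      ; isLinear = record
        { cong = λ p → p ; +-homo = λ _ _ _ → K.refl ; *-homo = λ _ _ _ → K.refl }
      }

    -- The action of 𝔖_P on W_P.
    permuteW : ∀ h → Stabilises h → LinearMap W W
    permuteW h s = record
      { ⟦_⟧ = λ (x , z) → ⟦ permute h ⟧ x , λ v → K.trans (blockSum-permute h s x v) (z v)
      ; isLinear = record
        { cong   = λ p v → p (h ⟨$⟩ˡ v)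
        ; +-homo = λ _ _ _ → K.refl
        ; *-homo = λ _ _ _ → K.refl
        }
      }

    -- 𝓜 j is the degree j part K[𝔖ₙ] ⊗_{K[𝔖_P]} ⋀ʲ W_P of the induced module,
    -- with ⟨ g , x ⟩ standing for g ⊗ x.  As b runs over the block sizes, ⋀ W_P
    -- is the tensor product of the graded modules L_b = ⋀ S^{(b-1,1)}.
    data Ind-Relation (j : ℕ) : Rel (Term (𝔖 n × LeftModule.Carrierᴹ (⋀ W j))) 0ℓ where
      congruent   : ∀ {g h x y} → g Perm.≈ h → LeftModule._≈ᴹ_ (⋀ W j) x y →
                    Ind-Relation j ⟨ g , x ⟩ ⟨ h , y ⟩
      additive    : ∀ g x y → Ind-Relation j ⟨ g , x ⊞ y ⟩ (⟨ g , x ⟩ ⊞ ⟨ g , y ⟩)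
      homogeneous : ∀ g c x → Ind-Relation j ⟨ g , c ⊡ x ⟩ (c ⊡ ⟨ g , x ⟩)
      balanced    : ∀ g h (s : Stabilises h) x →
                    Ind-Relation j ⟨ g · h , x ⟩ ⟨ g , ⟦ ⋀-map j (permuteW h s) ⟧ x ⟩

    𝓜 : ℕ → Representation n
    𝓜 j = record
      { leftModule = presented _ (Ind-Relation j)
      ; act        = λ g → extend (presented _ (Ind-Relation j)) (λ (h , x) → ⟨ g · h , x ⟩)
      ; act-cong   = λ {g} {g′} {t} {u} g≈g′ p → trans (left-cong {g} {g′} g≈g′ t) (LinearMap.cong (left g′) p)
      ; act-+      = λ g _ _ → refl
      ; act-*      = λ g _ _ → refl
      ; act-id     = extend-unique (left Perm.id) identityˡ (λ _ → refl)
      ; act-∘      = λ g h → extend-unique (left (g · h)) (left g ∘ˡ left h) (λ _ → refl)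
      }
      where
      M = presented _ (Ind-Relation j)

      left : 𝔖 n → LinearMap M M
      left g = extend-linear M (λ (h , x) → ⟨ g · h , x ⟩) λ where
        (congruent h≈k p)   → relation (congruent (λ v → ≡.cong (g ⟨$⟩ʳ_) (h≈k v)) p)
        (additive h x y)    → relation (additive (g · h) x y)
        (homogeneous h c x) → relation (homogeneous (g · h) c x)
        (balanced h k s x)  → trans (relation (congruent (λ _ → ≡.refl) refl))
                                    (relation (balanced (g · h) k s x))

      identityˡ : LinearMap M M
      identityˡ = record
        { ⟦_⟧ = id
        ; isLinear = record { cong = id ; +-homo = λ _ _ → refl ; *-homo = λ _ _ → refl }
        }

      left-cong : ∀ {g g′} → g Perm.≈ g′ → ∀ t → Congruence (Ind-Relation j) (⟦ left g ⟧ t) (⟦ left g′ ⟧ t)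
      left-cong {g} {g′} g≈g′ = extend-unique (left g) (left g′)
        λ (h , x) → relation (congruent (λ v → g≈g′ (h ⟨$⟩ʳ v)) refl)

  module _ (M : Module) where
    open LeftModule M

    ∑ : {A : Set} → List A → (A → Carrierᴹ) → Carrierᴹ
    ∑ []       f = 0ᴹ
    ∑ (x ∷ xs) f = f x +ᴹ ∑ xs f

    module _ {A : Set} where

      ∑-cong : ∀ {f g : A → Carrierᴹ} {xs} → All (λ x → f x ≈ᴹ g x) xs → ∑ xs f ≈ᴹ ∑ xs g
      ∑-cong []       = ≈ᴹ-refl
      ∑-cong (p ∷ ps) = +ᴹ-cong p (∑-cong ps)

      ∑-cong′ : ∀ {f g : A → Carrierᴹ} → (∀ x → f x ≈ᴹ g x) → ∀ xs → ∑ xs f ≈ᴹ ∑ xs g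
      ∑-cong′ p xs = ∑-cong {xs = xs} (All.universal p xs)

      ∑-0 : ∀ xs → ∑ {A} xs (λ _ → 0ᴹ) ≈ᴹ 0ᴹ
      ∑-0 []       = ≈ᴹ-refl
      ∑-0 (x ∷ xs) = ≈ᴹ-trans (+ᴹ-identityˡ _) (∑-0 xs)

      ∑-+ : ∀ xs (f g : A → Carrierᴹ) → ∑ xs (λ x → f x +ᴹ g x) ≈ᴹ ∑ xs f +ᴹ ∑ xs g
      ∑-+ []       f g = ≈ᴹ-sym (+ᴹ-identityˡ 0ᴹ)
      ∑-+ (x ∷ xs) f g = ≈ᴹ-trans (+ᴹ-congˡ (∑-+ xs f g)) (interchange (f x) (g x) (∑ xs f) (∑ xs g))
        where open import Algebra.Properties.CommutativeSemigroup
                (CommutativeMonoid.commutativeSemigroup +ᴹ-commutativeMonoid) using (interchange)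

      ∑-* : ∀ xs c (f : A → Carrierᴹ) → ∑ xs (λ x → c *ₗ f x) ≈ᴹ c *ₗ ∑ xs f
      ∑-* []       c f = ≈ᴹ-sym (*ₗ-zeroʳ c)
      ∑-* (x ∷ xs) c f = ≈ᴹ-trans (+ᴹ-congˡ (∑-* xs c f)) (≈ᴹ-sym (*ₗ-distribˡ c (f x) (∑ xs f)))

    ∑-swap : ∀ {A B : Set} (xs : List A) (ys : List B) (f : A → B → Carrierᴹ) →
             ∑ xs (λ x → ∑ ys (f x)) ≈ᴹ ∑ ys (λ y → ∑ xs (λ x → f x y))
    ∑-swap []       ys f = ≈ᴹ-sym (∑-0 ys)
    ∑-swap (x ∷ xs) ys f = ≈ᴹ-trans (+ᴹ-congˡ (∑-swap xs ys f))
                                    (≈ᴹ-sym (∑-+ ys (f x) (λ y → ∑ xs (λ x → f x y))))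

    ∑-map : ∀ {A B : Set} (h : A → B) xs (f : B → Carrierᴹ) → ∑ (map h xs) f ≈ᴹ ∑ xs (f ∘ h)
    ∑-map h []       f = ≈ᴹ-refl
    ∑-map h (x ∷ xs) f = +ᴹ-congˡ (∑-map h xs f)

    -- Two systems of representatives of the same classes give the same sum.
    module _ {A : Set} (_~_ : Rel A 0ℓ) (isDecEquivalence : IsDecEquivalence _~_)
             (f : A → Carrierᴹ) (f-resp : ∀ {x y} → x ~ y → f x ≈ᴹ f y) where
      private module E = IsDecEquivalence isDecEquivalence

      private
        pick : ∀ {x ys} → AllPairs (λ y z → ¬ (y ~ z)) ys → Any (x ~_) ys →
               ∑ ys (λ y → if does (x E.≟ y) then f y else 0ᴹ) ≈ᴹ f x
        pick {x} {y ∷ ys} (y≁ ∷ _) (here x~y) =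
          ≈ᴹ-trans (+ᴹ-cong first (≈ᴹ-trans (∑-cong {xs = ys} (All.map rest y≁)) (∑-0 ys)))
                   (+ᴹ-identityʳ (f x))
          where
          first : (if does (x E.≟ y) then f y else 0ᴹ) ≈ᴹ f x
          first rewrite dec-true (x E.≟ y) x~y = f-resp (E.sym x~y)
          rest : ∀ {z} → ¬ (y ~ z) → (if does (x E.≟ z) then f z else 0ᴹ) ≈ᴹ 0ᴹ
          rest {z} y≁z rewrite dec-false (x E.≟ z) (λ x~z → y≁z (E.trans (E.sym x~y) x~z)) = ≈ᴹ-refl
        pick {x} {y ∷ ys} (y≁ ∷ ys!) (there x~ys) =
          ≈ᴹ-trans (+ᴹ-cong first (pick ys! x~ys)) (+ᴹ-identityˡ (f x))
          where
          first : (if does (x E.≟ y) then f y else 0ᴹ) ≈ᴹ 0ᴹ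
          first rewrite dec-false (x E.≟ y) (λ x~y → All.lookupAny y≁ x~ys .proj₁
                                      (E.trans (E.sym x~y) (All.lookupAny y≁ x~ys .proj₂))) = ≈ᴹ-refl

        swap-if : ∀ x y → (if does (x E.≟ y) then f y else 0ᴹ) ≈ᴹ (if does (y E.≟ x) then f x else 0ᴹ)
        swap-if x y with x E.≟ y | y E.≟ x
        ... | yes x~y | yes _   = f-resp (E.sym x~y)
        ... | yes x~y | no  y≁x = contradiction (E.sym x~y) y≁x
        ... | no  x≁y | yes y~x = contradiction (E.sym y~x) x≁y
        ... | no  _   | no  _   = ≈ᴹ-refl

      ∑-representatives : ∀ {xs ys} →
        AllPairs (λ x y → ¬ (x ~ y)) xs → AllPairs (λ x y → ¬ (x ~ y)) ys →
        All (λ x → Any (x ~_) ys) xs → All (λ y → Any (y ~_) xs) ys → ∑ xs f ≈ᴹ ∑ ys f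
      ∑-representatives {xs} {ys} xs! ys! xs⊆ys ys⊆xs =
        ≈ᴹ-trans (≈ᴹ-sym (∑-cong {xs = xs} (All.map (pick ys!) xs⊆ys)))
        (≈ᴹ-trans (∑-swap xs ys (λ x y → if does (x E.≟ y) then f y else 0ᴹ))
        (≈ᴹ-trans (∑-cong′ (λ y → ∑-cong′ (λ x → swap-if x y) xs) ys)
        (∑-cong {xs = ys} (All.map (pick xs!) ys⊆xs))))

  module _ {n} (P Q : Partition n) where
    private
      module P = Partition P
      module Q = Partition Q

    translate : 𝔖 n → LinearMap (W P) (W Q)
    translate h = π Q ∘ˡ permute (Perm.flip h) ∘ˡ inclusion P

    module _ (j : ℕ) where
      private
        M = Representation.leftModule (𝓜 Q j)
        T = transversal P Q

      summand : 𝔖 n → LeftModule.Carrierᴹ (⋀ (W P) j) → 𝔖 n → LeftModule.Carrierᴹ M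
      summand g x h = ⟨ g · h , ⟦ ⋀-map j (translate h) ⟧ x ⟩

      summands : 𝔖 n × LeftModule.Carrierᴹ (⋀ (W P) j) → LeftModule.Carrierᴹ M
      summands (g , x) = ∑ M T (summand g x)

      act-summands : ∀ k g x hs → Congruence (Ind-Relation Q j)
              (Representation.act (𝓜 Q j) k (∑ M hs (summand g x))) (∑ M hs (summand (k · g) x))
      act-summands k g x []       = refl
      act-summands k g x (h ∷ hs) = ⊞-cong (relation (congruent (λ _ → ≡.refl) refl)) (act-summands k g x hs)

      -- The summand depends only on the coset h 𝔖_Q.
      summand-coset : ∀ g x {h k} → Q.SameCoset h k →
                      Congruence (Ind-Relation Q j) (summand g x h) (summand g x k)
      summand-coset g x {h} {k} s = trans
        (relation (congruent (λ _ → ≡.refl) (sym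
          (⋀-map-∘ j (permuteW Q h⁻¹k s) (translate k) (translate h) shift x))))
        (trans (sym (relation (balanced (g · h) h⁻¹k s (⟦ ⋀-map j (translate k) ⟧ x))))
        (relation (congruent (λ v → ≡.cong (g ⟨$⟩ʳ_) (Perm.inverseʳ h)) refl)))
        where
        h⁻¹k = Perm.flip h · k
        shift : ∀ y v → proj₁ (⟦ permuteW Q h⁻¹k s ⟧ (⟦ translate k ⟧ y)) v
                        ≈ₛ proj₁ (⟦ translate h ⟧ y) v
        shift (y , _) v = K.+-cong (K.reflexive (≡.cong y (Perm.inverseʳ k))) (K.-‿cong (begin
          mean Q (y ∘ (k ⟨$⟩ʳ_)) (h⁻¹k ⟨$⟩ˡ v)
            ≈⟨ mean-~ Q (y ∘ (k ⟨$⟩ʳ_)) (Q.flip-stabilises h⁻¹k s v) ⟩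
          mean Q (y ∘ (k ⟨$⟩ʳ_)) v
            ≈⟨ K.*-congˡ (blockSum-permute Q h⁻¹k s (y ∘ (k ⟨$⟩ʳ_)) v) ⟨
          mean Q (λ u → y (k ⟨$⟩ʳ (k ⟨$⟩ˡ (h ⟨$⟩ʳ u)))) v
            ≈⟨ K.*-congˡ (blockSum-cong Q (λ u → K.reflexive (≡.cong y (Perm.inverseʳ k))) v) ⟩
          mean Q (y ∘ (h ⟨$⟩ʳ_)) v ∎))

      summands-resp : ∀ {t u} → Ind-Relation P j t u →
             Congruence (Ind-Relation Q j) (extend M summands t)
                                           (extend M summands u)
      summands-resp (congruent g≈h p) = ∑-cong′ M (λ k → relation (congruent (λ v → g≈h (k ⟨$⟩ʳ v))
        (LinearMap.cong (⋀-map j (translate k)) p))) T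
      summands-resp (additive g x y) = trans (∑-cong′ M (λ k → relation (additive (g · k) _ _)) T)
        (∑-+ M T (summand g x) (summand g y))
      summands-resp (homogeneous g c x) = trans (∑-cong′ M (λ k → relation (homogeneous (g · k) c _)) T)
        (∑-* M T c (summand g x))
      summands-resp (balanced g k s x) =
        trans (∑-cong′ M move T)
        (trans (sym (∑-map M (k ·_) T (summand g kx)))
        (∑-representatives M Q.SameCoset Q.sameCoset-isDecEquivalence (summand g kx)
          (λ {h} {h′} → summand-coset g kx {h} {h′})
          (AllPairsₚ.map⁺ (AllPairs.map (λ {a} {b} a≁b p → a≁b (cancel {a} {b} p)) (transversal-unique P Q))) (transversal-unique P Q)
          (Allₚ.map⁺ (All.map (λ {h} h∈ → transversal-complete P Q (k · h) (P.·-stabilises k h s h∈)) (transversal-stabilises P Q)))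
          (All.map (λ {h} h∈ → Anyₚ.map⁺ (Any.map (λ {a} → uncancel {h} {a})
              (transversal-complete P Q (k⁻¹ · h) (P.·-stabilises k⁻¹ h (P.flip-stabilises k s) h∈)))) (transversal-stabilises P Q))))
        where
        kx  = ⟦ ⋀-map j (permuteW P k s) ⟧ x
        k⁻¹ = Perm.flip k

        move : ∀ h → Congruence (Ind-Relation Q j) (summand (g · k) x h) (summand g kx (k · h))
        move h = relation (congruent (λ _ → ≡.refl) (sym
          (⋀-map-∘ j (translate (k · h)) (permuteW P k s) (translate h) (λ (y , _) v →
            K.+-cong (K.reflexive (≡.cong y (Perm.inverseˡ k)))
              (K.-‿cong (K.*-congˡ (blockSum-cong Q
                (λ u → K.reflexive (≡.cong y (Perm.inverseˡ k))) v)))) x)))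

        cancel : ∀ {a b} → Q.SameCoset (k · a) (k · b) → Q.SameCoset a b
        cancel {a} p v = ≡.subst (Q._~ v) (≡.cong (a ⟨$⟩ˡ_) (Perm.inverseˡ k)) (p v)

        uncancel : ∀ {h a} → Q.SameCoset (k⁻¹ · h) a → Q.SameCoset h (k · a)
        uncancel p v = p v

      -- The map d (g ⊗ x) = Σ_h g h ⊗ (⋀ π) (h⁻¹ x).  If P and Q have the same
      -- blocks, the sum has a single term and d is the identity.
      edgeMap : 𝓜 P j ⟶ 𝓜 Q j
      edgeMap = record
        { linearMap = linear
        ; equivariant = λ k → extend-unique (linear ∘ˡ actMap (𝓜 P j) k) (actMap (𝓜 Q j) k ∘ˡ linear)
            (λ (g , x) → sym (act-summands k g x T))
        }
        where linear = extend-linear M summands summands-resp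

  ----------------------------------------------------------------------
  -- The chain complex.  States of G are edge sets F; a spanning subgraph of G
  -- is given by its edge set S, with the edge order inherited from G.

  module _ (G : Graph) where
    open Graph G

    open import Algebra.Properties.Semiring.Exp K.semiring using (_^_)

    𝓜[_] : Subset m → ℕ → Representation n
    𝓜[ F ] = 𝓜 (components G F)

    Families : ℕ → Representation n
    Families j = ∏ʳ λ F → 𝓜[ F ] j

    _isState_of_ : Subset m → ℕ → Subset m → Set
    F isState i of S = F ⊆ S × ∣ F ∣ ≡ i

    -- C_{i,j}(S), the direct sum of the (M_F)ⱼ over the states F ⊆ S with i
    -- edges, as the families supported on these states.
    C : Subset m → ℕ → ℕ → Representation n
    C S i j = restrictʳ (Families j) record
      { submodule = record
        { _∈       = λ c → ∀ F → ¬ (F isState i of S) → c F ≈ 0ᴹ F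
        ; resp     = λ p z F ¬s → ≈ᴹ-trans F (≈ᴹ-sym F (p F)) (z F ¬s)
        ; 0-closed = λ F _ → ≈ᴹ-refl F
        ; +-closed = λ p q F ¬s → ≈ᴹ-trans F (+ᴹ-cong F (p F ¬s) (q F ¬s)) (+ᴹ-identityˡ F (0ᴹ F))
        ; *-closed = λ a p F ¬s → ≈ᴹ-trans F (*ₗ-cong F K.refl (p F ¬s)) (*ₗ-zeroʳ F a)
        }
      ; act-closed = λ g p F ¬s → act-cong F {g} {g} (λ _ → ≡.refl) (p F ¬s)
      }
      where
      open module M F = Representation (𝓜[ F ] j)
      _≈_ : ∀ {F} → Carrierᴹ F → Carrierᴹ F → Set
      _≈_ {F} = _≈ᴹ_ F

    onesAfter : ∀ {k} → Subset k → Fin k → ℕ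
    onesAfter (_ ∷ F) zero    = ∣ F ∣
    onesAfter (_ ∷ F) (suc e) = onesAfter F e

    sgn : Subset m → Edge → Scalar
    sgn F e = (K.- 1ₛ) ^ onesAfter F e

    -- (d c)_{F′} = Σ sgn(ε) d_ε c_F over the F with F′ = F - e, that is, over
    -- F = F′ ∪ {e} with e ∉ F′.  On C S only the F ⊆ S contribute.
    differential : ∀ j → Families j ⟶ Families j
    differential j = record
      { linearMap = record
        { ⟦_⟧ = λ c F′ → ∑ (M F′) (absent F′) (component c F′)
        ; isLinear = record
          { cong   = λ p F′ → ∑-cong′ (M F′)
              (λ e → ⊡-cong K.refl (E.cong F′ e (p (F′ ∪ ⁅ e ⁆)))) (absent F′)
          ; +-homo = λ b c F′ → trans (∑-cong′ (M F′)
              (λ e → ⊡-distribˡ _ _ _) (absent F′))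
              (∑-+ (M F′) (absent F′) (component b F′) (component c F′))
          ; *-homo = λ a c F′ → trans (∑-cong′ (M F′)
              (λ e → LeftModule.≈ᴹ-trans (M F′) (sym (⊡-assoc _ a _))
                (trans (⊡-cong (K.*-comm _ a) refl) (⊡-assoc a _ _))) (absent F′))
              (∑-* (M F′) (absent F′) a (component c F′))
          }
        }
      ; equivariant = λ g c F′ → act-∑ g c F′ (absent F′)
      }
      where
      M : Subset m → Module
      M F = Representation.leftModule (𝓜[ F ] j)
      module E F′ e = _⟶_ (edgeMap (components G (F′ ∪ ⁅ e ⁆)) (components G F′) j)

      absent : Subset m → List Edge
      absent F′ = filter (λ e → ¬? (e ∈? F′)) (allFin m)

      component : LeftModule.Carrierᴹ (Representation.leftModule (Families j)) →
                  ∀ F′ → Edge → LeftModule.Carrierᴹ (M F′)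
      component c F′ e = sgn (F′ ∪ ⁅ e ⁆) e ⊡ E.to F′ e (c (F′ ∪ ⁅ e ⁆))

      act-∑ : ∀ g c F′ es → LeftModule._≈ᴹ_ (M F′)
        (∑ (M F′) es (component (λ F → Representation.act (𝓜[ F ] j) g (c F)) F′))
        (Representation.act (𝓜[ F′ ] j) g (∑ (M F′) es (component c F′)))
      act-∑ g c F′ []       = refl
      act-∑ g c F′ (e ∷ es) =
        ⊞-cong (⊡-cong K.refl (E.equivariant F′ e g (c (F′ ∪ ⁅ e ⁆)))) (act-∑ g c F′ es)

    private
      ⊆-∪ : ∀ {F S : Subset m} {e} → F ∪ ⁅ e ⁆ ⊆ S → F ⊆ S
      ⊆-∪ {e = e} p x∈F = p (p⊆p∪q ⁅ e ⁆ x∈F)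

      ∣F∪e∣ : ∀ {k} (F : Subset k) e → ¬ (e ∈ F) → ∣ F ∪ ⁅ e ⁆ ∣ ≡ suc ∣ F ∣
      ∣F∪e∣ (true  ∷ F) zero    e∉F = contradiction here e∉F
      ∣F∪e∣ (false ∷ F) zero    e∉F = ≡.cong (λ F → suc ∣ F ∣) (∪-identityʳ F)
      ∣F∪e∣ (true  ∷ F) (suc e) e∉F = ≡.cong suc (∣F∪e∣ F e (e∉F ∘ there))
      ∣F∪e∣ (false ∷ F) (suc e) e∉F = ∣F∪e∣ F e (e∉F ∘ there)

    ∂ : ∀ S i j → C S (suc i) j ⟶ C S i j
    ∂ S i j = record
      { linearMap = record
        { ⟦_⟧ = λ (c , z) → D.to c , supported c z
        ; isLinear = record
          { cong   = D.cong
          ; +-homo = λ (b , _) (c , _) → D.+-homo b c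
          ; *-homo = λ a (c , _) → D.*-homo a c
          }
        }
      ; equivariant = λ g (c , _) → D.equivariant g c
      }
      where
      module D = _⟶_ (differential j)
      supported : ∀ c → (∀ F → ¬ (F isState suc i of S) → Representation._≈ᴹ_ (𝓜[ F ] j) (c F) 𝟘) →
                  ∀ F′ → ¬ (F′ isState i of S) → Representation._≈ᴹ_ (𝓜[ F′ ] j) (D.to c F′) 𝟘
      supported c z F′ ¬s = trans
        (∑-cong M {xs = es} (All.map (λ {e} e∉F′ → vanish e e∉F′) (Allₚ.all-filter (λ e → ¬? (e ∈? F′)) (allFin m))))
        (∑-0 M es)
        where
        M  = Representation.leftModule (𝓜[ F′ ] j)
        es = filter (λ e → ¬? (e ∈? F′)) (allFin m)
        vanish : ∀ e → ¬ (e ∈ F′) → Representation._≈ᴹ_ (𝓜[ F′ ] j)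
          (sgn (F′ ∪ ⁅ e ⁆) e ⊡ to (edgeMap (components G (F′ ∪ ⁅ e ⁆)) (components G F′) j) (c (F′ ∪ ⁅ e ⁆))) 𝟘
        vanish e e∉F′ = trans
          (⊡-cong K.refl (trans (E.cong (z (F′ ∪ ⁅ e ⁆) ¬s⁺)) E.0-homo))
          (LeftModule.*ₗ-zeroʳ M _)
          where
          module E = _⟶_ (edgeMap (components G (F′ ∪ ⁅ e ⁆)) (components G F′) j)
          ¬s⁺ : ¬ ((F′ ∪ ⁅ e ⁆) isState suc i of S)
          ¬s⁺ (F⊆S , ∣F∣≡) = ¬s ( ⊆-∪ {F′} {S} {e} F⊆S
                               , ℕₚ.suc-injective (≡.trans (≡.sym (∣F∪e∣ F′ e e∉F′)) ∣F∣≡))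

    -- C_{i-1,j}(S), with C_{-1,j}(S) = 0, and the differential d_{i,j} into it.
    C⁻ : Subset m → ℕ → ℕ → Representation n
    C⁻ S zero    j = 𝟎
    C⁻ S (suc i) j = C S i j

    d : ∀ S i j → C S i j ⟶ C⁻ S i j
    d S zero    j = record { linearMap = record { isLinear = _ } }
    d S (suc i) j = ∂ S i j

    H[_,_] : ℕ → ℕ → Subset m → Representation n
    H[ i , j ] S = homology (d S (suc i) j) (d S i j)

    H : ℕ → Subset m → Representation n
    H i S = ⨁ λ j → H[ i , j ] S

    -- Concentrated in degree j of H i S = ⊕ⱼ H[ i , j ] S.
    Homogeneous : ∀ i S j → Representation.Carrierᴹ (H i S) → Set
    Homogeneous i S j (x , _) = ∀ k → k ≢ j →
      Representation._≈ᴹ_ (H[ i , k ] S) (x k) (Representation.0ᴹ (H[ i , k ] S))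

    DegreePreserving : ∀ i S k T → (H i S ⟶ H k T) → Set
    DegreePreserving i S k T f = ∀ j x → Homogeneous i S j x → Homogeneous k T j (to f x)

    include : ∀ {S T} → S ⊆ T → ∀ i j → C S i j ⟶ C T i j
    include S⊆T i j = record
      { linearMap = record
        { ⟦_⟧ = λ (c , z) → c , λ F ¬s → z F (λ (F⊆S , ∣F∣≡i) → ¬s (S⊆T ∘ F⊆S , ∣F∣≡i))
        ; isLinear = record
          { cong   = id
          ; +-homo = λ _ _ _ → refl
          ; *-homo = λ _ _ _ → refl
          }
        }
      ; equivariant = λ _ _ _ → refl
      }

    include⁻ : ∀ {S T} → S ⊆ T → ∀ i j → C⁻ S i j ⟶ C⁻ T i j
    include⁻ S⊆T zero    j = record { linearMap = record { isLinear = _ } }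
    include⁻ S⊆T (suc i) j = include S⊆T i j

    include-H : ∀ {S T} → S ⊆ T → ∀ i → H i S ⟶ H i T
    include-H {S} {T} S⊆T i = ⨁-map {X = λ j → H[ i , j ] S} {λ j → H[ i , j ] T} λ j →
      homology-map {f = d S (suc i) j} {d S i j} {d T (suc i) j} {d T i j}
        (include {S} {T} S⊆T (suc i) j) (include {S} {T} S⊆T i j) (include⁻ {S} {T} S⊆T i j)
        (λ _ _ → refl) (commutes i j)
      where
      commutes : ∀ i j x → Representation._≈ᴹ_ (C⁻ T i j)
        (to (d T i j) (to (include {S} {T} S⊆T i j) x)) (to (include⁻ {S} {T} S⊆T i j) (to (d S i j) x))
      commutes zero    j x = _
      commutes (suc i) j x = λ _ → refl

    module _ {S A B : Subset m} (S⊆A : S ⊆ A) (S⊆B : S ⊆ B) where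

      φ : ∀ i → H i S ⟶ H i A ⊕ H i B
      φ i = ⟪_,_⟫ {X = H i S} {H i A} {H i B} (include-H {S} {A} S⊆A i)
              (-ʳ_ {X = H i S} {H i B} (include-H {S} {B} S⊆B i))

    module _ {A B T : Subset m} (A⊆T : A ⊆ T) (B⊆T : B ⊆ T) where

      ψ : ∀ i → H i A ⊕ H i B ⟶ H i T
      ψ i = [_∣_] {X = H i A} {H i B} {H i T} (include-H {A} {T} A⊆T i) (include-H {B} {T} B⊆T i)

minus⊆ : ∀ {m} (S : Subset m) e → S ∖ e ⊆ S
minus⊆ S e = p─q⊆p S ⁅ e ⁆

minus⊆ˡ : ∀ {m} (S : Subset m) e f → S ∖ e ∖ f ⊆ S ∖ e
minus⊆ˡ S e f = p─q⊆p (S ∖ e) ⁅ f ⁆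

minus⊆ʳ : ∀ {m} (S : Subset m) e f → S ∖ e ∖ f ⊆ S ∖ f
minus⊆ʳ S e f {x} x∈ = minus⊆ˡ S f e (≡.subst (x ∈_) (p─x─y≡p─y─x S e f) x∈)

------------------------------------------------------------------------
-- Representations and homology over ℂ.

open LinearAlgebra ℂ public using (_⟶_; _⊕_; Exact; Surjective)
open ChromaticHomology ℂ ℂ-hasReciprocals public using (H; φ; ψ; DegreePreserving)

{-# OPTIONS --safe #-}
module Submission where

-- The chains of A and B together are those supported on states that do not
-- contain both e₁ and e₂.  On the remaining states, adding e₃ does not change
-- the components, so that M_F and M_{F + e₃} are identified by the
-- differential; inverting it gives a homotopy h with D h + h D = id on these
-- states.  Hence a cycle z of G is homologous to N z = z - D h z in C(A) + C(B),
-- and Mayer–Vietoris for 0 → C(A ∩ B) → C(A) ⊕ C(B) → C(A) + C(B) → 0 gives the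
-- sequence: writing P for the part of N z supported on the states of A, the
-- connecting map is δ z = D P.  That D ∘ D = 0 comes from the functoriality of
-- the per-edge maps, M_P → M_Q → M_R being M_P → M_R for R finer than Q finer
-- than P.

open import Algebra.Bundles using (CommutativeRing; CommutativeMonoid)
import Algebra.Definitions.RawMonoid as RawMonoidDefs
open import Algebra.Module.Bundles using (LeftModule)
open import Algebra.Module.Morphism.Structures using (IsLeftModuleHomomorphism)
open import Data.Bool.Base using (Bool; true; false; if_then_else_)
open import Data.Fin.Base using (Fin; zero; suc)
open import Data.Fin.Permutation as Perm using (_⟨$⟩ʳ_; _⟨$⟩ˡ_)
import Data.Fin.Properties as Fin
open import Data.Fin.Subset using (Subset; _∈_; _∉_; _⊆_; _∪_; ⁅_⁆; ⊤; ∣_∣; _-_)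
open import Data.Fin.Subset.Properties
  using (_∈?_; ∪-identityʳ; ∪-assoc; ∪-comm; p⊆p∪q; q⊆p∪q; p─q⊆p; x∈p∪q⁻; x∈⁅x⁆; x∈⁅y⁆⇒x≡y;
         x∈p∧x≢y⇒x∈p-y; ⊆-antisym; ⊆⊤)
open import Data.List.Base using (List; []; _∷_; _++_; map; filter; allFin; cartesianProductWith)
open import Data.List.Membership.Propositional using () renaming (_∈_ to _∈ₗ_)
open import Data.List.Membership.Propositional.Properties using (∈-allFin)
open import Data.List.Relation.Unary.All as All using (All; []; _∷_)
import Data.List.Relation.Unary.All.Properties as Allₚ
open import Data.List.Relation.Unary.AllPairs as AllPairs using (AllPairs; []; _∷_)
import Data.List.Relation.Unary.AllPairs.Properties as AllPairsₚ
open import Data.List.Relation.Unary.Any as Any using (Any; here; there)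
import Data.List.Relation.Unary.Any.Properties as Anyₚ
open import Data.List.Relation.Unary.Unique.Propositional using (Unique)
open import Data.List.Relation.Unary.Unique.Propositional.Properties using (allFin⁺)
import Data.Nat as ℕ
open import Data.Nat.Base using (ℕ; zero; suc)
import Data.Nat.Properties as ℕₚ
open import Data.Product using (Σ-syntax; ∃-syntax; _×_; _,_; proj₁; proj₂)
open import Data.Sum.Base using (_⊎_; inj₁; inj₂)
open import Data.Vec.Base as Vec using (Vec; _∷_; tabulate; here; there)
open import Data.Vec.Relation.Binary.Pointwise.Inductive as Pointwise using (Pointwise)
open import Function.Base using (_∘_; id)
open import Function.Bundles using (mk⇔; Equivalence)
open import Level using (0ℓ)
open import Relation.Binary.Construct.Closure.Equivalence as EqClosure using ()
open import Relation.Binary.Core using (Rel)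
open import Relation.Binary.PropositionalEquality.Core as ≡ using (_≡_; _≢_)
open import Relation.Nullary.Decidable
  using (Dec; yes; no; does; ¬?; dec-true; dec-false; _×-dec_)
open import Relation.Nullary.Negation using (¬_; contradiction)
open import Relation.Unary using (Decidable)

-- The names of Defs for ℂ clash with those for an arbitrary ring of scalars, so
-- they are opened only before the theorem.
open import Defs
  using (HasReciprocals; Graph; Partition; components; 𝔖; _·_; transversal; transversal-stabilises;
         transversal-unique; transversal-complete; minus⊆; minus⊆ˡ; minus⊆ʳ;
         module LinearAlgebra; module ChromaticHomology)

-- The identity D h + h D = id holds only on the states containing e₁ and e₂, while h vanishes on
-- C(A) and on C(B). Hence id - D h - h D retracts the complex of G onto C(A) + C(B). N is this
-- retraction without its last term; the two agree on every chain z with h D z = 0. Such chains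
-- include, besides the cycles, those whose boundary lies in C(A) + C(B). The exactness proofs
-- depend on the latter: a chain bounding a + b must itself be moved into C(A) + C(B).
--
-- All complexes sit inside one module V of families indexed by all edge sets, with D, h and r
-- equivariant endomorphisms of V, and a subcomplex is a condition on supports. So inclusions are
-- identities on chains and δ z = D (r (N z)) is a formula, without a choice of preimages.
--
-- M_F and M_{F - e₃} are different modules even when the components agree, since they are built
-- from different partitions. Edge maps exist in both directions, and functoriality turns either
-- composite into the edge map from a state to itself, which is the identity. This is how h inverts
-- a component of the differential.

module MayerVietoris (K : CommutativeRing 0ℓ 0ℓ) where

  open LinearAlgebra K

  -- Subtraction in modules and linear maps

  module Differences (V : Module) where
    open LeftModule V public
    open import Algebra.Properties.AbelianGroup +ᴹ-abelianGroup public
      using () renaming (⁻¹-∙-comm to -‿+-comm; ⁻¹-involutive to -‿involutive;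
                         x≈y⇒x∙y⁻¹≈ε to x≈y⇒x-y≈0; ε⁻¹≈ε to -0≈0)
    open import Algebra.Solver.CommutativeMonoid +ᴹ-commutativeMonoid
      using (solve; _⊜_) renaming (_⊕_ to _∙_)
    open import Relation.Binary.Reasoning.Setoid ≈ᴹ-setoid public

    infixl 6 _-ᴹ_
    _-ᴹ_ : Carrierᴹ → Carrierᴹ → Carrierᴹ
    x -ᴹ y = x +ᴹ -ᴹ y

    -‿cong₂ : ∀ {x y u v} → x ≈ᴹ y → u ≈ᴹ v → x -ᴹ u ≈ᴹ y -ᴹ v
    -‿cong₂ p q = +ᴹ-cong p (-ᴹ‿cong q)

    x-0≈x : ∀ x → x -ᴹ 0ᴹ ≈ᴹ x
    x-0≈x x = ≈ᴹ-trans (+ᴹ-congˡ -0≈0) (+ᴹ-identityʳ x)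

    x≈0⇒y-x≈y : ∀ {x} y → x ≈ᴹ 0ᴹ → y -ᴹ x ≈ᴹ y
    x≈0⇒y-x≈y y p = ≈ᴹ-trans (-‿cong₂ ≈ᴹ-refl p) (x-0≈x y)

    x+[y-x]≈y : ∀ x y → x +ᴹ (y -ᴹ x) ≈ᴹ y
    x+[y-x]≈y x y = begin
      x +ᴹ (y -ᴹ x)     ≈⟨ solve 3 (λ a b c → a ∙ (b ∙ c) ⊜ b ∙ (a ∙ c)) ≈ᴹ-refl x y (-ᴹ x) ⟩
      y +ᴹ (x -ᴹ x)     ≈⟨ +ᴹ-congˡ (-ᴹ‿inverseʳ x) ⟩
      y +ᴹ 0ᴹ          ≈⟨ +ᴹ-identityʳ y ⟩
      y                ∎

    [x+y]-x≈y : ∀ x y → (x +ᴹ y) -ᴹ x ≈ᴹ y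
    [x+y]-x≈y x y = ≈ᴹ-trans (+ᴹ-assoc x y (-ᴹ x)) (x+[y-x]≈y x y)

    [x-y]-x≈-y : ∀ x y → (x -ᴹ y) -ᴹ x ≈ᴹ -ᴹ y
    [x-y]-x≈-y x y = [x+y]-x≈y x (-ᴹ y)

    +-interchange : ∀ x y u v → (x +ᴹ y) +ᴹ (u +ᴹ v) ≈ᴹ (x +ᴹ u) +ᴹ (y +ᴹ v)
    +-interchange = solve 4 (λ x y u v → (x ∙ y) ∙ (u ∙ v) ⊜ (x ∙ u) ∙ (y ∙ v)) ≈ᴹ-refl

    [[x+y]-z]-y≈x-z : ∀ x y z → ((x +ᴹ y) -ᴹ z) -ᴹ y ≈ᴹ x -ᴹ z
    [[x+y]-z]-y≈x-z x y z = ≈ᴹ-trans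
      (solve 4 (λ a b c d → ((a ∙ b) ∙ c) ∙ d ⊜ ((b ∙ (a ∙ c)) ∙ d)) ≈ᴹ-refl x y (-ᴹ z) (-ᴹ y))
      ([x+y]-x≈y y (x -ᴹ z))

    [x-z]+[y+z]≈x+y : ∀ x y z → (x -ᴹ z) +ᴹ (y +ᴹ z) ≈ᴹ x +ᴹ y
    [x-z]+[y+z]≈x+y x y z = begin
      (x -ᴹ z) +ᴹ (y +ᴹ z)     ≈⟨ +-interchange x (-ᴹ z) y z ⟩
      (x +ᴹ y) +ᴹ (-ᴹ z +ᴹ z) ≈⟨ +ᴹ-congˡ (-ᴹ‿inverseˡ z) ⟩
      (x +ᴹ y) +ᴹ 0ᴹ          ≈⟨ +ᴹ-identityʳ _ ⟩
      x +ᴹ y                  ∎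

  module LinearMapProperties {V U : Module} (f : LinearMap V U) where
    private
      module V = Differences V
      module U = Differences U
    open LinearMap f public using (⟦_⟧; cong; +-homo; *-homo; 0-homo)
    open LinearMap f using (isLeftModuleHomomorphism)

    neg-homo : ∀ x → ⟦ V.-ᴹ x ⟧ U.≈ᴹ U.-ᴹ ⟦ x ⟧
    neg-homo = IsLeftModuleHomomorphism.-ᴹ-homo isLeftModuleHomomorphism

    minus-homo : ∀ x y → ⟦ x V.-ᴹ y ⟧ U.≈ᴹ ⟦ x ⟧ U.-ᴹ ⟦ y ⟧
    minus-homo x y = U.≈ᴹ-trans (+-homo x (V.-ᴹ y)) (U.+ᴹ-congˡ (neg-homo y))

    ≈0 : ∀ {x} → x V.≈ᴹ V.0ᴹ → ⟦ x ⟧ U.≈ᴹ U.0ᴹ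
    ≈0 p = U.≈ᴹ-trans (cong p) 0-homo

  -- Mayer-Vietoris for subcomplexes of one module

  module _ (V : Module) (D h r : LinearMap V V) where

    open Differences V
    open LinearMap D using () renaming (⟦_⟧ to ⟦D⟧)
    open LinearMap h using () renaming (⟦_⟧ to ⟦h⟧)
    open LinearMap r using () renaming (⟦_⟧ to ⟦r⟧)

    infix 4 _∈ˢ_
    _∈ˢ_ : Carrierᴹ → Submodule V → Set
    c ∈ˢ S = Submodule._∈ S c

    -- T is the total complex and X = A ∩ B.  The map r restricts a chain to its
    -- part in A, so that z lies in A + B as soon as z - r z lies in B.
    module ConnectingMap
      (A B X T : ℕ → Submodule V)
      (D² : ∀ c → ⟦D⟧ (⟦D⟧ c) ≈ᴹ 0ᴹ)
      (D-A : ∀ {i c} → c ∈ˢ A (suc i) → ⟦D⟧ c ∈ˢ A i)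
      (D-B : ∀ {i c} → c ∈ˢ B (suc i) → ⟦D⟧ c ∈ˢ B i)
      (D-T : ∀ {i c} → c ∈ˢ T (suc i) → ⟦D⟧ c ∈ˢ T i)
      (A⊆T : ∀ {i c} → c ∈ˢ A i → c ∈ˢ T i)
      (B⊆T : ∀ {i c} → c ∈ˢ B i → c ∈ˢ T i)
      (X⊆A : ∀ {i c} → c ∈ˢ X i → c ∈ˢ A i)
      (X⊆B : ∀ {i c} → c ∈ˢ X i → c ∈ˢ B i)
      (A∩B⊆X : ∀ {i c} → c ∈ˢ A i → c ∈ˢ B i → c ∈ˢ X i)
      (h-T : ∀ {i c} → c ∈ˢ T i → ⟦h⟧ c ∈ˢ T (suc i))
      (h-A : ∀ {i c} → c ∈ˢ A i → ⟦h⟧ c ≈ᴹ 0ᴹ)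
      (h-B : ∀ {i c} → c ∈ˢ B i → ⟦h⟧ c ≈ᴹ 0ᴹ)
      (r-T : ∀ {i c} → c ∈ˢ T i → ⟦r⟧ c ∈ˢ A i)
      (r-A : ∀ {i c} → c ∈ˢ A i → ⟦r⟧ c ≈ᴹ c)
      (r-B : ∀ {i c} → c ∈ˢ B i → ⟦r⟧ c ∈ˢ X i)
      (homotopy : ∀ {i c} → c ∈ˢ T i → ⟦h⟧ (⟦D⟧ c) ≈ᴹ 0ᴹ →
                  (c -ᴹ ⟦D⟧ (⟦h⟧ c)) -ᴹ ⟦r⟧ (c -ᴹ ⟦D⟧ (⟦h⟧ c)) ∈ˢ B i)
      where

      private
        module D = LinearMapProperties D
        module h = LinearMapProperties h
        module r = LinearMapProperties r

      minus-closed : ∀ {i} {S : ℕ → Submodule V} {x y} → x ∈ˢ S i → y ∈ˢ S i → (x -ᴹ y) ∈ˢ S i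
      minus-closed {i} {S} p q = Submodule.+-closed (S i) p (Submodule.neg-closed (S i) q)

      -- `P z` and `Q z` are the parts of `N z` in A and in B. Membership of `Q z` in B is available
      -- when `h (D z)` vanishes.
      N P Q δ : Carrierᴹ → Carrierᴹ
      N z = z -ᴹ ⟦D⟧ (⟦h⟧ z)
      P z = ⟦r⟧ (N z)
      Q z = N z -ᴹ P z
      δ z = ⟦D⟧ (P z)

      N-T : ∀ {i z} → z ∈ˢ T i → N z ∈ˢ T i
      N-T z∈ = minus-closed {S = T} z∈ (D-T (h-T z∈))

      P-A : ∀ {i z} → z ∈ˢ T i → P z ∈ˢ A i
      P-A z∈ = r-T (N-T z∈)

      P+Q : ∀ z → P z +ᴹ Q z ≈ᴹ N z
      P+Q z = x+[y-x]≈y (P z) (N z)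

      N-homologous : ∀ z → ⟦D⟧ (-ᴹ ⟦h⟧ z) ≈ᴹ N z -ᴹ z
      N-homologous z = ≈ᴹ-trans (D.neg-homo (⟦h⟧ z)) (≈ᴹ-sym ([x-y]-x≈-y z _))

      DN : ∀ z → ⟦D⟧ (N z) ≈ᴹ ⟦D⟧ z
      DN z = ≈ᴹ-trans (D.minus-homo z _) (x≈0⇒y-x≈y (⟦D⟧ z) (D² (⟦h⟧ z)))

      DQ : ∀ z → ⟦D⟧ (Q z) ≈ᴹ ⟦D⟧ z -ᴹ δ z
      DQ z = ≈ᴹ-trans (D.minus-homo (N z) (P z)) (-‿cong₂ (DN z) ≈ᴹ-refl)

      N-fixes : ∀ {z} → ⟦h⟧ z ≈ᴹ 0ᴹ → N z ≈ᴹ z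
      N-fixes {z} p = x≈0⇒y-x≈y z (D.≈0 p)

      h-A+B : ∀ {i a b} → a ∈ˢ A i → b ∈ˢ B i → ⟦h⟧ (a +ᴹ b) ≈ᴹ 0ᴹ
      h-A+B a∈ b∈ = ≈ᴹ-trans (h.+-homo _ _) (≈ᴹ-trans (+ᴹ-cong (h-A a∈) (h-B b∈)) (+ᴹ-identityˡ 0ᴹ))

      hN : ∀ {i z} → z ∈ˢ T i → ⟦h⟧ (⟦D⟧ z) ≈ᴹ 0ᴹ → ⟦h⟧ (N z) ≈ᴹ 0ᴹ
      hN {z = z} z∈ p = ≈ᴹ-trans (h.cong (≈ᴹ-sym (P+Q z))) (h-A+B (P-A z∈) (homotopy z∈ p))

      DQ-cycle : ∀ {z} → ⟦D⟧ z ≈ᴹ 0ᴹ → ⟦D⟧ (Q z) ≈ᴹ -ᴹ δ z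
      DQ-cycle {z} Dz≈0 = ≈ᴹ-trans (DQ z) (≈ᴹ-trans (+ᴹ-congʳ Dz≈0) (+ᴹ-identityˡ _))

      -- Since `P z + Q z = N z` is a cycle, `D (P z) = - D (Q z)`; the left side lies in A and the
      -- right side in B.
      δ-X : ∀ {i z} → z ∈ˢ T (suc i) → ⟦D⟧ z ≈ᴹ 0ᴹ → δ z ∈ˢ X i
      δ-X {i} {z} z∈ Dz≈0 = A∩B⊆X (D-A (P-A z∈))
        (Submodule.resp (B i)
          (≈ᴹ-trans (-ᴹ‿cong (DQ-cycle Dz≈0)) (-‿involutive (δ z)))
          (Submodule.neg-closed (B i) (D-B (homotopy z∈ (h.≈0 Dz≈0)))))

      -- N fixes A + B. The decomposition a + b may differ from the one made by r, but only by
      -- `r b`, which lies in X when b is in B; so `δ (a + b)` is `D a` up to a boundary of X.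
      δ-A+B : ∀ {i a b} → a ∈ˢ A i → b ∈ˢ B i → δ (a +ᴹ b) ≈ᴹ ⟦D⟧ a +ᴹ ⟦D⟧ (⟦r⟧ b)
      δ-A+B {a = a} {b} a∈ b∈ = begin
        ⟦D⟧ (⟦r⟧ (N (a +ᴹ b)))     ≈⟨ D.cong (r.cong (N-fixes (h-A+B a∈ b∈))) ⟩
        ⟦D⟧ (⟦r⟧ (a +ᴹ b))         ≈⟨ D.cong (r.+-homo a b) ⟩
        ⟦D⟧ (⟦r⟧ a +ᴹ ⟦r⟧ b)       ≈⟨ D.cong (+ᴹ-congʳ (r-A a∈)) ⟩
        ⟦D⟧ (a +ᴹ ⟦r⟧ b)           ≈⟨ D.+-homo a (⟦r⟧ b) ⟩
        ⟦D⟧ a +ᴹ ⟦D⟧ (⟦r⟧ b)       ∎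

      -- If z = D y and u = y - h z, then N z = D (N u) with N u in A + B, and δ z
      -- is the boundary of r (D (Q u)), where Q u is the part of N u in B.
      δ-boundary : ∀ {i y z} → y ∈ˢ T (suc (suc i)) → z ∈ˢ T (suc i) → ⟦D⟧ y ≈ᴹ z →
                   ∃[ x ] (x ∈ˢ X (suc i) × ⟦D⟧ x ≈ᴹ δ z)
      δ-boundary {i} {y} {z} y∈ z∈ Dy≈z =
        ⟦r⟧ (⟦D⟧ (Q u)) , r-B (D-B (homotopy u∈ hDu≈0)) , (begin
          ⟦D⟧ (⟦r⟧ (⟦D⟧ (Q u)))                     ≈⟨ D.cong (r.cong (DQ u)) ⟩
          ⟦D⟧ (⟦r⟧ (⟦D⟧ u -ᴹ δ u))                   ≈⟨ D.cong (r.minus-homo _ _) ⟩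
          ⟦D⟧ (⟦r⟧ (⟦D⟧ u) -ᴹ ⟦r⟧ (δ u))             ≈⟨ D.cong (-‿cong₂ (r.cong Du≈Nz) (r-A (D-A (P-A u∈)))) ⟩
          ⟦D⟧ (P z -ᴹ δ u)                           ≈⟨ D.minus-homo _ _ ⟩
          δ z -ᴹ ⟦D⟧ (δ u)                           ≈⟨ x≈0⇒y-x≈y (δ z) (D² (P u)) ⟩
          δ z                                       ∎)
        where
        u = y -ᴹ ⟦h⟧ z
        u∈ : u ∈ˢ T (suc (suc i))
        u∈ = minus-closed {S = T} y∈ (h-T z∈)
        Du≈Nz : ⟦D⟧ u ≈ᴹ N z
        Du≈Nz = ≈ᴹ-trans (D.minus-homo y (⟦h⟧ z)) (+ᴹ-congʳ Dy≈z)
        Dz≈0 : ⟦D⟧ z ≈ᴹ 0ᴹ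
        Dz≈0 = ≈ᴹ-trans (D.cong (≈ᴹ-sym Dy≈z)) (D² y)
        hDu≈0 : ⟦h⟧ (⟦D⟧ u) ≈ᴹ 0ᴹ
        hDu≈0 = ≈ᴹ-trans (h.cong Du≈Nz) (hN z∈ (h.≈0 Dz≈0))

      -- The two parts need not be cycles. This serves surjectivity at index 0, where every chain is
      -- a cycle.
      splitting : ∀ {i z} → z ∈ˢ T i → ⟦D⟧ z ≈ᴹ 0ᴹ → ∃[ a ] ∃[ b ]
        (a ∈ˢ A i × b ∈ˢ B i × ∃[ y ] (y ∈ˢ T (suc i) × ⟦D⟧ y ≈ᴹ (a +ᴹ b) -ᴹ z))
      splitting {i} {z} z∈ Dz≈0 = P z , Q z , P-A z∈ , homotopy z∈ (h.≈0 Dz≈0)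
        , -ᴹ ⟦h⟧ z , Submodule.neg-closed (T (suc i)) (h-T z∈)
        , ≈ᴹ-trans (N-homologous z) (+ᴹ-congʳ (≈ᴹ-sym (P+Q z)))

      -- The boundary of y lies in A + B, so y may be replaced by `P y + Q y`. Then
      -- `a - D (P y) = D (Q y) - b` lies in both A and B: it is the required x, and `- P y`,
      -- `- Q y` are the homologies.
      φψ-exact : ∀ {i a b y} → a ∈ˢ A i → b ∈ˢ B i → ⟦D⟧ a ≈ᴹ 0ᴹ → y ∈ˢ T (suc i) → ⟦D⟧ y ≈ᴹ a +ᴹ b →
        ∃[ x ] (x ∈ˢ X i × ⟦D⟧ x ≈ᴹ 0ᴹ
          × (∃[ u ] (u ∈ˢ A (suc i) × ⟦D⟧ u ≈ᴹ x -ᴹ a))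
          × (∃[ v ] (v ∈ˢ B (suc i) × ⟦D⟧ v ≈ᴹ -ᴹ x -ᴹ b)))
      φψ-exact {i} {a} {b} {y} a∈ b∈ Da≈0 y∈ Dy≈a+b = x
        , A∩B⊆X (minus-closed {S = A} a∈ (D-A (P-A y∈)))
            (Submodule.resp (B i) DQy-b≈x (minus-closed {S = B} (D-B Qy∈) b∈))
        , ≈ᴹ-trans (D.minus-homo a (δ y)) (≈ᴹ-trans (-‿cong₂ Da≈0 (D² (P y))) (-ᴹ‿inverseʳ 0ᴹ))
        , (-ᴹ P y , Submodule.neg-closed (A (suc i)) (P-A y∈)
          , ≈ᴹ-trans (D.neg-homo (P y)) (≈ᴹ-sym ([x-y]-x≈-y a (δ y))))
        , (-ᴹ Q y , Submodule.neg-closed (B (suc i)) Qy∈ , (begin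
            ⟦D⟧ (-ᴹ Q y)            ≈⟨ D.neg-homo (Q y) ⟩
            -ᴹ ⟦D⟧ (Q y)            ≈⟨ -ᴹ‿cong (x+[y-x]≈y b (⟦D⟧ (Q y))) ⟨
            -ᴹ (b +ᴹ (⟦D⟧ (Q y) -ᴹ b)) ≈⟨ -ᴹ‿cong (+ᴹ-congˡ DQy-b≈x) ⟩
            -ᴹ (b +ᴹ x)             ≈⟨ -ᴹ‿cong (+ᴹ-comm b x) ⟩
            -ᴹ (x +ᴹ b)             ≈⟨ -‿+-comm x b ⟨
            -ᴹ x -ᴹ b                ∎))
        where
        x = a -ᴹ δ y
        hDy≈0 : ⟦h⟧ (⟦D⟧ y) ≈ᴹ 0ᴹ
        hDy≈0 = ≈ᴹ-trans (h.cong Dy≈a+b) (h-A+B a∈ b∈)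
        Qy∈ = homotopy y∈ hDy≈0
        DQy-b≈x : ⟦D⟧ (Q y) -ᴹ b ≈ᴹ x
        DQy-b≈x = ≈ᴹ-trans (+ᴹ-congʳ (≈ᴹ-trans (DQ y) (+ᴹ-congʳ Dy≈a+b))) ([[x+y]-z]-y≈x-z a b (δ y))

      δψ≈0 : ∀ {i a b} → a ∈ˢ A i → b ∈ˢ B i → ⟦D⟧ a ≈ᴹ 0ᴹ → ∃[ x ] (x ∈ˢ X i × ⟦D⟧ x ≈ᴹ δ (a +ᴹ b))
      δψ≈0 a∈ b∈ Da≈0 = _ , r-B b∈
        , ≈ᴹ-sym (≈ᴹ-trans (δ-A+B a∈ b∈) (≈ᴹ-trans (+ᴹ-congʳ Da≈0) (+ᴹ-identityˡ _)))

      -- Moving w from one part to the other turns `P z` and `Q z` into cycles `P z - w` and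
      -- `Q z + w` without changing their sum `N z`.
      ψδ-exact : ∀ {i z w} → z ∈ˢ T i → ⟦D⟧ z ≈ᴹ 0ᴹ → w ∈ˢ X i → ⟦D⟧ w ≈ᴹ δ z →
        ∃[ a ] ∃[ b ] (a ∈ˢ A i × b ∈ˢ B i × ⟦D⟧ a ≈ᴹ 0ᴹ × ⟦D⟧ b ≈ᴹ 0ᴹ
          × ∃[ y ] (y ∈ˢ T (suc i) × ⟦D⟧ y ≈ᴹ (a +ᴹ b) -ᴹ z))
      ψδ-exact {i} {z} {w} z∈ Dz≈0 w∈ Dw≈δz = P z -ᴹ w , Q z +ᴹ w
        , minus-closed {S = A} (P-A z∈) (X⊆A w∈)
        , Submodule.+-closed (B i) (homotopy z∈ (h.≈0 Dz≈0)) (X⊆B w∈)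
        , ≈ᴹ-trans (D.minus-homo (P z) w) (≈ᴹ-trans (+ᴹ-congˡ (-ᴹ‿cong Dw≈δz)) (-ᴹ‿inverseʳ (δ z)))
        , ≈ᴹ-trans (D.+-homo (Q z) w) (≈ᴹ-trans (+ᴹ-cong (DQ-cycle Dz≈0) Dw≈δz) (-ᴹ‿inverseˡ (δ z)))
        , -ᴹ ⟦h⟧ z , Submodule.neg-closed (T (suc i)) (h-T z∈)
        , ≈ᴹ-trans (N-homologous z) (+ᴹ-congʳ (≈ᴹ-sym
            (≈ᴹ-trans ([x-z]+[y+z]≈x+y (P z) (Q z) w) (P+Q z))))

      φδ≈0 : ∀ {i z} → z ∈ˢ T i → ⟦D⟧ z ≈ᴹ 0ᴹ →
        (∃[ u ] (u ∈ˢ A i × ⟦D⟧ u ≈ᴹ δ z)) × (∃[ v ] (v ∈ˢ B i × ⟦D⟧ v ≈ᴹ -ᴹ δ z))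
      φδ≈0 z∈ Dz≈0 = (_ , P-A z∈ , ≈ᴹ-refl) , (_ , homotopy z∈ (h.≈0 Dz≈0) , DQ-cycle Dz≈0)

      -- The bounding chains of x in A and of -x in B add up to a cycle of T. Its image under δ
      -- differs from x by the boundary of `r b`.
      δφ-exact : ∀ {i x a b} → a ∈ˢ A i → ⟦D⟧ a ≈ᴹ x → b ∈ˢ B i → ⟦D⟧ b ≈ᴹ -ᴹ x →
        (a +ᴹ b) ∈ˢ T i × ⟦D⟧ (a +ᴹ b) ≈ᴹ 0ᴹ × ∃[ w ] (w ∈ˢ X i × ⟦D⟧ w ≈ᴹ δ (a +ᴹ b) -ᴹ x)
      δφ-exact {i} {x} {a} {b} a∈ Da≈x b∈ Db≈-x = Submodule.+-closed (T i) (A⊆T a∈) (B⊆T b∈)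
        , ≈ᴹ-trans (D.+-homo a b) (≈ᴹ-trans (+ᴹ-cong Da≈x Db≈-x) (-ᴹ‿inverseʳ x))
        , ⟦r⟧ b , r-B b∈ , ≈ᴹ-sym (begin
            δ (a +ᴹ b) -ᴹ x                ≈⟨ +ᴹ-congʳ (≈ᴹ-trans (δ-A+B a∈ b∈) (+ᴹ-congʳ Da≈x)) ⟩
            (x +ᴹ ⟦D⟧ (⟦r⟧ b)) -ᴹ x        ≈⟨ [x+y]-x≈y x _ ⟩
            ⟦D⟧ (⟦r⟧ b)                   ∎)

-- Functoriality of the per-edge maps under refinement

_⊑_ : ∀ {n} → Partition n → Partition n → Set
R ⊑ P = ∀ {u v} → Partition._~_ R u v → Partition._~_ P u v

stabilises-⊑ : ∀ {n} (R P : Partition n) → R ⊑ P → ∀ {h} →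
               Partition.Stabilises R h → Partition.Stabilises P h
stabilises-⊑ R P R⊑P s v = R⊑P (s v)

module _ {A B C : Set} (f : A → B → C) {_∼_ : Rel A 0ℓ} {_≋_ : Rel C 0ℓ}
         {ys : List B} (row : ∀ a → AllPairs _≋_ (map (f a) ys))
         {S : B → Set} (ys⊆ : All S ys)
         (cross : ∀ {a a′ b b′} → S b → S b′ → a ∼ a′ → f a b ≋ f a′ b′) where

  -- Pairs within a row come from `row`, pairs from different rows from `cross`. The predicate S
  -- restricts the second factors: below it says that k stabilises Q, so that the coset of h can be
  -- recovered from h k.
  AllPairs-cartesianProductWith : ∀ {xs} → AllPairs _∼_ xs →
                                  AllPairs _≋_ (cartesianProductWith f xs ys)
  AllPairs-cartesianProductWith []         = []
  AllPairs-cartesianProductWith (x∼ ∷ xs∼) = AllPairsₚ.++⁺ (row _)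
    (AllPairs-cartesianProductWith xs∼) (Allₚ.map⁺ (All.map (λ s → rest s x∼) ys⊆))
    where
    rest : ∀ {x b xs} → S b → All (x ∼_) xs → All (f x b ≋_) (cartesianProductWith f xs ys)
    rest s []       = []
    rest s (p ∷ ps) = Allₚ.++⁺ (Allₚ.map⁺ (All.map (λ s′ → cross s s′ p) ys⊆)) (rest s ps)

module EdgeMaps (K : CommutativeRing 0ℓ 0ℓ) (reciprocals : HasReciprocals K) where

  open LinearAlgebra K
  open LinearMap using (⟦_⟧)
  open _⟶_ using (to)
  open ChromaticHomology K reciprocals
  open MayerVietoris K using (module LinearMapProperties)
  open HasReciprocals reciprocals
  private module K = CommutativeRing K
  open K using () renaming (Carrier to Scalar; _≈_ to _≈ₛ_; 0# to 0ₛ; 1# to 1ₛ)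
  open import Algebra.Properties.CommutativeMonoid.Sum K.+-commutativeMonoid using (sum; sum-cong-≋)
  open RawMonoidDefs K.+-rawMonoid using () renaming (_×_ to _×ₙ_)

  ∑-++ : ∀ (M : Module) {A : Set} xs ys (f : A → LeftModule.Carrierᴹ M) →
    LeftModule._≈ᴹ_ M (∑ M (xs ++ ys) f) (LeftModule._+ᴹ_ M (∑ M xs f) (∑ M ys f))
  ∑-++ M []       ys f = LeftModule.≈ᴹ-sym M (LeftModule.+ᴹ-identityˡ M _)
  ∑-++ M (x ∷ xs) ys f = ≈ᴹ-trans (+ᴹ-congˡ (∑-++ M xs ys f)) (≈ᴹ-sym (+ᴹ-assoc _ _ _))
    where open LeftModule M

  ∑-cartesianProductWith : ∀ (M : Module) {A B C : Set} (g : A → B → C) xs ys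
    (f : C → LeftModule.Carrierᴹ M) →
    LeftModule._≈ᴹ_ M (∑ M (cartesianProductWith g xs ys) f) (∑ M xs (λ x → ∑ M ys (λ y → f (g x y))))
  ∑-cartesianProductWith M g []       ys f = LeftModule.≈ᴹ-refl M
  ∑-cartesianProductWith M g (x ∷ xs) ys f = ≈ᴹ-trans (∑-++ M (map (g x) ys) _ f)
    (+ᴹ-cong (∑-map M (g x) ys f) (∑-cartesianProductWith M g xs ys f))
    where open LeftModule M

  ∑-homo : ∀ {M N : Module} (f : LinearMap M N) {A : Set} xs (g : A → LeftModule.Carrierᴹ M) →
    LeftModule._≈ᴹ_ N (⟦ f ⟧ (∑ M xs g)) (∑ N xs (λ x → ⟦ f ⟧ (g x)))
  ∑-homo f []               g = LinearMap.0-homo f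
  ∑-homo {M} {N} f (x ∷ xs) g = ≈ᴹ-trans (LinearMap.+-homo f (g x) _) (+ᴹ-congˡ (∑-homo f xs g))
    where open LeftModule N

  sum-indicator : ∀ {n} (b : Fin n → Bool) c →
    sum (λ u → if b u then c else 0ₛ) ≈ₛ (∣ tabulate b ∣ ×ₙ 1ₛ) K.* c
  sum-indicator {zero}  b c = K.sym (K.zeroˡ c)
  sum-indicator {suc n} b c with b zero
  ... | true  = K.trans (K.+-cong (K.sym (K.*-identityˡ c)) (sum-indicator (b ∘ suc) c))
                  (K.sym (K.distribʳ c 1ₛ _))
  ... | false = K.trans (K.+-identityˡ _) (sum-indicator (b ∘ suc) c)

  count-pos : ∀ {n} (b : Fin n → Bool) v → b v ≡ true → ∃[ k ] ∣ tabulate b ∣ ≡ suc k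
  count-pos b zero    p rewrite p = ∣ tabulate (b ∘ suc) ∣ , ≡.refl
  count-pos b (suc v) p with b zero
  ... | true  = ∣ tabulate (b ∘ suc) ∣ , ≡.refl
  ... | false = count-pos (b ∘ suc) v p

  mean-constant : ∀ {n} (P : Partition n) (x : Fin n → Scalar) →
    (∀ {u v} → Partition._~_ P u v → x u ≈ₛ x v) → ∀ v → mean P x v ≈ₛ x v
  mean-constant P x x-~ v = begin
    (1/1+ ℕ.pred ∣ block v ∣) K.* blockSum P x v
      ≈⟨ K.*-congˡ (K.trans (sum-cong-≋ on-block) (sum-indicator (λ u → does (u ~? v)) (x v))) ⟩
    (1/1+ ℕ.pred ∣ block v ∣) K.* ((∣ block v ∣ ×ₙ 1ₛ) K.* x v)
      ≈⟨ K.*-assoc _ _ _ ⟨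
    ((1/1+ ℕ.pred ∣ block v ∣) K.* (∣ block v ∣ ×ₙ 1ₛ)) K.* x v
      ≈⟨ K.*-congʳ (K.*-comm _ _) ⟩
    ((∣ block v ∣ ×ₙ 1ₛ) K.* (1/1+ ℕ.pred ∣ block v ∣)) K.* x v
      ≈⟨ K.*-congʳ (inverse (count-pos (λ u → does (u ~? v)) v (dec-true (v ~? v) ~-refl))) ⟩
    1ₛ K.* x v
      ≈⟨ K.*-identityˡ (x v) ⟩
    x v ∎
    where
    open Partition P
    open import Relation.Binary.Reasoning.Setoid K.setoid
    on-block : ∀ u → (if does (u ~? v) then x u else 0ₛ) ≈ₛ (if does (u ~? v) then x v else 0ₛ)
    on-block u with u ~? v
    ... | yes u~v = x-~ u~v
    ... | no  _   = K.refl
    inverse : ∀ {b} → ∃[ k ] b ≡ suc k → (b ×ₙ 1ₛ) K.* (1/1+ ℕ.pred b) ≈ₛ 1ₛ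
    inverse (k , ≡.refl) = 1/1+-inverse k

  ⋀-map-id : ∀ {M} j (f : LinearMap M M) → (∀ x → LeftModule._≈ᴹ_ M (⟦ f ⟧ x) x) →
             ∀ t → LeftModule._≈ᴹ_ (⋀ M j) (⟦ ⋀-map j f ⟧ t) t
  ⋀-map-id {M} j f p = extend-unique (⋀-map j f) identity λ xs → relation (congruent (go xs))
    where
    identity : LinearMap (⋀ M j) (⋀ M j)
    identity = record
      { ⟦_⟧ = id
      ; isLinear = record { cong = id ; +-homo = λ _ _ → refl ; *-homo = λ _ _ → refl }
      }
    go : ∀ {k} (xs : Vec (LeftModule.Carrierᴹ M) k) →
         Pointwise (LeftModule._≈ᴹ_ M) (Vec.map ⟦ f ⟧ xs) xs
    go Vec.[]       = Pointwise.[]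
    go (x Vec.∷ xs) = p x Pointwise.∷ go xs

  module _ {n} (P : Partition n) where
    open Partition P

    π-inclusion : ∀ x → LeftModule._≈ᴹ_ (W P) (⟦ π P ⟧ (proj₁ x)) x
    π-inclusion (x , z) v = K.trans
      (K.+-congˡ (K.trans (K.-‿cong (K.trans (K.*-congˡ (z v)) (K.zeroʳ _))) -0#≈0#))
      (K.+-identityʳ (x v))
      where open import Algebra.Properties.Ring K.ring using (-0#≈0#)

    -- There is only one coset, represented by the identity permutation, and the projection fixes
    -- vectors already in W.
    edgeMap-id : ∀ j t → Representation._≈ᴹ_ (𝓜 P j) (to (edgeMap P P j) t) t
    edgeMap-id j = extend-unique (_⟶_.linearMap (edgeMap P P j)) identity λ (g , x) → trans
      (∑-representatives M SameCoset sameCoset-isDecEquivalence (summand P P j g x)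
        (λ {h} {k} → summand-coset P P j g x {h} {k})
        {transversal P P} {Perm.id ∷ []} (transversal-unique P P) ([] ∷ [])
        (All.map (λ {h} s → here (flip-closed h s)) (transversal-stabilises P P))
        (transversal-complete P P Perm.id id-stabilises ∷ []))
      (trans (⊞-comm _ _) (trans (⊞-identityˡ _)
        (relation (congruent (λ _ → ≡.refl) (⋀-map-id j (translate P P Perm.id) π-inclusion x)))))
      where
      M = Representation.leftModule (𝓜 P j)
      identity : LinearMap M M
      identity = record
        { ⟦_⟧ = id
        ; isLinear = record { cong = id ; +-homo = λ _ _ → refl ; *-homo = λ _ _ → refl }
        }
      flip-closed : ∀ h → Stabilises h → SameCoset h Perm.id
      flip-closed h s = ·-stabilises (Perm.flip h) Perm.id (flip-stabilises h s) id-stabilises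

  module _ {n} (P Q R : Partition n) (Q⊑P : Q ⊑ P) (R⊑Q : R ⊑ Q) where
    private
      module P = Partition P
      module Q = Partition Q
      module R = Partition R

    -- The projection to W_Q subtracts a function that is constant on the
    -- blocks of Q; these are permuted by k, and functions constant on the
    -- blocks of R project to 0 in W_R.
    translate-∘ : ∀ h k → Q.Stabilises k → ∀ y →
      LeftModule._≈ᴹ_ (W R) (⟦ translate Q R k ⟧ (⟦ translate P Q h ⟧ y)) (⟦ translate P R (h · k) ⟧ y)
    translate-∘ h k s (y , _) v = begin
      (yh (k ⟨$⟩ʳ v) K.- m (k ⟨$⟩ʳ v)) K.- mean R (λ u → yh (k ⟨$⟩ʳ u) K.- m (k ⟨$⟩ʳ u)) v
        ≈⟨ K.+-cong (K.+-congˡ (K.-‿cong (mk v)))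
             (K.-‿cong (K.*-congˡ (blockSum-cong R (λ u → K.+-congˡ (K.-‿cong (mk u))) v))) ⟩
      proj₁ (⟦ π R ⟧ (yhk ∖ m)) v
        ≈⟨ πR.minus-homo yhk m v ⟩
      proj₁ (⟦ π R ⟧ yhk) v K.- (m v K.- mean R m v)
        ≈⟨ K.+-congˡ (K.-‿cong (K.trans (K.+-congˡ (K.-‿cong (mean-constant R m
             (λ u~v → mean-~ Q yh (R⊑Q u~v)) v))) (K.-‿inverseʳ (m v)))) ⟩
      proj₁ (⟦ π R ⟧ yhk) v K.- 0ₛ
        ≈⟨ K.trans (K.+-congˡ -0#≈0#) (K.+-identityʳ _) ⟩
      proj₁ (⟦ π R ⟧ yhk) v ∎
      where
      open import Relation.Binary.Reasoning.Setoid K.setoid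
      open import Algebra.Properties.Ring K.ring using (-0#≈0#)
      module πR = LinearMapProperties (π R)
      yh yhk m : Fin n → Scalar
      yh  u = y (h ⟨$⟩ʳ u)
      yhk u = yh (k ⟨$⟩ʳ u)
      m     = mean Q yh
      _∖_ : (Fin n → Scalar) → (Fin n → Scalar) → Fin n → Scalar
      (x ∖ x′) u = x u K.- x′ u
      mk : ∀ u → m (k ⟨$⟩ʳ u) ≈ₛ m u
      mk u = mean-~ Q yh (s u)

    -- Representatives of 𝔖_P / 𝔖_Q times representatives of 𝔖_Q / 𝔖_R represent 𝔖_P / 𝔖_R. The list
    -- may differ from `transversal P R`, but sums over the two agree because summands depend only
    -- on the coset.
    products : List (𝔖 n)
    products = cartesianProductWith _·_ (transversal P Q) (transversal Q R)

    private
      cancel : ∀ g {h k} → R.SameCoset (g · h) (g · k) → R.SameCoset h k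
      cancel g {h} {k} p v = ≡.subst (λ w → (h ⟨$⟩ˡ w) R.~ v) (Perm.inverseˡ g) (p v)

      coset-Q : ∀ {h h′ k k′} → Q.Stabilises k → Q.Stabilises k′ →
                R.SameCoset (h · k) (h′ · k′) → Q.SameCoset h h′
      coset-Q {h} {h′} {k} {k′} s s′ p = Q.sameCoset-trans {h} {h · k} {h′}
        (λ v → ≡.subst (Q._~ v) (≡.sym (Perm.inverseˡ h)) (s v))
        (Q.sameCoset-trans {h · k} {h′ · k′} {h′} (stabilises-⊑ R Q R⊑Q {Perm.flip (h · k) · (h′ · k′)} p)
          (Q.sameCoset-sym {h′} {h′ · k′}
            (λ v → ≡.subst (Q._~ v) (≡.sym (Perm.inverseˡ h′)) (s′ v))))

    products-unique : AllPairs (λ g h → ¬ R.SameCoset g h) products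
    products-unique = AllPairs-cartesianProductWith _·_
      {_∼_ = λ g h → ¬ Q.SameCoset g h}
      (λ g → AllPairsₚ.map⁺ (AllPairs.map (λ {h} {k} h≁k p → h≁k (cancel g {h} {k} p))
                                          (transversal-unique Q R)))
      (transversal-stabilises Q R)
      (λ {h} {h′} {k} {k′} s s′ h≁h′ p → h≁h′ (coset-Q {h} {h′} {k} {k′} s s′ p))
      (transversal-unique P Q)

    products-complete : ∀ g → P.Stabilises g → Any (R.SameCoset g) products
    products-complete g s = search (transversal-stabilises P Q) (transversal-complete P Q g s)
      where
      search : ∀ {hs} → All P.Stabilises hs → Any (Q.SameCoset g) hs →
               Any (R.SameCoset g) (cartesianProductWith _·_ hs (transversal Q R))
      -- Here g = h q with q = h⁻¹ g in 𝔖_Q, so the second factor is the representative of q modulo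
      -- 𝔖_R.
      search {h ∷ hs} _ (here g~h) = Anyₚ.++⁺ˡ (Anyₚ.map⁺ (Any.map
        (λ {k} p v → ≡.subst (λ w → (g ⟨$⟩ˡ w) R.~ v) ≡.refl (p v))
        (transversal-complete Q R (Perm.flip h · g) (Q.sameCoset-sym {g} {h} g~h))))
      search (_ ∷ ss) (there p) = Anyₚ.++⁺ʳ _ (search ss p)

    products-stabilise : All P.Stabilises products
    products-stabilise = go (transversal-stabilises P Q)
      where
      go : ∀ {hs} → All P.Stabilises hs → All P.Stabilises (cartesianProductWith _·_ hs (transversal Q R))
      go []       = []
      go (_∷_ {h} s ss) = Allₚ.++⁺ (Allₚ.map⁺ (All.map
        (λ {k} t → P.·-stabilises h k s (stabilises-⊑ Q P Q⊑P {k} t)) (transversal-stabilises Q R))) (go ss)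

    edgeMap-∘ : ∀ j t → Representation._≈ᴹ_ (𝓜 R j)
                          (to (edgeMap Q R j) (to (edgeMap P Q j) t)) (to (edgeMap P R j) t)
    edgeMap-∘ j = extend-unique (linearMap (edgeMap Q R j) ∘ˡ linearMap (edgeMap P Q j))
      (linearMap (edgeMap P R j)) λ (g , x) →
        trans (∑-homo (linearMap (edgeMap Q R j)) (transversal P Q) (summand P Q j g x))
        (trans (∑-cong M {xs = transversal P Q} (All.universal (λ h →
            ∑-cong M (All.map (λ {k} s → relation (congruent (λ _ → ≡.refl)
              (⋀-map-∘ j (translate Q R k) (translate P Q h) (translate P R (h · k)) (translate-∘ h k s) x)))
              (transversal-stabilises Q R))) (transversal P Q)))
        (trans (sym (∑-cartesianProductWith M _·_ (transversal P Q) (transversal Q R) (summand P R j g x)))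
        (∑-representatives M R.SameCoset R.sameCoset-isDecEquivalence (summand P R j g x)
          (λ {h} {k} → summand-coset P R j g x {h} {k})
          products-unique (transversal-unique P R)
          (All.map (λ {h} s → transversal-complete P R h s) products-stabilise)
          (All.map (λ {h} s → products-complete h s) (transversal-stabilises P R)))))
      where
      open _⟶_ using (linearMap)
      M = Representation.leftModule (𝓜 R j)

-- Adding and deleting one edge of a state

x∉p-x : ∀ {m} (F : Subset m) e → e ∉ F - e
x∉p-x (_     ∷ F) zero    ()
x∉p-x (true  ∷ F) (suc e) (there e∈) = x∉p-x F e e∈
x∉p-x (false ∷ F) (suc e) (there e∈) = x∉p-x F e e∈

module _ {m : ℕ} where

  x∈p-y⇒x≢y : ∀ (F : Subset m) {e f} → e ∈ F - f → e ≢ f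
  x∈p-y⇒x≢y F e∈ ≡.refl = x∉p-x F _ e∈

  p∪x⊆q : ∀ {F S : Subset m} {e} → F ⊆ S → e ∈ S → F ∪ ⁅ e ⁆ ⊆ S
  p∪x⊆q {F} {e = e} F⊆S e∈S x∈ with x∈p∪q⁻ F ⁅ e ⁆ x∈
  ... | inj₁ x∈F = F⊆S x∈F
  ... | inj₂ x∈e with x∈⁅y⁆⇒x≡y e x∈e
  ... | ≡.refl = e∈S

  x∈p∪x : ∀ (F : Subset m) e → e ∈ F ∪ ⁅ e ⁆
  x∈p∪x F e = q⊆p∪q F ⁅ e ⁆ (x∈⁅x⁆ e)

  x∉p∪y : ∀ {F : Subset m} {e f} → e ∉ F → e ≢ f → e ∉ F ∪ ⁅ f ⁆
  x∉p∪y {F} {f = f} e∉F e≢f e∈ with x∈p∪q⁻ F ⁅ f ⁆ e∈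
  ... | inj₁ e∈F = e∉F e∈F
  ... | inj₂ e∈f = e≢f (x∈⁅y⁆⇒x≡y f e∈f)

  p∪x∪y≡p∪y∪x : ∀ (F : Subset m) e f → (F ∪ ⁅ e ⁆) ∪ ⁅ f ⁆ ≡ (F ∪ ⁅ f ⁆) ∪ ⁅ e ⁆
  p∪x∪y≡p∪y∪x F e f = ≡.trans (∪-assoc F ⁅ e ⁆ ⁅ f ⁆)
    (≡.trans (≡.cong (F ∪_) (∪-comm ⁅ e ⁆ ⁅ f ⁆)) (≡.sym (∪-assoc F ⁅ f ⁆ ⁅ e ⁆)))

  p-x∪x≡p : ∀ {F : Subset m} {e} → e ∈ F → (F - e) ∪ ⁅ e ⁆ ≡ F
  p-x∪x≡p {F} {e} e∈F = ⊆-antisym (p∪x⊆q (p─q⊆p F ⁅ e ⁆) e∈F) back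
    where
    back : F ⊆ (F - e) ∪ ⁅ e ⁆
    back {x} x∈F with x Fin.≟ e
    ... | yes ≡.refl = x∈p∪x (F - e) e
    ... | no  x≢e    = p⊆p∪q ⁅ e ⁆ (x∈p∧x≢y⇒x∈p-y x∈F x≢e)

  p∪x-x≡p : ∀ {F : Subset m} {e} → e ∉ F → (F ∪ ⁅ e ⁆) - e ≡ F
  p∪x-x≡p {F} {e} e∉F = ⊆-antisym forth back
    where
    forth : (F ∪ ⁅ e ⁆) - e ⊆ F
    forth {x} x∈ with x∈p∪q⁻ F ⁅ e ⁆ (p─q⊆p (F ∪ ⁅ e ⁆) ⁅ e ⁆ x∈)
    ... | inj₁ x∈F = x∈F
    ... | inj₂ x∈e = contradiction (x∈⁅y⁆⇒x≡y e x∈e) (x∈p-y⇒x≢y (F ∪ ⁅ e ⁆) x∈)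
    back : F ⊆ (F ∪ ⁅ e ⁆) - e
    back x∈F = x∈p∧x≢y⇒x∈p-y (p⊆p∪q ⁅ e ⁆ x∈F) λ { ≡.refl → e∉F x∈F }

  p∪x-y≡p-y∪x : ∀ (F : Subset m) {e f} → e ≢ f → (F ∪ ⁅ e ⁆) - f ≡ (F - f) ∪ ⁅ e ⁆
  p∪x-y≡p-y∪x F {e} {f} e≢f = ⊆-antisym forth
    (p∪x⊆q (λ x∈ → x∈p∧x≢y⇒x∈p-y (p⊆p∪q ⁅ e ⁆ (p─q⊆p F ⁅ f ⁆ x∈)) (x∈p-y⇒x≢y F x∈))
           (x∈p∧x≢y⇒x∈p-y (x∈p∪x F e) e≢f))
    where
    forth : (F ∪ ⁅ e ⁆) - f ⊆ (F - f) ∪ ⁅ e ⁆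
    forth x∈ with x∈p∪q⁻ F ⁅ e ⁆ (p─q⊆p (F ∪ ⁅ e ⁆) ⁅ f ⁆ x∈)
    ... | inj₁ x∈F = p⊆p∪q ⁅ e ⁆ (x∈p∧x≢y⇒x∈p-y x∈F (x∈p-y⇒x≢y (F ∪ ⁅ e ⁆) x∈))
    ... | inj₂ x∈e = q⊆p∪q (F - f) ⁅ e ⁆ x∈e

⊆-⇒∉ : ∀ {m} {F S : Subset m} {e} → F ⊆ S - e → e ∉ F
⊆-⇒∉ {S = S} {e} F⊆ e∈F = x∉p-x S e (F⊆ e∈F)

∉⇒⊆- : ∀ {m} {F S : Subset m} {e} → F ⊆ S → e ∉ F → F ⊆ S - e
∉⇒⊆- F⊆S e∉F x∈F = x∈p∧x≢y⇒x∈p-y (F⊆S x∈F) λ { ≡.refl → e∉F x∈F }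

∣p∪x∣≡1+∣p∣ : ∀ {k} (F : Subset k) e → e ∉ F → ∣ F ∪ ⁅ e ⁆ ∣ ≡ suc ∣ F ∣
∣p∪x∣≡1+∣p∣ (true  ∷ F) zero    e∉F = contradiction here e∉F
∣p∪x∣≡1+∣p∣ (false ∷ F) zero    e∉F = ≡.cong (λ F → suc ∣ F ∣) (∪-identityʳ F)
∣p∪x∣≡1+∣p∣ (true  ∷ F) (suc e) e∉F = ≡.cong suc (∣p∪x∣≡1+∣p∣ F e (e∉F ∘ there))
∣p∪x∣≡1+∣p∣ (false ∷ F) (suc e) e∉F = ∣p∪x∣≡1+∣p∣ F e (e∉F ∘ there)

∣p∣≡1+∣p-x∣ : ∀ {k} {F : Subset k} {e} → e ∈ F → ∣ F ∣ ≡ suc ∣ F - e ∣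
∣p∣≡1+∣p-x∣ {F = F} {e} e∈F =
  ≡.trans (≡.cong ∣_∣ (≡.sym (p-x∪x≡p e∈F))) (∣p∪x∣≡1+∣p∣ (F - e) e (x∉p-x F e))

-- Components of states and the triangle

module _ (G : Graph) where
  open Graph G

  components-mono : ∀ {F F′} → F ⊆ F′ → components G F ⊑ components G F′
  components-mono F⊆F′ = EqClosure.map λ (e , e∈F , eq) → e , F⊆F′ e∈F , eq

  triangle-≢₁₃ : ∀ {e₁ e₂ e₃} → Triangle e₁ e₂ e₃ → e₁ ≢ e₃
  triangle-≢₁₃ (u , v , w , u≢v , v≢w , u≢w , p , q , r) ≡.refl = clash p r
    where
    clash : ∀ {e} → Joins e u v → ¬ Joins e u w
    clash (inj₁ p) (inj₁ r) = v≢w (≡.cong proj₂ (≡.trans (≡.sym p) r))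
    clash (inj₁ p) (inj₂ r) = u≢w (≡.cong proj₁ (≡.trans (≡.sym p) r))
    clash (inj₂ p) (inj₁ r) = u≢v (≡.sym (≡.cong proj₁ (≡.trans (≡.sym p) r)))
    clash (inj₂ p) (inj₂ r) = v≢w (≡.cong proj₁ (≡.trans (≡.sym p) r))

  triangle-≢₂₃ : ∀ {e₁ e₂ e₃} → Triangle e₁ e₂ e₃ → e₂ ≢ e₃
  triangle-≢₂₃ (u , v , w , u≢v , v≢w , u≢w , p , q , r) ≡.refl = clash q r
    where
    clash : ∀ {e} → Joins e v w → ¬ Joins e u w
    clash (inj₁ q) (inj₁ r) = u≢v (≡.sym (≡.cong proj₁ (≡.trans (≡.sym q) r)))
    clash (inj₁ q) (inj₂ r) = v≢w (≡.cong proj₁ (≡.trans (≡.sym q) r))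
    clash (inj₂ q) (inj₁ r) = u≢w (≡.sym (≡.cong proj₁ (≡.trans (≡.sym q) r)))
    clash (inj₂ q) (inj₂ r) = u≢v (≡.sym (≡.cong proj₂ (≡.trans (≡.sym q) r)))

  -- The path e₁, e₂ through v replaces e₃. It survives in F - e₃ because e₃ differs from both
  -- edges.
  components-minus : ∀ {e₁ e₂ e₃} → Triangle e₁ e₂ e₃ → ∀ {F} → e₁ ∈ F → e₂ ∈ F →
                     components G F ⊑ components G (F - e₃)
  components-minus {e₁} {e₂} {e₃} tri@(u , v , w , _ , _ , _ , p , q , r) {F} e₁∈F e₂∈F = link EqClosure.⋆
    where
    joined : ∀ {e a b} → e ∈ F - e₃ → Joins e a b → Connected (F - e₃) a b
    joined e∈ (inj₁ eq) = EqClosure.return (_ , e∈ , eq)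
    joined e∈ (inj₂ eq) = EqClosure.symmetric _ (EqClosure.return (_ , e∈ , eq))

    detour : Connected (F - e₃) u w
    detour = EqClosure.transitive _
      (joined (x∈p∧x≢y⇒x∈p-y e₁∈F (triangle-≢₁₃ tri)) p)
      (joined (x∈p∧x≢y⇒x∈p-y e₂∈F (triangle-≢₂₃ tri)) q)

    third : ∀ {a b} → ends e₃ ≡ (a , b) → Joins e₃ u w → Connected (F - e₃) a b
    third eq (inj₁ r) with ≡.trans (≡.sym eq) r
    ... | ≡.refl = detour
    third eq (inj₂ r) with ≡.trans (≡.sym eq) r
    ... | ≡.refl = EqClosure.symmetric _ detour

    link : ∀ {a b} → ∃[ e ] (e ∈ F × ends e ≡ (a , b)) → Connected (F - e₃) a b
    link (e , e∈F , eq) with e Fin.≟ e₃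
    ... | yes ≡.refl = third eq r
    ... | no  e≢e₃   = joined (x∈p∧x≢y⇒x∈p-y e∈F e≢e₃) (inj₁ eq)

-- Signs in the Boolean lattice of states

module Signs (K : CommutativeRing 0ℓ 0ℓ) (reciprocals : HasReciprocals K) (G : Graph) where
  open CommutativeRing K hiding (_-_)
  open ChromaticHomology K reciprocals using (onesAfter; sgn)
  open Graph G using (m)
  open import Algebra.Properties.Semiring.Exp semiring using (_^_)
  open import Algebra.Properties.Ring ring using (-1*x≈-x)

  -- Of two edges only the earlier one counts the other, so when both are present exactly one of the
  -- two exponents grows, and by one.
  onesAfter-∪ : ∀ {k} (F : Subset k) {e f} → e ∉ F → f ∉ F → e ≢ f →
    let o = onesAfter G in
    (o ((F ∪ ⁅ e ⁆) ∪ ⁅ f ⁆) f ≡ suc (o (F ∪ ⁅ f ⁆) f) × o ((F ∪ ⁅ e ⁆) ∪ ⁅ f ⁆) e ≡ o (F ∪ ⁅ e ⁆) e) ⊎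
    (o ((F ∪ ⁅ e ⁆) ∪ ⁅ f ⁆) e ≡ suc (o (F ∪ ⁅ e ⁆) e) × o ((F ∪ ⁅ e ⁆) ∪ ⁅ f ⁆) f ≡ o (F ∪ ⁅ f ⁆) f)
  onesAfter-∪ (_ ∷ F) {zero}  {zero}  _   _   e≢f = contradiction ≡.refl e≢f
  onesAfter-∪ (_ ∷ F) {zero}  {suc f} _   f∉F _
    rewrite ∪-identityʳ F = inj₂ (∣p∪x∣≡1+∣p∣ F f (f∉F ∘ there) , ≡.refl)
  onesAfter-∪ (_ ∷ F) {suc e} {zero}  e∉F _   _
    rewrite ∪-identityʳ (F ∪ ⁅ e ⁆) | ∪-identityʳ F = inj₁ (∣p∪x∣≡1+∣p∣ F e (e∉F ∘ there) , ≡.refl)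
  onesAfter-∪ (_ ∷ F) {suc e} {suc f} e∉F f∉F e≢f =
    onesAfter-∪ F (e∉F ∘ there) (f∉F ∘ there) (e≢f ∘ ≡.cong suc)

  private
    ±_ : ℕ → Carrier
    ± k = (- 1#) ^ k

    flip-sign : ∀ x y → (- 1# * x) * y + y * x ≈ 0#
    flip-sign x y = trans (+-cong (trans (*-assoc _ x y) (-1*x≈-x _)) (*-comm y x)) (-‿inverseˡ (x * y))

  sgn-square : ∀ F e → sgn G F e * sgn G F e ≈ 1#
  sgn-square F e = square (onesAfter G F e)
    where
    square : ∀ k → ± k * ± k ≈ 1#
    square zero    = *-identityˡ 1#
    square (suc k) = begin
      (- 1# * ± k) * (- 1# * ± k)   ≈⟨ interchange _ _ _ _ ⟩
      (- 1# * - 1#) * (± k * ± k)   ≈⟨ *-cong (trans (-1*x≈-x _) (-‿involutive 1#)) (square k) ⟩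
      1# * 1#                       ≈⟨ *-identityˡ 1# ⟩
      1#                            ∎
      where
      open import Relation.Binary.Reasoning.Setoid setoid
      open import Algebra.Properties.Ring ring using (-‿involutive)
      open import Algebra.Properties.CommutativeSemigroup
        (CommutativeMonoid.commutativeSemigroup *-commutativeMonoid) using (interchange)

  sgn-anticommute : ∀ (F : Subset m) {e f} → e ∉ F → f ∉ F → e ≢ f →
    sgn G ((F ∪ ⁅ e ⁆) ∪ ⁅ f ⁆) f * sgn G (F ∪ ⁅ e ⁆) e +
    sgn G ((F ∪ ⁅ e ⁆) ∪ ⁅ f ⁆) e * sgn G (F ∪ ⁅ f ⁆) f ≈ 0#
  sgn-anticommute F e∉F f∉F e≢f with onesAfter-∪ F e∉F f∉F e≢f
  ... | inj₁ (p , q) rewrite p | q = flip-sign _ _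
  ... | inj₂ (p , q) rewrite p | q = trans (+-comm _ _) (flip-sign _ _)

  -- The same square of states with the e-arrows reversed, deleting f and restoring e in either
  -- order. Signs are their own inverses, so this square anticommutes too; it is the one met in D h
  -- + h D.
  sgn-anticommute′ : ∀ (F : Subset m) {e f} → e ∉ F → f ∉ F → e ≢ f →
    sgn G ((F ∪ ⁅ e ⁆) ∪ ⁅ f ⁆) f * sgn G ((F ∪ ⁅ e ⁆) ∪ ⁅ f ⁆) e +
    sgn G (F ∪ ⁅ e ⁆) e * sgn G (F ∪ ⁅ f ⁆) f ≈ 0#
  sgn-anticommute′ F e∉F f∉F e≢f with onesAfter-∪ F e∉F f∉F e≢f
  ... | inj₁ (p , q) rewrite p | q = flip-sign _ _
  ... | inj₂ (p , q) rewrite p | q = trans (+-cong (*-comm _ _) (*-comm _ _)) (flip-sign _ _)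

-- Exactness and lifting for direct sums of representations

module Representations (K : CommutativeRing 0ℓ 0ℓ) where
  open LinearAlgebra K
  open _⟶_ using (to; linearMap)

  idʳ : ∀ {n} {X : Representation n} → X ⟶ X
  idʳ {X = X} = record
    { linearMap = record
      { ⟦_⟧ = id
      ; isLinear = record { cong = id ; +-homo = λ _ _ → ≈ᴹ-refl ; *-homo = λ _ _ → ≈ᴹ-refl }
      }
    ; equivariant = λ _ _ → ≈ᴹ-refl
    }
    where open Representation X

  infixr 9 _∘ʳ_
  _∘ʳ_ : ∀ {n} {X Y Z : Representation n} → Y ⟶ Z → X ⟶ Y → X ⟶ Z
  _∘ʳ_ {Z = Z} g f = record
    { linearMap = linearMap g ∘ˡ linearMap f
    ; equivariant = λ h x → Representation.≈ᴹ-trans Z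
        (_⟶_.cong g (_⟶_.equivariant f h x)) (_⟶_.equivariant g h (to f x))
    }

  exact : ∀ {n} {X Y Z : Representation n} (f : X ⟶ Y) (g : Y ⟶ Z) →
    (let module Y = Representation Y
         module Z = Representation Z) →
    (∀ x → to g (to f x) Z.≈ᴹ Z.0ᴹ) →
    (∀ y → to g y Z.≈ᴹ Z.0ᴹ → ∃[ x ] to f x Y.≈ᴹ y) → Exact f g
  exact {Y = Y} {Z} f g gf≈0 lift y = mk⇔ (lift y) λ (x , fx≈y) →
    Z.≈ᴹ-trans (_⟶_.cong g (Y.≈ᴹ-sym fx≈y)) (gf≈0 x)
    where
    module Y = Representation Y
    module Z = Representation Z

  -- Lifts chosen degree by degree need not vanish eventually; from N on, where y is zero, they are
  -- replaced by 0.
  ⨁-lift : ∀ {n} {X Y : ℕ → Representation n} (f : ∀ j → X j ⟶ Y j) →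
    (let module Y j = Representation (Y j)) →
    (y : ∀ j → Y.Carrierᴹ j) → ∃[ N ] (∀ j → N ℕ.≤ j → Y._≈ᴹ_ j (y j) (Y.0ᴹ j)) →
    (∀ j → ∃[ x ] Y._≈ᴹ_ j (to (f j) x) (y j)) →
    Σ[ x ∈ Representation.Carrierᴹ (⨁ X) ] (∀ j → Y._≈ᴹ_ j (to (f j) (proj₁ x j)) (y j))
  ⨁-lift {X = X} {Y} f y (N , y≈0) lift = (x , N , x≈0) , fx≈y
    where
    module X j = Representation (X j)
    module Y j = Representation (Y j)
    choose : ∀ j → Dec (N ℕ.≤ j) → X.Carrierᴹ j
    choose j (yes _) = X.0ᴹ j
    choose j (no  _) = proj₁ (lift j)
    x : ∀ j → X.Carrierᴹ j
    x j = choose j (N ℕ.≤? j)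
    x≈0 : ∀ j → N ℕ.≤ j → X._≈ᴹ_ j (x j) (X.0ᴹ j)
    x≈0 j N≤j with N ℕ.≤? j
    ... | yes _   = X.≈ᴹ-refl j
    ... | no  N≰j = contradiction N≤j N≰j
    fx≈y : ∀ j → Y._≈ᴹ_ j (to (f j) (x j)) (y j)
    fx≈y j with N ℕ.≤? j
    ... | yes N≤j = Y.≈ᴹ-trans j (_⟶_.0-homo (f j)) (Y.≈ᴹ-sym j (y≈0 j N≤j))
    ... | no  _   = proj₂ (lift j)

-- Finite sums in a module

module Sums (K : CommutativeRing 0ℓ 0ℓ) (reciprocals : HasReciprocals K) where
  open LinearAlgebra K
  open ChromaticHomology K reciprocals
  open HasReciprocals reciprocals
  private module K = CommutativeRing K
  open EdgeMaps K reciprocals public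

  module _ (M : Module) {A : Set} where
    open LeftModule M

    ∑-filter : ∀ {P : A → Set} (P? : Decidable P) {f g : A → Carrierᴹ} →
      (∀ {x} → P x → f x ≈ᴹ g x) → (∀ {x} → ¬ P x → g x ≈ᴹ 0ᴹ) →
      ∀ xs → ∑ M (filter P? xs) f ≈ᴹ ∑ M xs g
    ∑-filter P? p q []       = ≈ᴹ-refl
    ∑-filter P? p q (x ∷ xs) with P? x
    ... | yes px = +ᴹ-cong (p px) (∑-filter P? p q xs)
    ... | no ¬px = ≈ᴹ-trans (∑-filter P? p q xs)
                     (≈ᴹ-trans (≈ᴹ-sym (+ᴹ-identityˡ _)) (+ᴹ-congʳ (≈ᴹ-sym (q ¬px))))

    ∑-≈0 : ∀ {f : A → Carrierᴹ} {xs} → All (λ x → f x ≈ᴹ 0ᴹ) xs → ∑ M xs f ≈ᴹ 0ᴹ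
    ∑-≈0 {xs = xs} ps = ≈ᴹ-trans (∑-cong M ps) (∑-0 M xs)

    ∑-single : ∀ {f : A → Carrierᴹ} {x xs} → Unique xs → x ∈ₗ xs →
               (∀ {y} → y ≢ x → f y ≈ᴹ 0ᴹ) → ∑ M xs f ≈ᴹ f x
    ∑-single (x≢ ∷ _) (here ≡.refl) p = ≈ᴹ-trans
      (+ᴹ-congˡ (∑-≈0 (All.map (λ x≢y → p (x≢y ∘ ≡.sym)) x≢))) (+ᴹ-identityʳ _)
    ∑-single (y≢ ∷ xs!) (there x∈) p = ≈ᴹ-trans
      (+ᴹ-cong (p (λ { ≡.refl → All.lookup y≢ x∈ ≡.refl })) (∑-single xs! x∈ p)) (+ᴹ-identityˡ _)

    x+x≈0⇒x≈0 : ∀ {x} → x +ᴹ x ≈ᴹ 0ᴹ → x ≈ᴹ 0ᴹ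
    x+x≈0⇒x≈0 {x} p = begin
      x                                        ≈⟨ *ₗ-identityˡ x ⟨
      K.1# *ₗ x                                ≈⟨ *ₗ-cong (1/1+-inverse 1) ≈ᴹ-refl ⟨
      ((K.1# K.+ (K.1# K.+ K.0#)) K.* ½) *ₗ x  ≈⟨ *ₗ-cong (K.*-congʳ (K.+-congˡ (K.+-identityʳ K.1#))) ≈ᴹ-refl ⟩
      ((K.1# K.+ K.1#) K.* ½) *ₗ x             ≈⟨ *ₗ-cong (K.*-comm _ _) ≈ᴹ-refl ⟩
      (½ K.* (K.1# K.+ K.1#)) *ₗ x             ≈⟨ *ₗ-assoc _ _ x ⟩
      ½ *ₗ ((K.1# K.+ K.1#) *ₗ x)              ≈⟨ *ₗ-cong K.refl (*ₗ-distribʳ x _ _) ⟩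
      ½ *ₗ (K.1# *ₗ x +ᴹ K.1# *ₗ x)            ≈⟨ *ₗ-cong K.refl (+ᴹ-cong 1*x≈x 1*x≈x) ⟩
      ½ *ₗ (x +ᴹ x)                            ≈⟨ *ₗ-cong K.refl p ⟩
      ½ *ₗ 0ᴹ                                  ≈⟨ *ₗ-zeroʳ ½ ⟩
      0ᴹ                                       ∎
      where
      open import Relation.Binary.Reasoning.Setoid ≈ᴹ-setoid
      ½ = 1/1+ 1
      1*x≈x = *ₗ-identityˡ x

    -- A double sum with antisymmetric summands equals its own negative, hence
    -- vanishes because 2 is invertible.
    ∑-antisymmetric : ∀ (f : A → A → Carrierᴹ) → (∀ x y → f x y +ᴹ f y x ≈ᴹ 0ᴹ) →
                      ∀ xs → ∑ M xs (λ x → ∑ M xs (f x)) ≈ᴹ 0ᴹ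
    ∑-antisymmetric f p xs = x+x≈0⇒x≈0 (begin
      ∑ M xs (λ x → ∑ M xs (f x)) +ᴹ ∑ M xs (λ x → ∑ M xs (f x))
        ≈⟨ +ᴹ-congˡ (∑-swap M xs xs f) ⟩
      ∑ M xs (λ x → ∑ M xs (f x)) +ᴹ ∑ M xs (λ x → ∑ M xs (λ y → f y x))
        ≈⟨ ∑-+ M xs (λ x → ∑ M xs (f x)) (λ x → ∑ M xs (λ y → f y x)) ⟨
      ∑ M xs (λ x → ∑ M xs (f x) +ᴹ ∑ M xs (λ y → f y x))
        ≈⟨ ∑-cong′ M (λ x → ∑-+ M xs (f x) (λ y → f y x)) xs ⟨
      ∑ M xs (λ x → ∑ M xs (λ y → f x y +ᴹ f y x))
        ≈⟨ ∑-≈0 (All.universal (λ x → ∑-≈0 (All.universal (p x) xs)) xs) ⟩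
      0ᴹ ∎)
      where open import Relation.Binary.Reasoning.Setoid ≈ᴹ-setoid

-- The differential squares to zero

module Differential (K : CommutativeRing 0ℓ 0ℓ) (reciprocals : HasReciprocals K) (G : Graph) (j : ℕ) where

  open LinearAlgebra K
  open _⟶_ using (to)
  open ChromaticHomology K reciprocals
  open Sums K reciprocals
  open Representations K
  open Signs K reciprocals G
  open Graph G
  private module K = CommutativeRing K
  open K using () renaming (Carrier to Scalar; _≈_ to _≈ₛ_; 0# to 0ₛ; 1# to 1ₛ)

  V : Representation n
  V = Families G j

  D : V ⟶ V
  D = differential G j

  open Representation V using (Carrierᴹ; _≈ᴹ_)

  module _ (F : Subset m) where
    open Representation (𝓜[_] G F j) public using () renaming (_≈ᴹ_ to _⊢_≈_)

  E : ∀ F F′ → 𝓜[_] G F j ⟶ 𝓜[_] G F′ j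
  E F F′ = edgeMap (components G F) (components G F′) j

  infix 9 _[_↦_]
  _[_↦_] : Carrierᴹ → ∀ F F′ → Representation.Carrierᴹ (𝓜[_] G F′ j)
  c [ F ↦ F′ ] = to (E F F′) (c F)

  M : Subset m → Module
  M F = Representation.leftModule (𝓜[_] G F j)

  -- Extending the sign by 0 to the edges of F makes every component of the differential a sum over
  -- all edges, so that double sums range over one fixed list and can be interchanged.
  coefficient : Subset m → Edge → Scalar
  coefficient F e = if does (e ∈? F) then 0ₛ else sgn G (F ∪ ⁅ e ⁆) e

  coefficient-∈ : ∀ {F e} → e ∈ F → coefficient F e ≡ 0ₛ
  coefficient-∈ {F} {e} e∈F rewrite dec-true (e ∈? F) e∈F = ≡.refl

  coefficient-∉ : ∀ {F e} → e ∉ F → coefficient F e ≡ sgn G (F ∪ ⁅ e ⁆) e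
  coefficient-∉ {F} {e} e∉F rewrite dec-false (e ∈? F) e∉F = ≡.refl

  differential-∑ : ∀ c F → F ⊢ to D c F ≈
                   ∑ (M F) (allFin m) (λ e → coefficient F e ⊡ c [ F ∪ ⁅ e ⁆ ↦ F ])
  differential-∑ c F = ∑-filter (M F) (λ e → ¬? (e ∈? F))
    (λ e∉F → ⊡-cong (K.reflexive (≡.sym (coefficient-∉ e∉F))) refl)
    (λ {e} ¬e∉F → trans (⊡-cong (K.reflexive (zero-coefficient ¬e∉F)) refl) (⊡-zeroˡ _))
    (allFin m)
    where
    zero-coefficient : ∀ {e} → ¬ (e ∉ F) → coefficient F e ≡ 0ₛ
    zero-coefficient {e} ¬e∉F with e ∈? F
    ... | yes _  = ≡.refl
    ... | no e∉F = contradiction e∉F ¬e∉F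

  ⊡-∘ : ∀ {P Q R : Subset m} → components G Q ⊑ components G P → components G R ⊑ components G Q →
        ∀ a b x → R ⊢ a ⊡ to (E Q R) (b ⊡ to (E P Q) x) ≈ ((a K.* b) ⊡ to (E P R) x)
  ⊡-∘ {P} {Q} {R} Q⊑P R⊑Q a b x = trans
    (⊡-cong K.refl (trans (_⟶_.*-homo (E Q R) b (to (E P Q) x))
      (⊡-cong K.refl (edgeMap-∘ (components G P) (components G Q) (components G R) Q⊑P R⊑Q j x))))
    (sym (⊡-assoc a b _))

  -- Functoriality shortens each two-step map to a single edge map. Only refinement of components is
  -- assumed, so F′ may also be larger than F: this covers h D, with F = F′ - e₃, as well as D D.
  component-differential : ∀ {F F′} → components G F′ ⊑ components G F → ∀ a c →
    F′ ⊢ a ⊡ to (E F F′) (to D c F) ≈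
    ∑ (M F′) (allFin m) (λ e → (a K.* coefficient F e) ⊡ c [ F ∪ ⁅ e ⁆ ↦ F′ ])
  component-differential {F} {F′} F′⊑F a c = trans
    (⊡-cong K.refl (trans (_⟶_.cong (E F F′) (differential-∑ c F))
      (∑-homo (_⟶_.linearMap (E F F′)) (allFin m) _)))
    (trans (sym (∑-* (M F′) (allFin m) a _))
    (∑-cong′ (M F′) (λ e →
      ⊡-∘ (components-mono G {F} {F ∪ ⁅ e ⁆} (p⊆p∪q ⁅ e ⁆)) F′⊑F a _ (c (F ∪ ⁅ e ⁆))) (allFin m)))

  coefficient-anticommute : ∀ F e f →
    coefficient F e K.* coefficient (F ∪ ⁅ e ⁆) f K.+ coefficient F f K.* coefficient (F ∪ ⁅ f ⁆) e ≈ₛ 0ₛ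
  coefficient-anticommute F e f with e ∈? F | f ∈? F | e Fin.≟ f
  ... | yes e∈F | _       | _ rewrite coefficient-∈ (p⊆p∪q {p = F} ⁅ f ⁆ e∈F) =
    K.trans (K.+-cong (K.zeroˡ _) (K.zeroʳ _)) (K.+-identityˡ 0ₛ)
  ... | no  _   | yes f∈F | _ rewrite coefficient-∈ (p⊆p∪q {p = F} ⁅ e ⁆ f∈F) =
    K.trans (K.+-cong (K.zeroʳ _) (K.zeroˡ _)) (K.+-identityˡ 0ₛ)
  ... | no  _   | no _    | yes ≡.refl rewrite coefficient-∈ (x∈p∪x F e) =
    K.trans (K.+-cong (K.zeroʳ _) (K.zeroʳ _)) (K.+-identityˡ 0ₛ)
  ... | no  e∉F | no f∉F  | no e≢f
    rewrite coefficient-∉ (x∉p∪y {F = F} f∉F (e≢f ∘ ≡.sym)) | coefficient-∉ (x∉p∪y {F = F} e∉F e≢f)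
          | p∪x∪y≡p∪y∪x F f e =
    K.trans (K.+-cong (K.*-comm _ _) (K.*-comm _ _)) (sgn-anticommute F e∉F f∉F e≢f)

  ⊡-cancel : ∀ {F a b} {x y : Representation.Carrierᴹ (𝓜[_] G F j)} → a K.+ b ≈ₛ 0ₛ → x ≡ y →
             F ⊢ (a ⊡ x ⊞ b ⊡ y) ≈ 𝟘
  ⊡-cancel p ≡.refl = trans (sym (⊡-distribʳ _ _ _)) (trans (⊡-cong p refl) (⊡-zeroˡ _))

  D² : ∀ c → to D (to D c) ≈ᴹ (λ _ → 𝟘)
  D² c F = trans (differential-∑ (to D c) F)
    (trans (∑-cong′ (M F) (λ e → component-differential
        (components-mono G {F} {F ∪ ⁅ e ⁆} (p⊆p∪q ⁅ e ⁆)) (coefficient F e) c) (allFin m))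
    (∑-antisymmetric (M F)
      (λ e f → (coefficient F e K.* coefficient (F ∪ ⁅ e ⁆) f) ⊡ c [ (F ∪ ⁅ e ⁆) ∪ ⁅ f ⁆ ↦ F ])
      (λ e f → ⊡-cancel (coefficient-anticommute F e f) (≡.cong (λ S → c [ S ↦ F ]) (p∪x∪y≡p∪y∪x F e f)))
      (allFin m)))

  diagonal : (Subset m → Scalar) → V ⟶ V
  diagonal κ = record
    { linearMap = record
      { ⟦_⟧ = λ c F → κ F ⊡ c F
      ; isLinear = record
        { cong   = λ p F → ⊡-cong K.refl (p F)
        ; +-homo = λ b c F → ⊡-distribˡ _ _ _
        ; *-homo = λ a c F → trans (sym (⊡-assoc _ a _))
            (trans (⊡-cong (K.*-comm _ a) refl) (⊡-assoc a _ _))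
        }
      }
    ; equivariant = λ g c F → refl
    }

  -- Edge maps are defined between any two states. With σ deleting e₃ they run from the smaller
  -- state to the larger one.
  pull : (Subset m → Subset m) → V ⟶ V
  pull σ = record
    { linearMap = record
      { ⟦_⟧ = λ c F → c [ σ F ↦ F ]
      ; isLinear = record
        { cong   = λ p F → _⟶_.cong (E (σ F) F) (p (σ F))
        ; +-homo = λ _ _ _ → refl
        ; *-homo = λ _ _ _ → refl
        }
      }
    ; equivariant = λ g c F → _⟶_.equivariant (E (σ F) F) g (c (σ F))
    }

  -- The contracting homotopy given by the triangle

  module TriangleHomotopy {e₁ e₂ e₃ : Edge} (tri : Triangle e₁ e₂ e₃) where

    full? : ∀ F → Dec (e₁ ∈ F × e₂ ∈ F × e₃ ∈ F)
    full? F = e₁ ∈? F ×-dec e₂ ∈? F ×-dec e₃ ∈? F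

    -- On states containing the triangle this is the sign of the deletion F to F - e₃, which is its
    -- own inverse; h thus undoes the signed component of D.
    κ : Subset m → Scalar
    κ F = if does (full? F) then sgn G F e₃ else 0ₛ

    κ-full : ∀ {F} → e₁ ∈ F → e₂ ∈ F → e₃ ∈ F → κ F ≡ sgn G F e₃
    κ-full {F} p q r rewrite dec-true (full? F) (p , q , r) = ≡.refl

    κ-notFull : ∀ {F} → ¬ (e₁ ∈ F × e₂ ∈ F × e₃ ∈ F) → κ F ≡ 0ₛ
    κ-notFull {F} ¬full rewrite dec-false (full? F) ¬full = ≡.refl

    hʳ : V ⟶ V
    hʳ = diagonal κ ∘ʳ pull (_- e₃)

    open _⟶_ hʳ using () renaming (to to ⟦h⟧)

    private
      X : Carrierᴹ → (F : Subset m) → Edge → Representation.Carrierᴹ (𝓜[_] G F j)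
      X c F e = (coefficient F e K.* κ (F ∪ ⁅ e ⁆)) ⊡ c [ (F ∪ ⁅ e ⁆) - e₃ ↦ F ]

    differential-h : ∀ c {F} → e₁ ∈ F → e₂ ∈ F → F ⊢ to D (⟦h⟧ c) F ≈ ∑ (M F) (allFin m) (X c F)
    differential-h c {F} e₁∈F e₂∈F = trans (differential-∑ (⟦h⟧ c) F)
      (∑-cong′ (M F) (λ e → ⊡-∘
        (components-minus G tri (p⊆p∪q {p = F} ⁅ e ⁆ e₁∈F) (p⊆p∪q {p = F} ⁅ e ⁆ e₂∈F))
        (components-mono G {F} {F ∪ ⁅ e ⁆} (p⊆p∪q ⁅ e ⁆)) _ _ (c ((F ∪ ⁅ e ⁆) - e₃))) (allFin m))

    ↦-id : ∀ c {F S} → S ≡ F → F ⊢ c [ S ↦ F ] ≈ c F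
    ↦-id c ≡.refl = edgeMap-id _ j _

    unit : ∀ {F a b} {x y : Representation.Carrierᴹ (𝓜[_] G F j)} → a K.* b ≈ₛ 1ₛ → F ⊢ x ≈ y →
           F ⊢ (a K.* b) ⊡ x ≈ y
    unit p q = trans (⊡-cong p q) (⊡-identityˡ _)

    -- The term h D vanishes at F, and in D h only the edge e₃ leads to a state containing the
    -- triangle; its two equal signs multiply to 1.
    homotopy-∉ : ∀ c {F} → e₁ ∈ F → e₂ ∈ F → e₃ ∉ F → F ⊢ to D (⟦h⟧ c) F ⊞ ⟦h⟧ (to D c) F ≈ c F
    homotopy-∉ c {F} e₁∈F e₂∈F e₃∉F = trans
      (⊞-cong
        (trans (differential-h c e₁∈F e₂∈F)
        (trans (∑-single (M F) (allFin⁺ m) (∈-allFin e₃) λ {e} e≢e₃ →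
            trans (⊡-cong (K.trans (K.*-congˡ (K.reflexive (κ-notFull
                    (x∉p∪y {F = F} e₃∉F (e≢e₃ ∘ ≡.sym) ∘ proj₂ ∘ proj₂)))) (K.zeroʳ _)) refl)
                  (⊡-zeroˡ _))
        (unit scalar (↦-id c (p∪x-x≡p e₃∉F)))))
        (trans (⊡-cong (K.reflexive (κ-notFull (e₃∉F ∘ proj₂ ∘ proj₂))) refl) (⊡-zeroˡ _)))
      (trans (⊞-comm _ _) (⊞-identityˡ _))
      where
      scalar : coefficient F e₃ K.* κ (F ∪ ⁅ e₃ ⁆) ≈ₛ 1ₛ
      scalar rewrite coefficient-∉ {F} {e₃} e₃∉F
                   | κ-full {F ∪ ⁅ e₃ ⁆} (p⊆p∪q {p = F} ⁅ e₃ ⁆ e₁∈F)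
                            (p⊆p∪q {p = F} ⁅ e₃ ⁆ e₂∈F) (x∈p∪x F e₃)
             = sgn-square (F ∪ ⁅ e₃ ⁆) e₃

    -- In h D, putting e₃ back into F - e₃ yields `c F`. For any other edge e outside F, both D h
    -- and h D reach the state F + e - e₃, with opposite signs; for e in F both coefficients are 0.
    homotopy-∈ : ∀ c {F} → e₁ ∈ F → e₂ ∈ F → e₃ ∈ F → F ⊢ to D (⟦h⟧ c) F ⊞ ⟦h⟧ (to D c) F ≈ c F
    homotopy-∈ c {F} e₁∈F e₂∈F e₃∈F = trans
      (⊞-cong (differential-h c e₁∈F e₂∈F)
              (component-differential (components-minus G tri e₁∈F e₂∈F) (κ F) c))
      (trans (sym (∑-+ (M F) (allFin m) (X c F) Y))
      (trans (∑-single (M F) (allFin⁺ m) (∈-allFin e₃) cancels)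
      (trans (⊞-cong
        (trans (⊡-cong (K.trans (K.*-congʳ (K.reflexive (coefficient-∈ e₃∈F))) (K.zeroˡ _)) refl) (⊡-zeroˡ _))
        (unit scalar₃ (↦-id c (p-x∪x≡p e₃∈F))))
      (⊞-identityˡ _))))
      where
      F₀ = F - e₃
      e₃∉F₀ = x∉p-x F e₃
      Y : (e : Edge) → Representation.Carrierᴹ (𝓜[_] G F j)
      Y e = (κ F K.* coefficient F₀ e) ⊡ c [ F₀ ∪ ⁅ e ⁆ ↦ F ]
      scalar₃ : κ F K.* coefficient F₀ e₃ ≈ₛ 1ₛ
      scalar₃ rewrite coefficient-∉ e₃∉F₀ | κ-full e₁∈F e₂∈F e₃∈F | p-x∪x≡p e₃∈F = sgn-square F e₃
      scalar : ∀ {e} → e ≢ e₃ → coefficient F e K.* κ (F ∪ ⁅ e ⁆) K.+ κ F K.* coefficient F₀ e ≈ₛ 0ₛ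
      scalar {e} e≢e₃ with e ∈? F
      ... | yes e∈F rewrite coefficient-∈ {F₀} (x∈p∧x≢y⇒x∈p-y e∈F e≢e₃) =
        K.trans (K.+-cong (K.zeroˡ _) (K.zeroʳ _)) (K.+-identityˡ 0ₛ)
      ... | no  e∉F rewrite coefficient-∉ {F₀} (λ e∈F₀ → e∉F (p─q⊆p F ⁅ e₃ ⁆ e∈F₀))
                          | κ-full {F ∪ ⁅ e ⁆} (p⊆p∪q {p = F} ⁅ e ⁆ e₁∈F)
                                   (p⊆p∪q {p = F} ⁅ e ⁆ e₂∈F) (p⊆p∪q {p = F} ⁅ e ⁆ e₃∈F)
                          | κ-full e₁∈F e₂∈F e₃∈F =
        ≡.subst (λ S → sgn G (S ∪ ⁅ e ⁆) e K.* sgn G (S ∪ ⁅ e ⁆) e₃ K.+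
                       sgn G S e₃ K.* sgn G (F₀ ∪ ⁅ e ⁆) e ≈ₛ 0ₛ)
          (p-x∪x≡p e₃∈F)
          (sgn-anticommute′ F₀ e₃∉F₀ (λ e∈F₀ → e∉F (p─q⊆p F ⁅ e₃ ⁆ e∈F₀)) (e≢e₃ ∘ ≡.sym))
      cancels : ∀ {e} → e ≢ e₃ → F ⊢ X c F e ⊞ Y e ≈ 𝟘
      cancels e≢e₃ = ⊡-cancel (scalar e≢e₃) (≡.cong (λ S → c [ S ↦ F ]) (p∪x-y≡p-y∪x F e≢e₃))

    homotopy : ∀ c {F} → e₁ ∈ F → e₂ ∈ F → F ⊢ to D (⟦h⟧ c) F ⊞ ⟦h⟧ (to D c) F ≈ c F
    homotopy c {F} e₁∈F e₂∈F = by-cases (e₃ ∈? F)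
      where
      by-cases : Dec (e₃ ∈ F) → F ⊢ to D (⟦h⟧ c) F ⊞ ⟦h⟧ (to D c) F ≈ c F
      by-cases (yes e₃∈F) = homotopy-∈ c e₁∈F e₂∈F e₃∈F
      by-cases (no  e₃∉F) = homotopy-∉ c e₁∈F e₂∈F e₃∉F

    h-vanishes : ∀ {c F} → (e₁ ∈ F → e₂ ∈ F → e₃ ∈ F → (F - e₃) ⊢ c (F - e₃) ≈ 𝟘) → F ⊢ ⟦h⟧ c F ≈ 𝟘
    h-vanishes {c} {F} z = by-cases (full? F)
      where
      by-cases : Dec (e₁ ∈ F × e₂ ∈ F × e₃ ∈ F) → F ⊢ ⟦h⟧ c F ≈ 𝟘
      by-cases (no  ¬full)         = trans (⊡-cong (K.reflexive (κ-notFull ¬full)) refl) (⊡-zeroˡ _)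
      by-cases (yes (p₁ , p₂ , p₃)) = trans
        (⊡-cong K.refl (trans (_⟶_.cong (E (F - e₃) F) (z p₁ p₂ p₃)) (_⟶_.0-homo (E (F - e₃) F))))
        (LeftModule.*ₗ-zeroʳ (M F) _)

-- The long exact sequence in each exterior degree

module LongExactSequence (K : CommutativeRing 0ℓ 0ℓ) (reciprocals : HasReciprocals K)
  (G : Graph) {e₁ e₂ e₃ : Graph.Edge G} (tri : Graph.Triangle G e₁ e₂ e₃) where

  open Graph G
  open LinearAlgebra K
  open _⟶_ using (to; linearMap)
  open ChromaticHomology K reciprocals
  open Sums K reciprocals
  open Representations K
  open MayerVietoris K
  private module K = CommutativeRing K
  open K using () renaming (Carrier to Scalar; 0# to 0ₛ; 1# to 1ₛ)

  A B A∩B : Subset m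
  A   = ⊤ - e₁
  B   = ⊤ - e₂
  A∩B = ⊤ - e₁ - e₂

  module Degree (j : ℕ) where
    open Differential K reciprocals G j
    open TriangleHomotopy tri
    open Differences (Representation.leftModule V)
      using (_≈ᴹ_; _-ᴹ_; 0ᴹ; -ᴹ‿inverseʳ; ≈ᴹ-sym; ≈ᴹ-trans; x≈y⇒x-y≈0; x-0≈x)
      renaming (Carrierᴹ to Chain)

    supported : Subset m → ℕ → Submodule (Representation.leftModule V)
    supported S i = record
      { _∈       = λ c → ∀ F → ¬ (_isState_of_ G F i S) → F ⊢ c F ≈ 𝟘
      ; resp     = λ p z F ¬s → trans (sym (p F)) (z F ¬s)
      ; 0-closed = proj₂ (C.0ᴹ)
      ; +-closed = λ p q → proj₂ ((_ , p) C.+ᴹ (_ , q))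
      ; *-closed = λ a p → proj₂ (a C.*ₗ (_ , p))
      }
      where module C = Representation (C G S i j)

    Supported : Subset m → ℕ → Chain → Set
    Supported S i = Submodule._∈ (supported S i)

    D-supported : ∀ S i {c} → Supported S (suc i) c → Supported S i (to D c)
    D-supported S i z = proj₂ (to (∂ G S i j) (_ , z))

    include-supported : ∀ {S T} → S ⊆ T → ∀ i {c} → Supported S i c → Supported T i c
    include-supported {S} {T} S⊆T i z = proj₂ (to (include G {S} {T} S⊆T i j) (_ , z))

    -- Restriction to the states without e₁ is not a chain map, since D can delete e₁. The
    -- connecting map measures this failure on the cycle `N z`.
    ρ : Subset m → Scalar
    ρ F = if does (e₁ ∈? F) then 0ₛ else 1ₛ

    rʳ : V ⟶ V
    rʳ = diagonal ρ

    r-∈ : ∀ c {F} → e₁ ∈ F → F ⊢ to rʳ c F ≈ 𝟘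
    r-∈ c {F} e₁∈F rewrite dec-true (e₁ ∈? F) e₁∈F = ⊡-zeroˡ (c F)

    r-∉ : ∀ c {F} → e₁ ∉ F → F ⊢ to rʳ c F ≈ c F
    r-∉ c {F} e₁∉F rewrite dec-false (e₁ ∈? F) e₁∉F = ⊡-identityˡ (c F)

    h-supported : ∀ {i c} → Supported ⊤ i c → Supported ⊤ (suc i) (to hʳ c)
    h-supported {i} {c} z F ¬s = h-vanishes {c} {F} λ _ _ e₃∈F → z (F - e₃) λ (_ , eq) →
      ¬s (⊆⊤ , ≡.trans (∣p∣≡1+∣p-x∣ e₃∈F) (≡.cong suc eq))

    h-A : ∀ {i c} → Supported A i c → to hʳ c ≈ᴹ 0ᴹ
    h-A {i} {c} z F = h-vanishes {c} {F} λ e₁∈F _ _ → z (F - e₃) λ (F⊆A , _) →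
      ⊆-⇒∉ {S = ⊤} F⊆A (x∈p∧x≢y⇒x∈p-y e₁∈F (triangle-≢₁₃ G tri))

    h-B : ∀ {i c} → Supported B i c → to hʳ c ≈ᴹ 0ᴹ
    h-B {i} {c} z F = h-vanishes {c} {F} λ _ e₂∈F _ → z (F - e₃) λ (F⊆B , _) →
      ⊆-⇒∉ {S = ⊤} F⊆B (x∈p∧x≢y⇒x∈p-y e₂∈F (triangle-≢₂₃ G tri))

    A∩B-supported : ∀ {i c} → Supported A i c → Supported B i c → Supported A∩B i c
    A∩B-supported {i} {c} zA zB F ¬s = by-cases (e₁ ∈? F)
      where
      by-cases : Dec (e₁ ∈ F) → F ⊢ c F ≈ 𝟘
      by-cases (yes e₁∈F) = zA F λ (F⊆A , _) → ⊆-⇒∉ {S = ⊤} F⊆A e₁∈F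
      by-cases (no  e₁∉F) = zB F λ (F⊆B , eq) →
        ¬s (∉⇒⊆- (∉⇒⊆- ⊆⊤ e₁∉F) (⊆-⇒∉ {S = ⊤} F⊆B) , eq)

    r-⊤ : ∀ {i c} → Supported ⊤ i c → Supported A i (to rʳ c)
    r-⊤ {i} {c} z F ¬s = by-cases (e₁ ∈? F)
      where
      by-cases : Dec (e₁ ∈ F) → F ⊢ to rʳ c F ≈ 𝟘
      by-cases (yes e₁∈F) = r-∈ c e₁∈F
      by-cases (no  e₁∉F) = trans (r-∉ c e₁∉F) (z F λ (_ , eq) → ¬s (∉⇒⊆- ⊆⊤ e₁∉F , eq))

    r-A : ∀ {i c} → Supported A i c → to rʳ c ≈ᴹ c
    r-A {i} {c} z F = by-cases (e₁ ∈? F)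
      where
      by-cases : Dec (e₁ ∈ F) → F ⊢ to rʳ c F ≈ c F
      by-cases (yes e₁∈F) = trans (r-∈ c e₁∈F) (sym (z F λ (F⊆A , _) → ⊆-⇒∉ {S = ⊤} F⊆A e₁∈F))
      by-cases (no  e₁∉F) = r-∉ c e₁∉F

    r-B : ∀ {i c} → Supported B i c → Supported A∩B i (to rʳ c)
    r-B {i} {c} z F ¬s = by-cases (e₁ ∈? F)
      where
      by-cases : Dec (e₁ ∈ F) → F ⊢ to rʳ c F ≈ 𝟘
      by-cases (yes e₁∈F) = r-∈ c e₁∈F
      by-cases (no  e₁∉F) = trans (r-∉ c e₁∉F) (z F λ (F⊆B , eq) →
        ¬s (∉⇒⊆- (∉⇒⊆- ⊆⊤ e₁∉F) (⊆-⇒∉ {S = ⊤} F⊆B) , eq))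

    -- On states without e₁ the difference is 0 because r fixes the chain; states with e₁ and
    -- without e₂ belong to B; on states with both, the homotopy and `h (D c) = 0` give
    -- `D (h c) = c`, so N vanishes.
    homotopy-B : ∀ {i c} → Supported ⊤ i c → to hʳ (to D c) ≈ᴹ 0ᴹ →
      Supported B i ((c -ᴹ to D (to hʳ c)) -ᴹ to rʳ (c -ᴹ to D (to hʳ c)))
    homotopy-B {i} {c} z hDc≈0 F ¬s = by-cases (e₁ ∈? F) (e₂ ∈? F)
      where
      module MF = Differences (M F)
      N = c -ᴹ to D (to hʳ c)
      zN : Supported ⊤ i N
      zN = Submodule.+-closed (supported ⊤ i) z
        (Submodule.neg-closed (supported ⊤ i) (D-supported ⊤ i (h-supported z)))
      by-cases : Dec (e₁ ∈ F) → Dec (e₂ ∈ F) → F ⊢ (N -ᴹ to rʳ N) F ≈ 𝟘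
      by-cases (no  e₁∉F) _          = MF.x≈y⇒x-y≈0 (sym (r-∉ N e₁∉F))
      by-cases (yes e₁∈F) (no e₂∉F)  = trans (MF.x≈0⇒y-x≈y (N F) (r-∈ N e₁∈F))
        (zN F λ (_ , eq) → ¬s (∉⇒⊆- ⊆⊤ e₂∉F , eq))
      by-cases (yes e₁∈F) (yes e₂∈F) = trans (MF.x≈0⇒y-x≈y (N F) (r-∈ N e₁∈F))
        (MF.x≈y⇒x-y≈0 (trans (sym (homotopy c e₁∈F e₂∈F))
          (trans (⊞-cong refl (hDc≈0 F)) (trans (⊞-comm _ _) (⊞-identityˡ _)))))

    open ConnectingMap (Representation.leftModule V) (linearMap D) (linearMap hʳ) (linearMap rʳ)
      (supported A) (supported B) (supported A∩B) (supported ⊤)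
      D² (λ {i} → D-supported A i) (λ {i} → D-supported B i) (λ {i} → D-supported ⊤ i)
      (λ {i} → include-supported (minus⊆ ⊤ e₁) i) (λ {i} → include-supported (minus⊆ ⊤ e₂) i)
      (λ {i} → include-supported (minus⊆ˡ ⊤ e₁ e₂) i) (λ {i} → include-supported (minus⊆ʳ ⊤ e₁ e₂) i)
      A∩B-supported h-supported h-A h-B r-⊤ r-A r-B homotopy-B

    -- N and δ as composites of morphisms: linearity and equivariance of δ on homology then hold
    -- already for chains.
    Nʳ δʳ : V ⟶ V
    Nʳ = [_∣_] {X = V} {V} {V} idʳ (-ʳ_ {X = V} {V} (D ∘ʳ hʳ)) ∘ʳ ⟪_,_⟫ {X = V} {V} {V} idʳ idʳ
    δʳ = D ∘ʳ rʳ ∘ʳ Nʳ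

    private
      module δ = LinearMapProperties (linearMap δʳ)
      module D = LinearMapProperties (linearMap D)

    chain : ∀ {S i} → Representation.Carrierᴹ (C G S i j) → Chain
    chain = proj₁

    -- The differential out of C₀ is zero by definition, but D on V must vanish there as well. It
    -- does because a state F + e has an edge, hence carries no part of c.
    D-C₀ : ∀ {S c} → Supported S 0 c → to D c ≈ᴹ 0ᴹ
    D-C₀ {S} {c} z F = trans (differential-∑ c F) (∑-≈0 (M F) (All.universal (λ e → trans
      (⊡-cong K.refl (trans (_⟶_.cong (E (F ∪ ⁅ e ⁆) F) (z (F ∪ ⁅ e ⁆) λ (_ , eq) →
          nonempty (≡.trans (≡.sym (∣p∣≡1+∣p-x∣ (x∈p∪x F e))) eq)))
        (_⟶_.0-homo (E (F ∪ ⁅ e ⁆) F))))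
      (LeftModule.*ₗ-zeroʳ (M F) _)) (allFin m)))
      where
      nonempty : ∀ {k} → ¬ (suc k ≡ 0)
      nonempty ()

    cycle⇒D≈0 : ∀ S i x →
                Representation._≈ᴹ_ (C⁻ G S i j) (to (d G S i j) x) (Representation.0ᴹ (C⁻ G S i j)) →
                to D (chain {S} {i} x) ≈ᴹ 0ᴹ
    cycle⇒D≈0 S zero    (c , z) _ = D-C₀ {S} z
    cycle⇒D≈0 S (suc i) x       p = p

    D≈0⇒cycle : ∀ S i x → to D (chain {S} {i} x) ≈ᴹ 0ᴹ →
                Representation._≈ᴹ_ (C⁻ G S i j) (to (d G S i j) x) (Representation.0ᴹ (C⁻ G S i j))
    D≈0⇒cycle S zero    x p = _
    D≈0⇒cycle S (suc i) x p = p

    class : ∀ S i {c} → Supported S i c → to D c ≈ᴹ 0ᴹ →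
            Representation.Carrierᴹ (H[_,_] G i j S)
    class S i z p = (_ , z) , D≈0⇒cycle S i (_ , z) p

    homologous : ∀ S i {x y} → x ≈ᴹ y → ∃[ u ] to D (chain {S} {suc i} u) ≈ᴹ x -ᴹ y
    homologous S i p = Representation.0ᴹ (C G S (suc i) j)
      , ≈ᴹ-trans D.0-homo (≈ᴹ-sym (x≈y⇒x-y≈0 p))

    δ-H : ∀ i → H[_,_] G (suc i) j ⊤ ⟶ H[_,_] G i j A∩B
    δ-H i = record
      { linearMap = record
        { ⟦_⟧ = λ ((c , z) , p) → class A∩B i (δ-X z p) (D² (P c))
        ; isLinear = record
          { cong   = λ {((c , z) , _)} {((c′ , z′) , _)} ((w , zw) , Dw≈) →
              let (x , zx , Dx≈) = δ-boundary zw (minus-closed {S = supported ⊤} z z′) Dw≈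
              in (x , zx) , ≈ᴹ-trans Dx≈ (δ.minus-homo c c′)
          ; +-homo = λ ((c , _) , _) ((c′ , _) , _) → homologous A∩B i (δ.+-homo c c′)
          ; *-homo = λ a ((c , _) , _) → homologous A∩B i (δ.*-homo a c)
          }
        }
      ; equivariant = λ g ((c , _) , _) → homologous A∩B i (_⟶_.equivariant δʳ g c)
      }

    -- The degree j summand of `include-H`, given separately so that exactness can be proved one
    -- degree at a time.
    include-Hⱼ : ∀ {S T} → S ⊆ T → ∀ i → H[_,_] G i j S ⟶ H[_,_] G i j T
    include-Hⱼ {S} {T} S⊆T i = homology-map
      {f = d G S (suc i) j} {d G S i j} {d G T (suc i) j} {d G T i j}
      (include G {S} {T} S⊆T (suc i) j) (include G {S} {T} S⊆T i j) (include⁻ G {S} {T} S⊆T i j)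
      (λ _ _ → refl) (commutes i)
      where
      commutes : ∀ i x → Representation._≈ᴹ_ (C⁻ G T i j)
        (to (d G T i j) (to (include G {S} {T} S⊆T i j) x))
        (to (include⁻ G {S} {T} S⊆T i j) (to (d G S i j) x))
      commutes zero    x = _
      commutes (suc i) x = λ _ → refl

    φ-H : ∀ i → H[_,_] G i j A∩B ⟶ H[_,_] G i j A ⊕ H[_,_] G i j B
    φ-H i = ⟪_,_⟫ {X = H[_,_] G i j A∩B} {H[_,_] G i j A} {H[_,_] G i j B}
      (include-Hⱼ {A∩B} {A} (minus⊆ˡ ⊤ e₁ e₂) i)
      (-ʳ_ {X = H[_,_] G i j A∩B} {H[_,_] G i j B} (include-Hⱼ {A∩B} {B} (minus⊆ʳ ⊤ e₁ e₂) i))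

    ψ-H : ∀ i → H[_,_] G i j A ⊕ H[_,_] G i j B ⟶ H[_,_] G i j ⊤
    ψ-H i = [_∣_] {X = H[_,_] G i j A} {H[_,_] G i j B} {H[_,_] G i j ⊤}
      (include-Hⱼ {A} {⊤} (minus⊆ ⊤ e₁) i) (include-Hⱼ {B} {⊤} (minus⊆ ⊤ e₂) i)

    φψ-exact-H : ∀ i → Exact (φ-H i) (ψ-H i)
    φψ-exact-H i = exact (φ-H i) (ψ-H i)
      (λ ((c , _) , _) → homologous ⊤ i (-ᴹ‿inverseʳ c))
      -- Being zero in the quotient means that the difference with 0 is a boundary, whence the
      -- conversions by `x-0≈x` here and below.
      λ { (((a , za) , pa) , ((b , zb) , pb)) ((y , zy) , Dy≈) →
        let (x , zx , Dx≈0 , (u , zu , Du≈) , (v , zv , Dv≈)) =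
              φψ-exact za zb (cycle⇒D≈0 A i (a , za) pa) zy (≈ᴹ-trans Dy≈ (x-0≈x _))
        in class A∩B i zx Dx≈0 , ((u , zu) , Du≈) , ((v , zv) , Dv≈) }

    ψδ-exact-H : ∀ i → Exact (ψ-H (suc i)) (δ-H i)
    ψδ-exact-H i = exact (ψ-H (suc i)) (δ-H i)
      (λ { (((a , za) , pa) , ((b , zb) , pb)) →
        let (x , zx , Dx≈) = δψ≈0 za zb pa in (x , zx) , ≈ᴹ-trans Dx≈ (≈ᴹ-sym (x-0≈x _)) })
      λ { ((z , zz) , pz) ((w , zw) , Dw≈) →
        let (a , b , za , zb , pa , pb , y , zy , Dy≈) = ψδ-exact zz pz zw (≈ᴹ-trans Dw≈ (x-0≈x _))
        in (class A (suc i) za pa , class B (suc i) zb pb) , (y , zy) , Dy≈ }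

    δφ-exact-H : ∀ i → Exact (δ-H i) (φ-H i)
    δφ-exact-H i = exact (δ-H i) (φ-H i)
      (λ ((z , zz) , pz) →
        let ((u , zu , Du≈) , (v , zv , Dv≈)) = φδ≈0 zz pz
        in ((u , zu) , ≈ᴹ-trans Du≈ (≈ᴹ-sym (x-0≈x _))) , ((v , zv) , ≈ᴹ-trans Dv≈ (≈ᴹ-sym (x-0≈x _))))
      λ { ((x , zx) , px) (((a , za) , Da≈) , ((b , zb) , Db≈)) →
        let (z∈ , Dz≈0 , w , zw , Dw≈) =
              δφ-exact za (≈ᴹ-trans Da≈ (x-0≈x _)) zb (≈ᴹ-trans Db≈ (x-0≈x _))
        in class ⊤ (suc i) z∈ Dz≈0 , (w , zw) , Dw≈ }

    ψ-surjective-H : Surjective (ψ-H 0)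
    ψ-surjective-H ((z , zz) , pz) =
      let (a , b , za , zb , y , zy , Dy≈) = splitting zz (D-C₀ {⊤} zz)
      in (class A 0 za (D-C₀ {A} za) , class B 0 zb (D-C₀ {B} zb)) , (y , zy) , Dy≈

  -- Assembling the degrees

  φᵢ : ∀ i → H G i A∩B ⟶ H G i A ⊕ H G i B
  φᵢ = φ G {A∩B} {A} {B} (minus⊆ˡ ⊤ e₁ e₂) (minus⊆ʳ ⊤ e₁ e₂)

  ψᵢ : ∀ i → H G i A ⊕ H G i B ⟶ H G i ⊤
  ψᵢ = ψ G {A} {B} {⊤} (minus⊆ ⊤ e₁) (minus⊆ ⊤ e₂)

  δᵢ : ∀ i → H G (suc i) ⊤ ⟶ H G i A∩B
  δᵢ i = ⨁-map {X = λ j → H[_,_] G (suc i) j ⊤} {λ j → H[_,_] G i j A∩B} λ j → Degree.δ-H j i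

  private
    module Summand (i : ℕ) (S : Subset m) (j : ℕ) = Representation (H[_,_] G i j S)

  φψ-exact : ∀ i → Exact (φᵢ i) (ψᵢ i)
  φψ-exact i ((a , Na , a≈0) , (b , Nb , b≈0)) = mk⇔
    (λ p →
      let (x , φx≈) = ⨁-lift (λ j → Degree.φ-H j i) (λ j → a j , b j)
            (Na ℕ.⊔ Nb , λ j l → a≈0 j (ℕₚ.m⊔n≤o⇒m≤o Na Nb l) , b≈0 j (ℕₚ.m⊔n≤o⇒n≤o Na Nb l))
            (λ j → Equivalence.to (Degree.φψ-exact-H j i (a j , b j)) (p j))
      in x , (λ j → proj₁ (φx≈ j)) , (λ j → proj₂ (φx≈ j)))
    (λ ((x , _) , p , q) j → Equivalence.from (Degree.φψ-exact-H j i (a j , b j)) (x j , p j , q j))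

  split : ∀ {n} {X Y : ℕ → Representation n} → Representation.Carrierᴹ (⨁ (λ j → X j ⊕ Y j)) →
          Representation.Carrierᴹ (⨁ X ⊕ ⨁ Y)
  split (x , N , x≈0) = ((λ j → proj₁ (x j)) , N , λ j l → proj₁ (x≈0 j l))
                      , ((λ j → proj₂ (x j)) , N , λ j l → proj₂ (x≈0 j l))

  ψδ-exact : ∀ i → Exact (ψᵢ (suc i)) (δᵢ i)
  ψδ-exact i (z , Nz , z≈0) = mk⇔
    (λ p →
      let (ab , ψab≈) = ⨁-lift (λ j → Degree.ψ-H j (suc i)) z (Nz , z≈0)
            (λ j → Equivalence.to (Degree.ψδ-exact-H j i (z j)) (p j))
      in split {X = λ j → H[_,_] G (suc i) j A} {λ j → H[_,_] G (suc i) j B} ab , ψab≈)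
    (λ (((a , _) , (b , _)) , p) j → Equivalence.from (Degree.ψδ-exact-H j i (z j)) ((a j , b j) , p j))

  δφ-exact : ∀ i → Exact (δᵢ i) (φᵢ i)
  δφ-exact i (x , Nx , x≈0) = mk⇔
    (λ (p , q) → ⨁-lift (λ j → Degree.δ-H j i) x (Nx , x≈0)
      (λ j → Equivalence.to (Degree.δφ-exact-H j i (x j)) (p j , q j)))
    (λ ((z , _) , p) →
      let φδ≈0 = λ j → Equivalence.from (Degree.δφ-exact-H j i (x j)) (z j , p j)
      in (λ j → proj₁ (φδ≈0 j)) , (λ j → proj₂ (φδ≈0 j)))

  ψ-surjective : Surjective (ψᵢ 0)
  ψ-surjective (z , Nz , z≈0) =
    let (ab , ψab≈) = ⨁-lift (λ j → Degree.ψ-H j 0) z (Nz , z≈0) (λ j → Degree.ψ-surjective-H j (z j))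
    in split {X = λ j → H[_,_] G 0 j A} {λ j → H[_,_] G 0 j B} ab , ψab≈

  δ-degreePreserving : ∀ i → DegreePreserving G (suc i) ⊤ i A∩B (δᵢ i)
  δ-degreePreserving i j (x , _) x-homogeneous k k≢j = Summand.≈ᴹ-trans i A∩B k
    {to (δk k) (x k)} {to (δk k) (Representation.0ᴹ (H[_,_] G (suc i) k ⊤))} {Summand.0ᴹ i A∩B k}
    (_⟶_.cong (δk k) {x k} {Summand.0ᴹ (suc i) ⊤ k} (x-homogeneous k k≢j)) (_⟶_.0-homo (δk k))
    where
    δk : ∀ k → H[_,_] G (suc i) k ⊤ ⟶ H[_,_] G i k A∩B
    δk k = Degree.δ-H k i

module Scalars (K : CommutativeRing 0ℓ 0ℓ) (reciprocals : HasReciprocals K) where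
  open LinearAlgebra K using (_⟶_; _⊕_; Exact; Surjective)
  open ChromaticHomology K reciprocals using (H; φ; ψ; DegreePreserving)

  -- Over ℂ itself, comparing the types below would unfold the construction of ℂ.
  longExactSequence : (G : Graph) (e₁ e₂ e₃ : Graph.Edge G) → Graph.Triangle G e₁ e₂ e₃ →
    let E   = ⊤
        A   = E - e₁
        B   = E - e₂
        A∩B = E - e₁ - e₂
        φᵢ : ∀ i → H G i A∩B ⟶ H G i A ⊕ H G i B
        φᵢ = φ G {A∩B} {A} {B} (minus⊆ˡ E e₁ e₂) (minus⊆ʳ E e₁ e₂)
        ψᵢ : ∀ i → H G i A ⊕ H G i B ⟶ H G i E
        ψᵢ = ψ G {A} {B} {E} (minus⊆ E e₁) (minus⊆ E e₂)
    in
    Σ[ δ ∈ (∀ i → H G (suc i) E ⟶ H G i A∩B) ]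
      ( (∀ i → Exact (φᵢ i) (ψᵢ i))
      × (∀ i → Exact (ψᵢ (suc i)) (δ i))
      × (∀ i → Exact (δ i) (φᵢ i))
      × Surjective (ψᵢ zero)
      × (∀ i → DegreePreserving G (suc i) E i A∩B (δ i)) )
  longExactSequence G e₁ e₂ e₃ tri =
    δᵢ , φψ-exact , ψδ-exact , δφ-exact , ψ-surjective , δ-degreePreserving
    where open LongExactSequence K reciprocals G tri

open import Defs

theorem4p4 : (G : Graph) (e₁ e₂ e₃ : Graph.Edge G) → Graph.Triangle G e₁ e₂ e₃ →
    let E   = ⊤
        A   = E - e₁
        B   = E - e₂
        A∩B = E - e₁ - e₂
        φᵢ : ∀ i → H G i A∩B ⟶ H G i A ⊕ H G i B
        φᵢ = φ G {A∩B} {A} {B} (minus⊆ˡ E e₁ e₂) (minus⊆ʳ E e₁ e₂)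
        ψᵢ : ∀ i → H G i A ⊕ H G i B ⟶ H G i E
        ψᵢ = ψ G {A} {B} {E} (minus⊆ E e₁) (minus⊆ E e₂)
    in
    Σ[ δ ∈ (∀ i → H G (suc i) E ⟶ H G i A∩B) ]
      ( (∀ i → Exact (φᵢ i) (ψᵢ i))
      × (∀ i → Exact (ψᵢ (suc i)) (δ i))
      × (∀ i → Exact (δ i) (φᵢ i))
      × Surjective (ψᵢ zero)
      × (∀ i → DegreePreserving G (suc i) E i A∩B (δ i)) )
theorem4p4 = Scalars.longExactSequence ℂ ℂ-hasReciprocals
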